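{- Let $G$ be a finite Abelian group of order $n$. Then $\chi(G) = n$ if the Sylow 2-subgroups of $G$ are either trivial or non-cyclic, and $\chi(G) = n+2$ otherwise (i.e. if the Sylow 2-subgroups of $G$ are nontrivial and cyclic).
   Context: A latin square of order $n$ is an $n\times n$ array in which each row and each column is a permutation of a set of $n$ symbols. A partial transversal of a latin square is a set of cells containing at most one cell from each row, at most one cell from each column, and at most one cell containing each symbol. A $k$-coloring of a latin square $L$ is a partition of its cells into $k$ partial transversals, and the chromatic number $\chi(L)$ is the least $k$ for which a $k$-coloring exists (equivalently, the chromatic number of the graph on the cells of $L$ in which two distinct cells are adjacent iff they share a row, share a column, or contain the same symbol). For a finite group $G=\{g_0,\dots,g_{n-1}\}$, its Cayley table $L(G)$ is the latin square whose $(i,j)$ entry is $g_ig_j$; $\chi(G)$ denotes $\chi(L(G))$ (this does not depend on the ordering of $G$). -}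

module Defs where

open import Data.Nat using (ℕ; zero; suc; _^_; _<_; _+_)
open import Data.Nat.Divisibility using (_∣_)
open import Data.Fin using (Fin)
open import Data.Fin.Subset using (Subset; _∈_; ∣_∣)
open import Data.Product using (_×_; ∃; ∃-syntax; _,_)
open import Data.Sum using (_⊎_)
open import Relation.Nullary using (¬_)
open import Relation.Binary.PropositionalEquality using (_≡_; _≢_)
open import Algebra.Structures using (IsAbelianGroup)

-- A latin-square-like array of order n: (row, column) ↦ symbol.
Array : ℕ → Set
Array n = Fin n → Fin n → Fin n

-- A latin square: each row and each column is a permutation of the symbols
-- (for a finite square, injectivity of every row and column suffices).
IsLatin : ∀ {n} → Array n → Set
IsLatin {n} L =
  (∀ i j j' → L i j ≡ L i j' → j ≡ j') × (∀ i i' j → L i j ≡ L i' j → i ≡ i')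

Adjacent : ∀ {n} → Array n → (Fin n × Fin n) → (Fin n × Fin n) → Set
Adjacent L (i , j) (i' , j') =
  (i , j) ≢ (i' , j') × (i ≡ i' ⊎ j ≡ j' ⊎ L i j ≡ L i' j')

-- A k-coloring: every colour class is a partial transversal, i.e. adjacent
-- cells receive different colours.
IsColoring : ∀ {n} → Array n → (k : ℕ) → (Fin n × Fin n → Fin k) → Set
IsColoring {n} L k c = ∀ x y → Adjacent L x y → c x ≢ c y

Colorable : ∀ {n} → Array n → ℕ → Set
Colorable {n} L k = ∃[ c ] IsColoring L k c

ChromaticNumber : ∀ {n} → Array n → ℕ → Set
ChromaticNumber L k = Colorable L k × (∀ k' → k' < k → ¬ Colorable L k')

cayley : ∀ {n} → (Fin n → Fin n → Fin n) → Array n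
cayley _∙_ i j = i ∙ j

pow : ∀ {n} → (Fin n → Fin n → Fin n) → Fin n → Fin n → ℕ → Fin n
pow _∙_ ε g zero = ε
pow _∙_ ε g (suc m) = g ∙ pow _∙_ ε g m

module _ {n : ℕ} (_∙_ : Fin n → Fin n → Fin n) (ε : Fin n) (_⁻¹ : Fin n → Fin n) where

  IsSubgroup : Subset n → Set
  IsSubgroup S = (ε ∈ S) × (∀ x y → x ∈ S → y ∈ S → (x ∙ y) ∈ S)
               × (∀ x → x ∈ S → (x ⁻¹) ∈ S)

  IsSylow2 : Subset n → Set
  IsSylow2 S = IsSubgroup S × ∃[ a ] (∣ S ∣ ≡ 2 ^ a × (2 ^ a) ∣ n × ¬ ((2 ^ suc a) ∣ n))

  IsTrivial : Subset n → Set
  IsTrivial S = ∣ S ∣ ≡ 1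

  IsCyclic : Subset n → Set
  IsCyclic S = ∃[ g ] (g ∈ S × (∀ h → h ∈ S → ∃[ m ] pow _∙_ ε g m ≡ h))

{-# OPTIONS --safe #-}

-- Let σ be the sum of all elements of G. Pairing x with g - x and with x + s shows that σ is the
-- unique involution t if the Sylow 2-subgroups are cyclic and nontrivial, and zero otherwise.
--
-- If σ = 0, Hall's theorem (a sequence b with sum zero admits a bijection a with a + b bijective)
-- yields a complete mapping, and its translates are n disjoint transversals.
--
-- If σ = t there is no transversal, so a colour has at most n - 1 cells and n + 1 colours do not
-- cover n² cells. For the colouring with n + 2 colours, suppose first that G is cyclic: consecutive
-- diagonals y - x = 2j, 2j + 1 are split into two colours, each with a single clash; removing one
-- cell from each colour leaves n cells, which can be chosen to form two partial transversals.
-- Otherwise some odd prime p and subgroup M satisfy G/M ≅ ℤ/p × ℤ/p, where K(a, b) = (-b, a) has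
-- K² = -1. The blocks (w + h, w ± Kh) with h ≠ 0 then split into transversals, and a colouring of M
-- handles the diagonal blocks.
module Submission where

open import Defs
open import Level using (Level; 0ℓ)
open import Algebra.Bundles using (AbelianGroup; CommutativeMonoid)
import Algebra.Definitions.RawMonoid as RawMonoid
open import Algebra.Structures using (IsAbelianGroup)
open import Data.Bool using (Bool; true; false; if_then_else_; not; _∧_; _∨_; _xor_; T)
open import Data.Bool.Properties
  using (T-∧; T-∨; T?; T-irrelevant; not-involutive; not-injective; not-¬;
    ∨-comm; ∧-zeroʳ; ∧-identityʳ; xor-same; xor-comm; xor-identityʳ)
open import Data.Nat as ℕ
  using (ℕ; zero; suc; z≤n; s≤s; NonZero; _+_; _*_; _^_; _∸_; _/_; _%_; _<_; _≤_; _≡ᵇ_)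
import Data.Nat.Properties as ℕₚ
import Data.Nat.DivMod as DivMod
open import Data.Nat.Coprimality using (Coprime; coprime-Bézout)
open import Data.Nat.Divisibility using (_∣_; _∣?_; divides; *-cancelˡ-∣)
open import Data.Nat.GCD using (module Bézout)
open import Data.Nat.ListAction using (product)
open import Data.Nat.Primality using (Prime; prime⇒irreducible)
open import Data.Nat.Primality.Factorisation using (factorise; PrimeFactorisation)
open import Data.Fin as Fin using (Fin; zero; suc; toℕ; fromℕ<; punchOut; join; splitAt; combine; remQuot)
import Data.Fin.Properties as Finₚ
open import Data.Fin.Properties
  using (any?; all?; pigeonhole; injective⇒≤; punchOut-injective) renaming (_≟_ to _≟ᶠ_)
open import Data.Fin.Permutation using (Permutation; permutation)
open import Data.Fin.Subset using (Subset; _∈_; ∣_∣)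
open import Data.Fin.Subset.Properties using (_∈?_)
open import Data.Product using (Σ; ∃; ∃-syntax; _×_; _,_; proj₁; proj₂; uncurry)
open import Data.Sum using (_⊎_; inj₁; inj₂; [_,_]′)
open import Data.Sum.Properties using (inj₁-injective; inj₂-injective)
open import Data.Empty using (⊥; ⊥-elim)
open import Data.List as List using (List; []; _∷_)
open import Data.List.Membership.Propositional using (lose) renaming (_∈_ to _∈ˡ_)
open import Data.List.Membership.Propositional.Properties using (∈-allFin)
open import Data.List.Relation.Unary.All using (All; []; _∷_)
open import Data.List.Relation.Unary.Any as Any using (here; there)
open import Data.Vec as Vec using (Vec; []; _∷_; lookup; tabulate; zipWith; replicate; _[_]≔_)
open import Data.Vec.N-ary using (N-ary; _$ⁿ_)
open import Data.Vec.Properties using ([]=⇒lookup; lookup⇒[]=; lookup∘tabulate)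
open import Function using (_∘_; id; const)
open import Function.Bundles using (Equivalence)
open import Function.Definitions using (Injective)
open import Relation.Nullary using (¬_; Dec; yes; no; does; contradiction)
open import Relation.Nullary.Decidable
  using (dec-true; dec-false; map′; isYes; toWitness; fromWitness; ¬?; _×-dec_; _⊎-dec_; decidable-stable)
open import Relation.Unary using (Decidable)
open import Relation.Binary.Definitions using (DecidableEquality; tri<; tri≈; tri>)
open import Relation.Binary.PropositionalEquality as ≡
  using (_≡_; _≢_; refl; sym; trans; cong; cong₂; subst)
open import Relation.Binary.PropositionalEquality.WithK using (≡-irrelevant)


-- Linear reasoning in abelian groups

-- A map K with K² = -1 makes 1 + K and 1 - K invertible wherever 2 is, since their product is 2;
-- every disjointness claim about the blocks reduces to this. On ℤ/p itself, p odd, such a K exists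
-- only for p ≡ 1 mod 4, whereas the plane ℤ/p × ℤ/p has a quarter turn for every odd p. This is why
-- rank two is required and why cyclic groups need a direct construction. If G/pG is cyclic for
-- every odd prime p dividing the exponent, then G is cyclic: G/2G is cyclic because the even
-- elements are doubles, and the quotients are glued along the prime factorisation of the exponent.
-- The recursion passes from G to M, so the hypothesis is carried as `EvenStructure`: the involution
-- with a parity whose even elements are the doubles. As G/M has odd exponent, M inherits all of
-- this. The parity comes from a form of Euler's criterion: for a non-double g, the pairing of x
-- with g - x gives σ = (n/2)·g.

infixl 7 _⊕_ _⊖_
infix 8 ⊝_
infix 6 _≜_
infix 4 _⊢_

data Term (n : ℕ) : Set where
  var : Fin n → Term n
  𝟘 : Term n
  _⊕_ : Term n → Term n → Term n
  ⊝_ : Term n → Term n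

_⊖_ : ∀ {n} → Term n → Term n → Term n
s ⊖ t = s ⊕ ⊝ t

Equation : ℕ → Set
Equation n = Term n × Term n

_≜_ : ∀ {n} → Term n → Term n → Equation n
_≜_ = _,_

Entailment : ℕ → Set
Entailment n = List (Equation n) × Equation n

_⊢_ : ∀ {n} → List (Equation n) → Equation n → Entailment n
_⊢_ = _,_

-- Each term is kept as a difference of two vectors of natural coefficients, so that an identity
-- is checked by comparing vectors. Each listed hypothesis is used exactly once, in either direction.
module LinearSolver {c ℓ : Level} (𝒜 : AbelianGroup c ℓ) where
  open AbelianGroup 𝒜 renaming (refl to ≈-refl; sym to ≈-sym; trans to ≈-trans)
  open import Algebra.Properties.CommutativeMonoid.Mult commutativeMonoid
    using (×-homo-+; ×-homo-1) renaming (_×_ to _·_)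
  open import Algebra.Properties.CommutativeSemigroup commutativeSemigroup using (interchange)
  open import Algebra.Properties.Group group using (∙-cancelʳ)
  open import Relation.Binary.Reasoning.Setoid setoid

  ⟦_⟧ : ∀ {n} → Term n → Vec Carrier n → Carrier
  ⟦ var i ⟧ ρ = lookup ρ i
  ⟦ 𝟘 ⟧ ρ = ε
  ⟦ s ⊕ t ⟧ ρ = ⟦ s ⟧ ρ ∙ ⟦ t ⟧ ρ
  ⟦ ⊝ t ⟧ ρ = ⟦ t ⟧ ρ ⁻¹

  Holds : ∀ {n} → Vec Carrier n → Equation n → Set ℓ
  Holds ρ (s , t) = ⟦ s ⟧ ρ ≈ ⟦ t ⟧ ρ

  private
    Coeffs : ℕ → Set
    Coeffs = Vec ℕ

    _⊞_ : ∀ {n} → Coeffs n → Coeffs n → Coeffs n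
    _⊞_ = zipWith ℕ._+_

    unit : ∀ {n} → Fin n → Coeffs n
    unit i = replicate _ 0 [ i ]≔ 1

    pos neg : ∀ {n} → Term n → Coeffs n
    pos (var i) = unit i
    pos 𝟘 = replicate _ 0
    pos (s ⊕ t) = pos s ⊞ pos t
    pos (⊝ t) = neg t
    neg (var i) = replicate _ 0
    neg 𝟘 = replicate _ 0
    neg (s ⊕ t) = neg s ⊞ neg t
    neg (⊝ t) = pos t

    eval : ∀ {n} → Coeffs n → Vec Carrier n → Carrier
    eval [] [] = ε
    eval (k ∷ ks) (x ∷ xs) = k · x ∙ eval ks xs

    eval-0 : ∀ {n} (ρ : Vec Carrier n) → eval (replicate n 0) ρ ≈ ε
    eval-0 [] = ≈-refl
    eval-0 (x ∷ ρ) = ≈-trans (identityˡ _) (eval-0 ρ)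

    eval-unit : ∀ {n} (i : Fin n) ρ → eval (unit i) ρ ≈ lookup ρ i
    eval-unit zero (x ∷ ρ) = ≈-trans (∙-cong (×-homo-1 x) (eval-0 ρ)) (identityʳ x)
    eval-unit (suc i) (x ∷ ρ) = ≈-trans (identityˡ _) (eval-unit i ρ)

    eval-⊞ : ∀ {n} (u v : Coeffs n) ρ → eval (u ⊞ v) ρ ≈ eval u ρ ∙ eval v ρ
    eval-⊞ [] [] [] = ≈-sym (identityˡ ε)
    eval-⊞ (k ∷ u) (l ∷ v) (x ∷ ρ) =
      ≈-trans (∙-cong (×-homo-+ x k l) (eval-⊞ u v ρ)) (interchange _ _ _ _)

    -- Moving the negated occurrences to the other side leaves natural coefficients only, so no
    -- integer multiples have to be evaluated.
    split : ∀ {n} (t : Term n) ρ → ⟦ t ⟧ ρ ∙ eval (neg t) ρ ≈ eval (pos t) ρ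
    split (var i) ρ = ≈-trans (∙-congˡ (eval-0 ρ)) (≈-trans (identityʳ _) (≈-sym (eval-unit i ρ)))
    split 𝟘 ρ = identityˡ _
    split (s ⊕ t) ρ = begin
      (⟦ s ⟧ ρ ∙ ⟦ t ⟧ ρ) ∙ eval (neg s ⊞ neg t) ρ                ≈⟨ ∙-congˡ (eval-⊞ (neg s) (neg t) ρ) ⟩
      (⟦ s ⟧ ρ ∙ ⟦ t ⟧ ρ) ∙ (eval (neg s) ρ ∙ eval (neg t) ρ)   ≈⟨ interchange _ _ _ _ ⟩
      (⟦ s ⟧ ρ ∙ eval (neg s) ρ) ∙ (⟦ t ⟧ ρ ∙ eval (neg t) ρ)   ≈⟨ ∙-cong (split s ρ) (split t ρ) ⟩
      eval (pos s) ρ ∙ eval (pos t) ρ                              ≈⟨ eval-⊞ (pos s) (pos t) ρ ⟨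
      eval (pos s ⊞ pos t) ρ                                       ∎
    split (⊝ t) ρ = begin
      ⟦ t ⟧ ρ ⁻¹ ∙ eval (pos t) ρ                      ≈⟨ ∙-congˡ (split t ρ) ⟨
      ⟦ t ⟧ ρ ⁻¹ ∙ (⟦ t ⟧ ρ ∙ eval (neg t) ρ)         ≈⟨ assoc _ _ _ ⟨
      (⟦ t ⟧ ρ ⁻¹ ∙ ⟦ t ⟧ ρ) ∙ eval (neg t) ρ         ≈⟨ ∙-congʳ (inverseˡ _) ⟩
      ε ∙ eval (neg t) ρ                                ≈⟨ identityˡ _ ⟩
      eval (neg t) ρ                                    ∎

    by-coeffs : ∀ {n} (s t : Term n) → pos s ⊞ neg t ≡ pos t ⊞ neg s → ∀ ρ → ⟦ s ⟧ ρ ≈ ⟦ t ⟧ ρ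
    by-coeffs s t eq ρ = ∙-cancelʳ (eval (neg s) ρ ∙ eval (neg t) ρ) _ _ (begin
      ⟦ s ⟧ ρ ∙ (eval (neg s) ρ ∙ eval (neg t) ρ)   ≈⟨ assoc _ _ _ ⟨
      (⟦ s ⟧ ρ ∙ eval (neg s) ρ) ∙ eval (neg t) ρ   ≈⟨ ∙-congʳ (split s ρ) ⟩
      eval (pos s) ρ ∙ eval (neg t) ρ                ≈⟨ eval-⊞ (pos s) (neg t) ρ ⟨
      eval (pos s ⊞ neg t) ρ                         ≡⟨ cong (λ u → eval u ρ) eq ⟩
      eval (pos t ⊞ neg s) ρ                         ≈⟨ eval-⊞ (pos t) (neg s) ρ ⟩
      eval (pos t) ρ ∙ eval (neg s) ρ                ≈⟨ ∙-congʳ (split t ρ) ⟨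
      (⟦ t ⟧ ρ ∙ eval (neg t) ρ) ∙ eval (neg s) ρ   ≈⟨ assoc _ _ _ ⟩
      ⟦ t ⟧ ρ ∙ (eval (neg t) ρ ∙ eval (neg s) ρ)   ≈⟨ ∙-congˡ (comm _ _) ⟩
      ⟦ t ⟧ ρ ∙ (eval (neg s) ρ ∙ eval (neg t) ρ)   ∎)

    same : ∀ {n} → Coeffs n → Coeffs n → Bool
    same [] [] = true
    same (k ∷ u) (l ∷ v) = (k ≡ᵇ l) ∧ same u v

    same-sound : ∀ {n} (u v : Coeffs n) → T (same u v) → u ≡ v
    same-sound [] [] _ = refl
    same-sound (k ∷ u) (l ∷ v) ok =
      let p , q = T-∧ .Equivalence.to ok in cong₂ _∷_ (ℕₚ.≡ᵇ⇒≡ k l p) (same-sound u v q)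

    check : ∀ {n} → Term n → Term n → List (Equation n) → Bool
    check s t [] = same (pos s ⊞ neg t) (pos t ⊞ neg s)
    check s t ((a , b) ∷ hs) = check (s ⊕ b) (t ⊕ a) hs ∨ check (s ⊕ a) (t ⊕ b) hs

    check-sound : ∀ {n} (s t : Term n) hs ρ → T (check s t hs) → All (Holds ρ) hs → ⟦ s ⟧ ρ ≈ ⟦ t ⟧ ρ
    check-sound s t [] ρ ok [] = by-coeffs s t (same-sound _ _ ok) ρ
    check-sound s t ((a , b) ∷ hs) ρ ok (h ∷ ps) with T-∨ .Equivalence.to ok
    ... | inj₁ ok₁ = ∙-cancelʳ (⟦ b ⟧ ρ) _ _ (≈-trans (check-sound (s ⊕ b) (t ⊕ a) hs ρ ok₁ ps) (∙-congˡ h))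
    ... | inj₂ ok₂ = ∙-cancelʳ (⟦ b ⟧ ρ) _ _ (≈-trans (∙-congˡ (≈-sym h))
      (check-sound (s ⊕ a) (t ⊕ b) hs ρ ok₂ ps))

  opaque
    solve : ∀ n (f : N-ary n (Term n) (Entailment n)) →
            let e = f $ⁿ Vec.map var (Vec.allFin n) in
            {T (check (proj₁ (proj₂ e)) (proj₂ (proj₂ e)) (proj₁ e))} →
            ∀ ρ → All (Holds ρ) (proj₁ e) → Holds ρ (proj₂ e)
    solve n f {ok} ρ ps = check-sound _ _ _ ρ ok ps

-- Hall's theorem on differences of permutations

least : {P : ℕ → Set} → Decidable P → ∀ {N} → P N → ∃[ m ] (P m × (∀ i → i ℕ.< m → ¬ P i))
least P? {zero} p = zero , p , λ _ ()
least {P} P? {suc N} p with P? 0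
... | yes p₀ = 0 , p₀ , λ _ ()
... | no ¬p₀ with least (P? ∘ suc) p
...   | m , pm , below = suc m , pm , λ { zero _ → ¬p₀ ; (suc i) (s≤s i<m) → below i i<m }

does⇒ : ∀ {P : Set} (P? : Dec P) → does P? ≡ true → P
does⇒ (yes p) _ = p

opaque
  injective⇒surjective : ∀ {n} {f : Fin n → Fin n} → Injective _≡_ _≡_ f → ∀ y → ∃[ x ] f x ≡ y
  injective⇒surjective {suc n} {f} inj y with any? (λ x → f x ≟ᶠ y)
  ... | yes found = found
  ... | no missing = contradiction (injective⇒≤ {f = λ x → punchOut (y≢f x)} squeeze) ℕₚ.1+n≰n
    where
    y≢f : ∀ x → y ≢ f x
    y≢f x eq = missing (x , sym eq)
    squeeze : Injective _≡_ _≡_ (λ x → punchOut (y≢f x))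
    squeeze {i} {j} eq = inj (punchOut-injective (y≢f i) (y≢f j) eq)

module _ {n : ℕ} (p q : Fin n) where
  opaque
    swap : Fin n → Fin n
    swap x with x ≟ᶠ p | x ≟ᶠ q
    ... | yes _ | _ = q
    ... | no _ | yes _ = p
    ... | no _ | no _ = x

    swap-p : swap p ≡ q
    swap-p with p ≟ᶠ p | p ≟ᶠ q
    ... | yes _ | _ = refl
    ... | no p≢p | _ = contradiction refl p≢p

    swap-q : swap q ≡ p
    swap-q with q ≟ᶠ p | q ≟ᶠ q
    ... | yes q≡p | _ = q≡p
    ... | no _ | yes _ = refl
    ... | no _ | no q≢q = contradiction refl q≢q

    swap-other : ∀ {x} → x ≢ p → x ≢ q → swap x ≡ x
    swap-other {x} x≢p x≢q with x ≟ᶠ p | x ≟ᶠ q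
    ... | yes x≡p | _ = contradiction x≡p x≢p
    ... | no _ | yes x≡q = contradiction x≡q x≢q
    ... | no _ | no _ = refl

    swap-involutive : ∀ x → swap (swap x) ≡ x
    swap-involutive x with x ≟ᶠ p | x ≟ᶠ q
    ... | yes refl | _ = swap-q
    ... | no _ | yes refl = swap-p
    ... | no x≢p | no x≢q = swap-other x≢p x≢q

-- Exactly one of f and swap p q ∘ f keeps p out of the cycle through q: composing with a
-- transposition splits or merges cycles.
module Orbit {n : ℕ} {f : Fin n → Fin n} (f-inj : Injective _≡_ _≡_ f) {p q : Fin n} (p≢q : p ≢ q) where

  iter : ℕ → Fin n
  iter zero = q
  iter (suc k) = f (iter k)

  iter-cancel : ∀ i d → iter i ≡ iter (i ℕ.+ d) → q ≡ iter d
  iter-cancel zero d eq = eq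
  iter-cancel (suc i) d eq = iter-cancel i d (f-inj eq)

  -- Two iterates coincide by the pigeonhole principle, and cancelling `f` moves the coincidence
  -- back to `q`.
  return : ∃[ N ] (iter (suc N) ≡ p ⊎ iter (suc N) ≡ q)
  return with pigeonhole (ℕₚ.n<1+n n) (iter ∘ toℕ)
  ... | i , j , i<j , eq = N , inj₂ (sym (iter-cancel (toℕ i) (suc N) (trans eq (cong iter j≡))))
    where
    N = toℕ j ℕ.∸ suc (toℕ i)
    j≡ : toℕ j ≡ toℕ i ℕ.+ suc N
    j≡ = sym (trans (ℕₚ.+-suc (toℕ i) N) (ℕₚ.m+[n∸m]≡n i<j))

  -- `member` is the stretch of iterates from `q` up to the first arrival at `p` or `q`. An arrival
  -- at `q` closes a cycle, and `s` is the identity; after an arrival at `p`, the transposition `s`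
  -- redirects it to `q`. Either way `s ∘ f` maps the stretch into itself.
  record Cycle : Set where
    field
      member : Fin n → Bool
      q∈ : member q ≡ true
      p∉ : member p ≡ false
      s : Fin n → Fin n
      s-involutive : ∀ x → s (s x) ≡ x
      s-other : ∀ {x} → x ≢ p → x ≢ q → s x ≡ x
      closed : ∀ {x} → member x ≡ true → member (s (f x)) ≡ true
      s-split : ∀ {x} → member x ≡ true →
                (f x ≢ p × f x ≢ q) ⊎ (s (f x) ≡ q × ((f x ≡ q × s p ≡ p) ⊎ (f x ≡ p × s p ≡ q)))

  opaque
    cycle : Cycle
    cycle with least (λ k → (iter (suc k) ≟ᶠ p) ⊎-dec (iter (suc k) ≟ᶠ q)) {proj₁ return} (proj₂ return)
    ... | m , last , before = build last
      where
      On : Fin n → Set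
      On x = ∃[ i ] x ≡ iter (toℕ {suc m} i)
      on? : Decidable On
      on? x = any? (λ i → x ≟ᶠ iter (toℕ i))
      member : Fin n → Bool
      member x = does (on? x)
      to : ∀ {x} → On x → member x ≡ true
      to {x} = dec-true (on? x)
      from : ∀ {x} → member x ≡ true → On x
      from {x} = does⇒ (on? x)
      at : ∀ k → k ℕ.≤ m → On (iter k)
      at k k≤m = Fin.fromℕ< (s≤s k≤m) , cong iter (sym (Finₚ.toℕ-fromℕ< (s≤s k≤m)))
      p-off : ¬ On p
      p-off (zero , eq) = p≢q eq
      p-off (suc i , eq) = before (toℕ i) (Finₚ.toℕ<n i) (inj₁ (sym eq))
      step : ∀ {x} → On x → (On (f x) × f x ≢ p × f x ≢ q) ⊎ f x ≡ iter (suc m)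
      step (i , refl) with ℕₚ.m≤n⇒m<n∨m≡n (ℕₚ.≤-pred (Finₚ.toℕ<n i))
      ... | inj₁ i<m = inj₁ (at (suc (toℕ i)) i<m , (before _ i<m ∘ inj₁) , (before _ i<m ∘ inj₂))
      ... | inj₂ i≡m = inj₂ (cong (iter ∘ suc) i≡m)
      build : iter (suc m) ≡ p ⊎ iter (suc m) ≡ q → Cycle
      build (inj₂ end) = record
        { member = member ; q∈ = to (at 0 z≤n) ; p∉ = dec-false (on? p) p-off
        ; s = id ; s-involutive = λ _ → refl ; s-other = λ _ _ → refl
        ; closed = λ {x} x∈ → [ to ∘ proj₁ , (λ eq → to (subst On (sym (trans eq end)) (at 0 z≤n))) ]′
          (step (from {x} x∈))
        ; s-split = λ {x} x∈ → [ inj₁ ∘ proj₂ , (λ eq → inj₂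
          (trans eq end , inj₁ (trans eq end , refl))) ]′ (step (from {x} x∈)) }
      build (inj₁ end) = record
        { member = member ; q∈ = to (at 0 z≤n) ; p∉ = dec-false (on? p) p-off
        ; s = swap p q ; s-involutive = swap-involutive p q ; s-other = swap-other p q
        ; closed = λ {x} x∈ →
            [ (λ (o , x≢p , x≢q) → to (subst On (sym (swap-other p q x≢p x≢q)) o))
            , (λ eq → to (subst On (sym (turn eq)) (at 0 z≤n))) ]′ (step (from {x} x∈))
        ; s-split = λ {x} x∈ → [ inj₁ ∘ proj₂ , (λ eq → inj₂
          (turn eq , inj₂ (trans eq end , swap-p p q))) ]′ (step (from {x} x∈)) }
        where
        turn : ∀ {y} → y ≡ iter (suc m) → swap p q y ≡ q
        turn eq = trans (cong (swap p q) (trans eq end)) (swap-p p q)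

true≢false : true ≢ false
true≢false ()

module Hall {n : ℕ} {_∙_ : Fin n → Fin n → Fin n} {ε : Fin n} {_⁻¹ : Fin n → Fin n}
            (isAb : IsAbelianGroup _≡_ _∙_ ε _⁻¹) where

  𝒢 : AbelianGroup 0ℓ 0ℓ
  𝒢 = record { isAbelianGroup = isAb }

  open LinearSolver 𝒢

  Solvable : (Fin n → Fin n) → Set
  Solvable b = ∃[ a ] (Injective _≡_ _≡_ a × Injective _≡_ _≡_ (λ i → a i ∙ b i))

  -- The elementary move for Hall's theorem: two entries change and the total does not. The solution
  -- `a` is rearranged along one cycle, so that the new sums are the old sums `c` in another order.
  module Exchange {b b′ : Fin n → Fin n} {p q : Fin n} (p≢q : p ≢ q)
                  (agree : ∀ {i} → i ≢ p → i ≢ q → b i ≡ b′ i)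
                  (total : b p ∙ b q ≡ b′ p ∙ b′ q)
                  (solvable : Solvable b) where

    a = proj₁ solvable
    a-inj = proj₁ (proj₂ solvable)
    c : Fin n → Fin n
    c i = a i ∙ b i
    c-inj : Injective _≡_ _≡_ c
    c-inj = proj₂ (proj₂ solvable)

    -- With this constant `a p ∙ b′ p` equals `C - a q`, which is `c (f q)`: the entry at `p` stays
    -- in place and takes over the sum of the place `f q`.
    C : Fin n
    C = (a p ∙ a q) ∙ b′ p

    f : Fin n → Fin n
    f i = proj₁ (injective⇒surjective c-inj (C ∙ (a i ⁻¹)))

    c∘f : ∀ i → c (f i) ≡ C ∙ (a i ⁻¹)
    c∘f i = proj₂ (injective⇒surjective c-inj (C ∙ (a i ⁻¹)))

    f-inj : Injective _≡_ _≡_ f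
    f-inj {i} {j} eq = a-inj (solve 3 (λ x y z → z ⊖ x ≜ z ⊖ y ∷ [] ⊢ y ≜ x) (a j ∷ a i ∷ C ∷ [])
      (trans (sym (c∘f j)) (trans (cong c (sym eq)) (c∘f i)) ∷ []))

    open Orbit f-inj p≢q
    open Cycle cycle

    h : Fin n → Fin n
    h x = if member x then s (f x) else x

    s-inj : Injective _≡_ _≡_ s
    s-inj {x} {y} eq = trans (sym (s-involutive x)) (trans (cong s eq) (s-involutive y))

    h-in : ∀ {x} → member x ≡ true → h x ≡ s (f x)
    h-in x∈ rewrite x∈ = refl

    h-out : ∀ {x} → member x ≡ false → h x ≡ x
    h-out x∉ rewrite x∉ = refl

    h-inj : Injective _≡_ _≡_ h
    h-inj {x} {y} eq with member x in x∈ | member y in y∈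
    ... | true  | true  = f-inj (s-inj eq)
    ... | false | false = eq
    ... | true  | false = contradiction (trans (sym (trans (cong member (sym eq))
      (closed x∈))) y∈) true≢false
    ... | false | true  = contradiction (trans (sym (trans (cong member eq) (closed y∈))) x∈) true≢false

    h⁻ : Fin n → Fin n
    h⁻ y = proj₁ (injective⇒surjective h-inj y)

    h∘h⁻ : ∀ y → h (h⁻ y) ≡ y
    h∘h⁻ y = proj₂ (injective⇒surjective h-inj y)

    h⁻-inj : Injective _≡_ _≡_ h⁻
    h⁻-inj {x} {y} eq = trans (sym (h∘h⁻ x)) (trans (cong h eq) (h∘h⁻ y))

    -- The place whose old sum reappears at `x`. Written as a composite of permutations, it is
    -- injective without any case analysis.
    γ : Fin n → Fin n
    γ x = s (h (swap p q x))

    γ-inj : Injective _≡_ _≡_ γ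
    γ-inj {x} {y} eq = trans (sym (swap-involutive p q x))
      (trans (cong (swap p q) (h-inj (s-inj eq))) (swap-involutive p q y))

    γ-p : γ p ≡ f q
    γ-p = trans (cong (s ∘ h) (swap-p p q)) (trans (cong s (h-in q∈)) (s-involutive (f q)))

    γ-q : γ q ≡ s p
    γ-q = cong s (trans (cong h (swap-q p q)) (h-out p∉))

    γ-in : ∀ {x} → member x ≡ true → x ≢ q → γ x ≡ f x
    γ-in {x} x∈ x≢q = trans (cong (s ∘ h) (swap-other p q x≢p x≢q))
      (trans (cong s (h-in x∈)) (s-involutive (f x)))
      where
      x≢p : x ≢ p
      x≢p refl = true≢false (trans (sym x∈) p∉)

    γ-out : ∀ {x} → member x ≡ false → x ≢ p → γ x ≡ x
    γ-out {x} x∉ x≢p = trans (cong (s ∘ h) (swap-other p q x≢p x≢q))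
      (trans (cong s (h-out x∉)) (s-other x≢p x≢q))
      where
      x≢q : x ≢ q
      x≢q refl = true≢false (trans (sym q∈) x∉)

    aᵢ≡ : ∀ i → a i ≡ C ∙ (c (f i) ⁻¹)
    aᵢ≡ i = solve 3 (λ x y z → y ≜ z ⊖ x ∷ [] ⊢ x ≜ z ⊖ y) (a i ∷ c (f i) ∷ C ∷ []) (c∘f i ∷ [])

    -- When `a i` moves to `x = f i`, the sum `a i ∙ b x` is `C - a x = c (f x)`, again an old one.
    -- Outside the stretch only `p` is affected, by the choice of `C`; where the stretch closes, the
    -- equality of totals gives `c p` or `c q`.
    moved : ∀ i → a i ∙ b′ (h i) ≡ c (γ (h i))
    moved i with member i in i∈
    ... | false with i ≟ᶠ p
    ...   | yes refl = trans (solve 3 (λ x y z → [] ⊢ x ⊕ z ≜ x ⊕ y ⊕ z ⊖ y) (a p ∷ a q ∷ b′ p ∷ []) [])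
                             (trans (sym (c∘f q)) (cong c (sym γ-p)))
    ...   | no i≢p = trans (cong (a i ∙_) (sym (agree i≢p i≢q))) (cong c (sym (γ-out i∈ i≢p)))
      where
      i≢q : i ≢ q
      i≢q refl = true≢false (trans (sym q∈) i∈)
    moved i | true with s-split i∈
    ... | inj₁ (fi≢p , fi≢q) = trans (cong (a i ∙_) (sym (agree x≢p x≢q)))
        (trans (solve 4 (λ w z x y → w ≜ z ⊖ (x ⊕ y) ∷ [] ⊢ w ⊕ y ≜ z ⊖ x) (a i ∷ C ∷ a x ∷ b x ∷ [])
                        (trans (aᵢ≡ i) (cong (λ y → C ∙ (c y ⁻¹)) (sym x≡)) ∷ []))
               (trans (sym (c∘f x)) (cong c (sym (γ-in (closed i∈) x≢q)))))
      where
      x = s (f i)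
      x≡ : x ≡ f i
      x≡ = s-other fi≢p fi≢q
      x≢p : x ≢ p
      x≢p eq = fi≢p (trans (sym x≡) eq)
      x≢q : x ≢ q
      x≢q eq = fi≢q (trans (sym x≡) eq)
    ... | inj₂ (x≡q , inj₁ (fi≡q , sp≡p)) = trans (cong (λ y → a i ∙ b′ y) x≡q)
        (trans (solve 7 (λ ai ap aq bp bq bp′ bq′ →
                  ai ≜ ap ⊕ aq ⊕ bp′ ⊖ (aq ⊕ bq) ∷ bp ⊕ bq ≜ bp′ ⊕ bq′ ∷ [] ⊢ ai ⊕ bq′ ≜ ap ⊕ bp)
                  (a i ∷ a p ∷ a q ∷ b p ∷ b q ∷ b′ p ∷ b′ q ∷ [])
                  (trans (aᵢ≡ i) (cong (λ y → C ∙ (c y ⁻¹)) fi≡q) ∷ total ∷ []))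
               (cong c (sym (trans (cong γ x≡q) (trans γ-q sp≡p)))))
    ... | inj₂ (x≡q , inj₂ (fi≡p , sp≡q)) = trans (cong (λ y → a i ∙ b′ y) x≡q)
        (trans (solve 7 (λ ai ap aq bp bq bp′ bq′ →
                  ai ≜ ap ⊕ aq ⊕ bp′ ⊖ (ap ⊕ bp) ∷ bp ⊕ bq ≜ bp′ ⊕ bq′ ∷ [] ⊢ ai ⊕ bq′ ≜ aq ⊕ bq)
                  (a i ∷ a p ∷ a q ∷ b p ∷ b q ∷ b′ p ∷ b′ q ∷ [])
                  (trans (aᵢ≡ i) (cong (λ y → C ∙ (c y ⁻¹)) fi≡p) ∷ total ∷ []))
               (cong c (sym (trans (cong γ x≡q) (trans γ-q sp≡q)))))

    exchanged : Solvable b′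
    exchanged = a ∘ h⁻ , h⁻-inj ∘ a-inj , λ {x} {y} eq → γ-inj
      (c-inj (trans (sym (value x)) (trans eq (value y))))
      where
      value : ∀ x → a (h⁻ x) ∙ b′ x ≡ c (γ x)
      value x = subst (λ y → a (h⁻ x) ∙ b′ y ≡ c (γ y)) (h∘h⁻ x) (moved (h⁻ x))

module _ {m : ℕ} {_∙_ : Fin (suc m) → Fin (suc m) → Fin (suc m)} {ε : Fin (suc m)} {_⁻¹ : Fin (suc m) → Fin (suc m)}
         (isAb : IsAbelianGroup _≡_ _∙_ ε _⁻¹) where

  open Hall isAb
  open AbelianGroup 𝒢 using (commutativeMonoid; identityʳ; identityˡ)
  open LinearSolver 𝒢
  open import Algebra.Properties.CommutativeMonoid.Sum commutativeMonoid
    using (sum; sum-cong-≗; sum-replicate-zero)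

  -- Entries are switched on one at a time; index 0 absorbs the change of the sum.
  private
    clear : ∀ {l} → Fin l → (Fin l → Fin (suc m)) → Fin l → Fin (suc m)
    clear i b j with j ≟ᶠ i
    ... | yes _ = ε
    ... | no _ = b j

    sum-clear : ∀ {l} (i : Fin l) (b : Fin l → Fin (suc m)) → b i ∙ sum (clear i b) ≡ sum b
    sum-clear {suc l} zero b = cong (b zero ∙_) (identityˡ _)
    sum-clear {suc l} (suc i) b = solve 4 (λ x y u v → x ⊕ u ≜ v ∷ [] ⊢ x ⊕ (y ⊕ u) ≜ y ⊕ v)
      (b (suc i) ∷ b zero ∷ sum (λ j → clear (suc i) b (suc j)) ∷ sum (λ j → b (suc j)) ∷ [])
      (trans (cong (b (suc i) ∙_) (sum-cong-≗ shift)) (sum-clear i (λ j → b (suc j))) ∷ [])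
      where
      shift : ∀ j → clear (suc i) b (suc j) ≡ clear i (λ j → b (suc j)) j
      shift j with j ≟ᶠ i
      ... | yes _ = refl
      ... | no _ = refl

    module Switch (b : Fin (suc m) → Fin (suc m)) (i : Fin m) where
      cleared : Fin (suc m) → Fin (suc m)
      cleared zero = b zero ∙ b (suc i)
      cleared (suc j) = clear i (λ j → b (suc j)) j

      at-i : clear i (λ j → b (suc j)) i ≡ ε
      at-i with i ≟ᶠ i
      ... | yes _ = refl
      ... | no i≢i = contradiction refl i≢i

      off-i : ∀ {j} → j ≢ i → clear i (λ j → b (suc j)) j ≡ b (suc j)
      off-i {j} j≢i with j ≟ᶠ i
      ... | yes j≡i = contradiction j≡i j≢i
      ... | no _ = refl

      switch : Solvable cleared → Solvable b
      switch sol = Exchange.exchanged {b = cleared} {b′ = b} {p = zero} {q = suc i} (λ ()) agree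
        (trans (cong ((b zero ∙ b (suc i)) ∙_) at-i) (identityʳ _)) sol
        where
        agree : ∀ {j} → j ≢ zero → j ≢ suc i → cleared j ≡ b j
        agree {zero} j≢0 _ = contradiction refl j≢0
        agree {suc j} _ j≢i = off-i (j≢i ∘ cong suc)

      sum-cleared : sum cleared ≡ sum b
      sum-cleared = solve 4 (λ x y u v → y ⊕ u ≜ v ∷ [] ⊢ x ⊕ y ⊕ u ≜ x ⊕ v)
        (b zero ∷ b (suc i) ∷ sum (clear i (λ j → b (suc j))) ∷ sum (λ j → b (suc j)) ∷ [])
        (sum-clear i (λ j → b (suc j)) ∷ [])

    support⇒solvable : ∀ k (b : Fin (suc m) → Fin (suc m)) → sum b ≡ ε →
                       (∀ i → k ℕ.≤ toℕ i → b (suc i) ≡ ε) → Solvable b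
    support⇒solvable zero b ∑b≡ε off =
      -- Only index 0 is left, and the zero sum forces this entry to vanish as well.
      id , id , λ {x} {y} eq → trans (sym (b≡ε x)) (trans eq (b≡ε y))
      where
      tail≡ε : sum (λ i → b (suc i)) ≡ ε
      tail≡ε = trans (sum-cong-≗ (λ i → off i z≤n)) (sum-replicate-zero m)
      b≡ε : ∀ x → x ∙ b x ≡ x
      b≡ε zero = trans (cong (zero ∙_) (trans (sym (identityʳ (b zero)))
        (trans (cong (b zero ∙_) (sym tail≡ε)) ∑b≡ε))) (identityʳ _)
      b≡ε (suc i) = trans (cong (suc i ∙_) (off i z≤n)) (identityʳ _)
    support⇒solvable (suc k) b ∑b≡ε off with k ℕₚ.<? m
    ... | no k≮m = support⇒solvable k b ∑b≡ε
            (λ i k≤i → contradiction (ℕₚ.≤-<-trans k≤i (Finₚ.toℕ<n i)) k≮m)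
    ... | yes k<m = switch (support⇒solvable k cleared (trans sum-cleared ∑b≡ε) off′)
      where
      i = Fin.fromℕ< k<m
      open Switch b i
      off′ : ∀ j → k ℕ.≤ toℕ j → clear i (λ j → b (suc j)) j ≡ ε
      off′ j k≤j with j ≟ᶠ i
      ... | yes _ = refl
      ... | no j≢i = off j (ℕₚ.≤∧≢⇒< k≤j (λ k≡j → j≢i (Finₚ.toℕ-injective
        (trans (sym k≡j) (sym (Finₚ.toℕ-fromℕ< k<m))))))

  sum-zero⇒solvable : ∀ b → sum b ≡ ε → Solvable b
  sum-zero⇒solvable b ∑b≡ε = support⇒solvable m b ∑b≡ε
    (λ i m≤i → contradiction (Finₚ.toℕ<n i) (ℕₚ.≤⇒≯ m≤i))

-- Finite abelian groups and their subgroups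

odd : ℕ → Bool
odd zero = false
odd (suc k) = not (odd k)

-- The carrier is abstract because the recursion passes to subgroups. The list may repeat elements:
-- it serves for searching, and its length bounds the recursion. The exponent is any positive number
-- that kills the group.
record FiniteAbelianGroup : Set₁ where
  infixl 7 _∙_ _-_
  infix 8 _⁻¹
  infix 4 _≟_
  field
    Carrier : Set
    _∙_ : Carrier → Carrier → Carrier
    ε : Carrier
    _⁻¹ : Carrier → Carrier
    isAbelianGroup : IsAbelianGroup _≡_ _∙_ ε _⁻¹
    _≟_ : DecidableEquality Carrier
    elements : List Carrier
    complete : ∀ x → x ∈ˡ elements

  𝒢 : AbelianGroup 0ℓ 0ℓ
  𝒢 = record { isAbelianGroup = isAbelianGroup }

  field
    exponent : ℕ
    exponent≢0 : NonZero exponent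
    exponent·x≡ε : ∀ x → RawMonoid._×_ (AbelianGroup.rawMonoid 𝒢) exponent x ≡ ε

  open import Algebra.Properties.CommutativeMonoid.Mult (AbelianGroup.commutativeMonoid 𝒢) public
    using (×-homo-+; ×-assocˡ; ×-distrib-+) renaming (_×_ to _·_)

  _-_ : Carrier → Carrier → Carrier
  x - y = x ∙ (y ⁻¹)

  Share : Carrier → Carrier → Carrier → Carrier → Set
  Share x y x′ y′ = x ≡ x′ ⊎ y ≡ y′ ⊎ x ∙ y ≡ x′ ∙ y′

  Share-sym : ∀ {x y x′ y′} → Share x y x′ y′ → Share x′ y′ x y
  Share-sym (inj₁ p) = inj₁ (sym p)
  Share-sym (inj₂ (inj₁ p)) = inj₂ (inj₁ (sym p))
  Share-sym (inj₂ (inj₂ p)) = inj₂ (inj₂ (sym p))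

  open AbelianGroup 𝒢 public using (identityˡ; identityʳ; inverseʳ; inverseˡ; assoc; comm)

T-≡ : ∀ {a b} → (T a → T b) → (T b → T a) → a ≡ b
T-≡ {false} {false} _ _ = refl
T-≡ {false} {true} _ g = ⊥-elim (g _)
T-≡ {true} {false} f _ = ⊥-elim (f _)
T-≡ {true} {true} _ _ = refl

T⇒≡true : ∀ {a} → T a → a ≡ true
T⇒≡true {true} _ = refl

Σ-T-≡ : ∀ {A : Set} {m : A → Bool} {x y : Σ A (T ∘ m)} → proj₁ x ≡ proj₁ y → x ≡ y
Σ-T-≡ {x = x , p} {.x , q} refl = cong (x ,_) (T-irrelevant p q)

xor-cancelʳ : ∀ c {a b} → a xor c ≡ b xor c → a ≡ b
xor-cancelʳ false {a} {b} eq = trans (sym (xor-identityʳ a)) (trans eq (xor-identityʳ b))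
xor-cancelʳ true {a} {b} eq = not-injective (trans (xor-comm true a) (trans eq (xor-comm b true)))

module _ (G : FiniteAbelianGroup) where
  open FiniteAbelianGroup G

  private
    search : (Carrier → Bool) → List Carrier → Carrier
    search f [] = ε
    search f (x ∷ xs) = if f x then x else search f xs

  -- The first hit depends only on the values of `f`, so congruent arguments lead to choices that
  -- are equal and not merely congruent. The default `ε` is reached by failure only if nothing
  -- satisfies `f`.
  pick : (Carrier → Bool) → Carrier
  pick f = search f elements

  opaque
    pick-cong : ∀ {f g} → (∀ x → f x ≡ g x) → pick f ≡ pick g
    pick-cong {f} {g} f≗g = go elements
      where
      go : ∀ xs → search f xs ≡ search g xs
      go [] = refl
      go (x ∷ xs) rewrite f≗g x | go xs = refl

    pick-satisfies : ∀ {f : Carrier → Bool} {x} → T (f x) → T (f (pick f))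
    pick-satisfies {f} {x} fx = go elements (complete x)
      where
      go : ∀ xs → x ∈ˡ xs → T (f (search f xs))
      go (y ∷ xs) x∈ with f y in fy
      go (y ∷ xs) x∈ | true = subst T (sym fy) _
      go (y ∷ xs) (here refl) | false = ⊥-elim (subst T fy fx)
      go (y ∷ xs) (there x∈) | false = go xs x∈

  -- A choice of one point from each pair {x, σ x} of classes.
  module Section (_≈ᵇ_ : Carrier → Carrier → Bool)
                 (≈-refl : ∀ {x} → T (x ≈ᵇ x)) (≈-sym : ∀ {x y} → T (x ≈ᵇ y) → T (y ≈ᵇ x))
                 (≈-trans : ∀ {x y z} → T (x ≈ᵇ y) → T (y ≈ᵇ z) → T (x ≈ᵇ z))
                 (σ : Carrier → Carrier)
                 (σ-cong : ∀ {x y} → T (x ≈ᵇ y) → T (σ x ≈ᵇ σ y))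
                 (σ-involutive : ∀ x → T (σ (σ x) ≈ᵇ x)) where
    private
      pair : Carrier → Carrier → Bool
      pair x z = (z ≈ᵇ x) ∨ (z ≈ᵇ σ x)

      shift : ∀ {x y} z → T (x ≈ᵇ y) → (z ≈ᵇ x) ≡ (z ≈ᵇ y)
      shift z x≈y = T-≡ (λ p → ≈-trans p x≈y) (λ p → ≈-trans p (≈-sym x≈y))

    section : Carrier → Bool
    section x = pick (pair x) ≈ᵇ x

    opaque
      section-cong : ∀ {x y} → T (x ≈ᵇ y) → section x ≡ section y
      section-cong {x} {y} x≈y = trans
        (cong (_≈ᵇ x) (pick-cong (λ z → cong₂ _∨_ (shift z x≈y) (shift z (σ-cong x≈y)))))
        (shift _ x≈y)

      -- Both `x` and `σ x` search the same pair of classes, and the first hit lies in exactly one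
      -- of them.
      section-σ : ∀ {x} → ¬ T (x ≈ᵇ σ x) → section (σ x) ≡ not (section x)
      section-σ {x} x≉σx = trans
        (cong (_≈ᵇ σ x) (pick-cong (λ z → trans (cong ((z ≈ᵇ σ x) ∨_) (shift z (σ-involutive x)))
          (∨-comm (z ≈ᵇ σ x) _))))
        (exclusive (pick (pair x)) (pick-satisfies {pair x} {x} (T-∨ .Equivalence.from (inj₁ ≈-refl))))
        where
        exclusive : ∀ z → T ((z ≈ᵇ x) ∨ (z ≈ᵇ σ x)) → (z ≈ᵇ σ x) ≡ not (z ≈ᵇ x)
        exclusive z sat with z ≈ᵇ x in zx | z ≈ᵇ σ x in zσ
        ... | true | true = ⊥-elim (x≉σx (≈-trans (≈-sym (subst T (sym zx) _)) (subst T (sym zσ) _)))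
        ... | true | false = refl
        ... | false | true = refl

-- The form in which a nontrivial cyclic Sylow 2-subgroup is remembered: its involution, and a
-- character onto ℤ/2 whose kernel consists of the doubles. It passes to subgroups whose quotient
-- has odd exponent.
record EvenStructure (G : FiniteAbelianGroup) : Set where
  open FiniteAbelianGroup G
  field
    t : Carrier
    t≢ε : t ≢ ε
    t∙t≡ε : t ∙ t ≡ ε
    involution-unique : ∀ x → x ∙ x ≡ ε → x ≡ ε ⊎ x ≡ t
    parity : Carrier → Bool
    parity-∙ : ∀ x y → parity (x ∙ y) ≡ parity x xor parity y
    g : Carrier
    parity-g : parity g ≡ true
    halve : ∀ x → parity x ≡ false → ∃[ y ] x ≡ y ∙ y

  parity-ε : parity ε ≡ false
  parity-ε = trans (cong parity (sym (identityˡ ε))) (trans (parity-∙ ε ε) (xor-same (parity ε)))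

  parity-⁻¹ : ∀ x → parity (x ⁻¹) ≡ parity x
  parity-⁻¹ x = xor-cancelʳ (parity x)
    (trans (sym (parity-∙ (x ⁻¹) x)) (trans (cong parity (inverseˡ x))
      (trans parity-ε (sym (xor-same (parity x))))))

  parity-square : ∀ x → parity (x ∙ x) ≡ false
  parity-square x = trans (parity-∙ x x) (xor-same (parity x))

  parity-· : ∀ k x → parity (k · x) ≡ odd k ∧ parity x
  parity-· zero x = parity-ε
  parity-· (suc k) x = trans (parity-∙ x (k · x)) (trans (cong (parity x xor_) (parity-· k x))
    (step (odd k) (parity x)))
    where
    step : ∀ a b → b xor (a ∧ b) ≡ not a ∧ b
    step false false = refl
    step false true = refl
    step true false = refl
    step true true = refl

-- The colours are the n group elements and the two extra ones in Bool.
record Colouring (G : FiniteAbelianGroup) : Set where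
  open FiniteAbelianGroup G
  field
    colour : Carrier → Carrier → Carrier ⊎ Bool
    proper : ∀ {x y x′ y′} → colour x y ≡ colour x′ y′ → Share x y x′ y′ → x ≡ x′ × y ≡ y′

record Subgroup (G : FiniteAbelianGroup) : Set where
  open FiniteAbelianGroup G
  field
    member : Carrier → Bool
    ε∈ : T (member ε)
    ∙∈ : ∀ {x y} → T (member x) → T (member y) → T (member (x ∙ y))
    ⁻¹∈ : ∀ {x} → T (member x) → T (member (x ⁻¹))

  infix 4 _≈_
  _≈_ : Carrier → Carrier → Set
  x ≈ y = T (member (x - y))

  open LinearSolver 𝒢

  ≈-reflexive : ∀ {x y} → x ≡ y → x ≈ y
  ≈-reflexive {x} refl = subst (T ∘ member) (solve 1 (λ x → [] ⊢ 𝟘 ≜ x ⊖ x) (x ∷ []) []) ε∈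

  ≈-sym : ∀ {x y} → x ≈ y → y ≈ x
  ≈-sym {x} {y} p = subst (T ∘ member) (solve 2 (λ x y → [] ⊢ ⊝ (x ⊖ y) ≜ y ⊖ x) (x ∷ y ∷ []) []) (⁻¹∈ p)

  ≈-trans : ∀ {x y z} → x ≈ y → y ≈ z → x ≈ z
  ≈-trans {x} {y} {z} p q = subst (T ∘ member)
    (solve 3 (λ x y z → [] ⊢ x ⊖ y ⊕ (y ⊖ z) ≜ x ⊖ z) (x ∷ y ∷ z ∷ []) []) (∙∈ p q)

  ∙-cong : ∀ {x y u v} → x ≈ y → u ≈ v → x ∙ u ≈ y ∙ v
  ∙-cong {x} {y} {u} {v} p q = subst (T ∘ member)
    (solve 4 (λ x y u v → [] ⊢ x ⊖ y ⊕ (u ⊖ v) ≜ x ⊕ u ⊖ (y ⊕ v)) (x ∷ y ∷ u ∷ v ∷ []) []) (∙∈ p q)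

  ⁻¹-cong : ∀ {x y} → x ≈ y → x ⁻¹ ≈ y ⁻¹
  ⁻¹-cong {x} {y} p = subst (T ∘ member)
    (solve 2 (λ x y → [] ⊢ ⊝ (x ⊖ y) ≜ ⊝ x ⊖ ⊝ y) (x ∷ y ∷ []) []) (⁻¹∈ p)

  -- The carrier stays that of `G` and only equality is coarsened, so the linear solver also proves
  -- congruences modulo the subgroup.
  quotient : AbelianGroup 0ℓ 0ℓ
  quotient = record
    { _≈_ = _≈_
    ; isAbelianGroup = record
      { isGroup = record
        { isMonoid = record
          { isSemigroup = record
            { isMagma = record
              { isEquivalence = record { refl = ≈-reflexive refl ; sym = ≈-sym ; trans = ≈-trans }
              ; ∙-cong = ∙-cong }
            ; assoc = λ x y z → ≈-reflexive (assoc x y z) }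
          ; identity = (λ x → ≈-reflexive (identityˡ x)) , (λ x → ≈-reflexive (identityʳ x)) }
        ; inverse = (λ x → ≈-reflexive (inverseˡ x)) , (λ x → ≈-reflexive (inverseʳ x))
        ; ⁻¹-cong = ⁻¹-cong }
      ; comm = λ x y → ≈-reflexive (comm x y) } }

  member⇒≈ε : ∀ {x} → T (member x) → x ≈ ε
  member⇒≈ε {x} = subst (T ∘ member) (solve 1 (λ x → [] ⊢ x ≜ x ⊖ 𝟘) (x ∷ []) [])

  ≈ε⇒member : ∀ {x} → x ≈ ε → T (member x)
  ≈ε⇒member {x} = subst (T ∘ member) (solve 1 (λ x → [] ⊢ x ⊖ 𝟘 ≜ x) (x ∷ []) [])

module _ (G : FiniteAbelianGroup) (M : Subgroup G) where
  open FiniteAbelianGroup G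
  open Subgroup M

  private
    Sub : Set
    Sub = Σ Carrier (T ∘ member)

    members : List Carrier → List Sub
    members [] = []
    members (x ∷ xs) with T? (member x)
    ... | yes x∈ = (x , x∈) ∷ members xs
    ... | no _ = members xs

    members-complete : ∀ {x xs} (x∈M : T (member x)) → x ∈ˡ xs → (x , x∈M) ∈ˡ members xs
    members-complete {x} {y ∷ xs} x∈M x∈ with T? (member y)
    members-complete x∈M (here refl) | yes _ = here (Σ-T-≡ refl)
    members-complete x∈M (there x∈) | yes _ = there (members-complete x∈M x∈)
    members-complete x∈M (here refl) | no x∉M = contradiction x∈M x∉M
    members-complete x∈M (there x∈) | no _ = members-complete x∈M x∈

    members-length : ∀ xs → List.length (members xs) ℕ.≤ List.length xs
    members-length [] = z≤n
    members-length (x ∷ xs) with T? (member x)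
    ... | yes _ = s≤s (members-length xs)
    ... | no _ = ℕₚ.m≤n⇒m≤1+n (members-length xs)

    members-shrink : ∀ {x xs} → ¬ T (member x) → x ∈ˡ xs → List.length (members xs) ℕ.< List.length xs
    members-shrink {x} {y ∷ xs} x∉M x∈ with T? (member y)
    members-shrink x∉M (here refl) | yes y∈M = contradiction y∈M x∉M
    members-shrink x∉M (there x∈) | yes _ = s≤s (members-shrink x∉M x∈)
    members-shrink {xs = y ∷ xs} _ _ | no _ = s≤s (members-length xs)

    _∙ₛ_ : Sub → Sub → Sub
    (x , p) ∙ₛ (y , q) = x ∙ y , ∙∈ p q

    _⁻¹ₛ : Sub → Sub
    (x , p) ⁻¹ₛ = x ⁻¹ , ⁻¹∈ p

    isAbelianGroupₛ : IsAbelianGroup _≡_ _∙ₛ_ (ε , ε∈) _⁻¹ₛ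
    isAbelianGroupₛ = record
      { isGroup = record
        { isMonoid = record
          { isSemigroup = record
            { isMagma = ≡.isMagma _∙ₛ_
            ; assoc = λ x y z → Σ-T-≡ (assoc _ _ _) }
          ; identity = (λ x → Σ-T-≡ (identityˡ _)) , (λ x → Σ-T-≡ (identityʳ _)) }
        ; inverse = (λ x → Σ-T-≡ (inverseˡ _)) , (λ x → Σ-T-≡ (inverseʳ _))
        ; ⁻¹-cong = cong _⁻¹ₛ }
      ; comm = λ x y → Σ-T-≡ (comm _ _) }

    𝒢ₛ : AbelianGroup 0ℓ 0ℓ
    𝒢ₛ = record { isAbelianGroup = isAbelianGroupₛ }

    ·ₛ : ∀ k (x : Sub) → proj₁ (RawMonoid._×_ (AbelianGroup.rawMonoid 𝒢ₛ) k x) ≡ k · proj₁ x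
    ·ₛ zero x = refl
    ·ₛ (suc k) x = cong (proj₁ x ∙_) (·ₛ k x)

  restrict : FiniteAbelianGroup
  restrict = record
    { isAbelianGroup = isAbelianGroupₛ
    ; _≟_ = λ x y → map′ Σ-T-≡ (cong proj₁) (proj₁ x ≟ proj₁ y)
    ; elements = members elements
    ; complete = λ (x , x∈M) → members-complete x∈M (complete x)
    ; exponent = exponent
    ; exponent≢0 = exponent≢0
    ; exponent·x≡ε = λ x → Σ-T-≡ (trans (·ₛ exponent x) (exponent·x≡ε (proj₁ x))) }

  restrict-shrinks : ∀ {x} → ¬ T (member x) →
                     List.length (FiniteAbelianGroup.elements restrict) ℕ.< List.length elements
  restrict-shrinks {x} x∉M = members-shrink x∉M (complete x)

-- Turns G/M into a module over the Gaussian integers on which 2 is invertible, with `K` acting as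
-- i. From (1 + K)(1 - K) = 2 both factors are invertible.
record QuarterTurn (G : FiniteAbelianGroup) (M : Subgroup G) : Set where
  open FiniteAbelianGroup G
  open Subgroup M
  field
    K : Carrier → Carrier
    K-cong : ∀ {x y} → x ≈ y → K x ≈ K y
    K-∙ : ∀ x y → K (x ∙ y) ≈ K x ∙ K y
    K∘K : ∀ x → K (K x) ≈ x ⁻¹
    half : Carrier → Carrier
    half∙half : ∀ x → half x ∙ half x ≈ x
    no-2-torsion : ∀ {x} → x ∙ x ≈ ε → x ≈ ε

  private
    module Q = LinearSolver quotient

  K-ε : K ε ≈ ε
  K-ε = Q.solve 1 (λ k → k ≜ k ⊕ k ∷ [] ⊢ k ≜ 𝟘) (K ε ∷ [])
    (≈-trans (K-cong (≈-reflexive (sym (identityˡ ε)))) (K-∙ ε ε) ∷ [])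

  K-⁻¹ : ∀ x → K (x ⁻¹) ≈ K x ⁻¹
  K-⁻¹ x = Q.solve 3 (λ k k′ z → z ≜ 𝟘 ∷ z ≜ k ⊕ k′ ∷ [] ⊢ k′ ≜ ⊝ k) (K x ∷ K (x ⁻¹) ∷ K (x - x) ∷ [])
    (≈-trans (K-cong (≈-reflexive (inverseʳ x))) K-ε ∷ K-∙ x (x ⁻¹) ∷ [])

  K-injective : ∀ {x y} → K x ≈ K y → x ≈ y
  K-injective {x} {y} eq = Q.solve 4 (λ x y kx ky → kx ≜ ⊝ x ∷ ky ≜ ⊝ y ∷ kx ≜ ky ∷ [] ⊢ x ≜ y)
    (x ∷ y ∷ K (K x) ∷ K (K y) ∷ []) (K∘K x ∷ K∘K y ∷ K-cong eq ∷ [])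

  K-fixed : ∀ {x} → K x ≈ x → x ≈ ε
  K-fixed {x} eq = no-2-torsion (Q.solve 3 (λ x k kk → k ≜ x ∷ kk ≜ k ∷ kk ≜ ⊝ x ∷ [] ⊢ x ⊕ x ≜ 𝟘)
    (x ∷ K x ∷ K (K x) ∷ []) (eq ∷ K-cong eq ∷ K∘K x ∷ []))

  K-antifixed : ∀ {x} → x ∙ K x ≈ ε → x ≈ ε
  K-antifixed {x} eq = no-2-torsion (Q.solve 4 (λ x k kk z → x ⊕ k ≜ 𝟘 ∷ kk ≜ z ∷ z ≜ ⊝ k ∷ kk ≜ ⊝ x ∷
    [] ⊢ x ⊕ x ≜ 𝟘)
    (x ∷ K x ∷ K (K x) ∷ K (x ⁻¹) ∷ [])
    (eq ∷ K-cong (Q.solve 2 (λ x k → x ⊕ k ≜ 𝟘 ∷ [] ⊢ k ≜ ⊝ x) (x ∷ K x ∷ []) (eq ∷ [])) ∷ K-⁻¹ x ∷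
      K∘K x ∷ []))

  sum-injective : ∀ {x y} → x ∙ K x ≈ y ∙ K y → x ≈ y
  sum-injective {x} {y} eq = Q.solve 2 (λ x y → x ⊖ y ≜ 𝟘 ∷ [] ⊢ x ≜ y) (x ∷ y ∷ [])
    (K-antifixed (Q.solve 6 (λ x y kx ky k kn → x ⊕ kx ≜ y ⊕ ky ∷ k ≜ kx ⊕ kn ∷ kn ≜ ⊝ ky ∷
      [] ⊢ x ⊖ y ⊕ k ≜ 𝟘)
      (x ∷ y ∷ K x ∷ K y ∷ K (x - y) ∷ K (y ⁻¹) ∷ []) (eq ∷ K-∙ x (y ⁻¹) ∷ K-⁻¹ y ∷ [])) ∷ [])

  -- Since (1 - K)K = 1 + K, the hypothesis reads (1 - K)Kx = (1 - K)y, and 1 - K is injective.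
  sum-difference : ∀ {x y} → x ∙ K x ≈ y ∙ (K y ⁻¹) → y ≈ K x
  sum-difference {x} {y} eq = Q.solve 2 (λ y k → y ⊖ k ≜ 𝟘 ∷ [] ⊢ y ≜ k) (y ∷ K x ∷ [])
    (K-fixed (Q.solve 7 (λ x y kx ky k kn kkx → x ⊕ kx ≜ y ⊖ ky ∷ k ≜ ky ⊕ kn ∷ kn ≜ ⊝ kkx ∷ kkx ≜ ⊝ x ∷
      [] ⊢ k ≜ y ⊖ kx)
      (x ∷ y ∷ K x ∷ K y ∷ K (y - K x) ∷ K (K x ⁻¹) ∷ K (K x) ∷ [])
      (eq ∷ K-∙ y (K x ⁻¹) ∷ K-⁻¹ (K x) ∷ K∘K x ∷ [])) ∷ [])

  -- Solving y = w + K(x - w) for w means (1 - K)w = y - Kx, and the inverse of 1 - K is (1 + K)/2.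
  centre : Carrier → Carrier → Carrier
  centre x y = half ((y - K x) ∙ K (y - K x))

  centre-spec : ∀ x y → y ≈ centre x y ∙ K (x - centre x y)
  -- The identity is shown after doubling, so some hypotheses are needed with coefficient two and
  -- are listed twice.
  centre-spec x y = Q.solve 2 (λ a b → a ⊖ b ≜ 𝟘 ∷ [] ⊢ a ≜ b) (y ∷ w ∙ K (x - w) ∷ [])
    (no-2-torsion (Q.solve 10
      (λ y w kw kx k kn z kz kkz ww → w ⊕ w ≜ z ⊕ kz ∷ ww ≜ kw ⊕ kw ∷ ww ≜ kz ⊕ kkz ∷ kkz ≜ ⊝ z ∷
             k ≜ kx ⊕ kn ∷ k ≜ kx ⊕ kn ∷ kn ≜ ⊝ kw ∷ kn ≜ ⊝ kw ∷ z ≜ y ⊖ kx ∷ z ≜ y ⊖ kx ∷ []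
             ⊢ y ⊖ (w ⊕ k) ⊕ (y ⊖ (w ⊕ k)) ≜ 𝟘)
      (y ∷ w ∷ K w ∷ K x ∷ K (x - w) ∷ K (w ⁻¹) ∷ z ∷ K z ∷ K (K z) ∷ K (w ∙ w) ∷ [])
      (half∙half (z ∙ K z) ∷ K-∙ w w ∷ ≈-trans (K-cong (half∙half (z ∙ K z))) (K-∙ z (K z)) ∷ K∘K z ∷
       K-∙ x (w ⁻¹) ∷ K-∙ x (w ⁻¹) ∷ K-⁻¹ w ∷ K-⁻¹ w ∷ ≈-reflexive refl ∷ ≈-reflexive refl ∷ [])) ∷ [])
    where
    z = y - K x
    w = centre x y

-- With -K in place of K, the blocks (w + h, w - Kh) become instances of the same construction as
-- the blocks (w + h, w + Kh).
reverse : ∀ {G M} → QuarterTurn G M → QuarterTurn G M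
reverse {G} {M} R = record
  { K = λ x → K x ⁻¹
  ; K-cong = λ eq → ⁻¹-cong (K-cong eq)
  ; K-∙ = λ x y → Q.solve 3 (λ k a b → k ≜ a ⊕ b ∷ [] ⊢ ⊝ k ≜ ⊝ a ⊕ ⊝ b) (K (x ∙ y) ∷ K x ∷ K y ∷ [])
    (K-∙ x y ∷ [])
  ; K∘K = λ x → Q.solve 3 (λ x k kk → k ≜ ⊝ kk ∷ kk ≜ ⊝ x ∷ [] ⊢ ⊝ k ≜ ⊝ x)
                  (x ∷ K (K x ⁻¹) ∷ K (K x) ∷ []) (K-⁻¹ (K x) ∷ K∘K x ∷ [])
  ; half = half ; half∙half = half∙half ; no-2-torsion = no-2-torsion }
  where
  open FiniteAbelianGroup G
  open Subgroup M
  open QuarterTurn R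
  module Q = LinearSolver quotient

-- Extending a colouring from a subgroup

-- The classes of G/M cut the table into blocks. The diagonal block of w carries a copy of the
-- colouring of M, and all these copies share the two extra colours. The other blocks have the form
-- (w + h, w + Kh) or (w + h, w - Kh) in exactly one way each; the first kind lends its even
-- diagonals and the second its odd diagonals to the colours of w. For fixed w, the rows h and -h
-- meet the same columns and the blocks (h, Kh) and (Kh, -K(Kh)) = (Kh, h) the same symbols, so
-- complementary halves of the diagonals fit together.
module Extension (G : FiniteAbelianGroup) (M : Subgroup G) (R : QuarterTurn G M) (E : EvenStructure G)
                 (g∈M : T (Subgroup.member M (EvenStructure.g E)))
                 (t∈M : T (Subgroup.member M (EvenStructure.t E)))
                 (χ : Colouring (restrict G M)) where

  open FiniteAbelianGroup G
  open Subgroup M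
  open EvenStructure E

  private
    module S = LinearSolver 𝒢
    module Q = LinearSolver quotient
    module χ = Colouring χ

  opaque
    ρ : Carrier → Carrier
    ρ x = pick G (λ z → member (z - x))

    ρ≈ : ∀ x → ρ x ≈ x
    ρ≈ x = pick-satisfies G {λ z → member (z - x)} {x} (≈-reflexive refl)

    ρ-cong : ∀ {x y} → x ≈ y → ρ x ≡ ρ y
    ρ-cong x≈y = pick-cong G (λ z → T-≡ (λ p → ≈-trans p x≈y) (λ p → ≈-trans p (≈-sym x≈y)))

  ρ-idempotent : ∀ x → ρ (ρ x) ≡ ρ x
  ρ-idempotent x = ρ-cong (ρ≈ x)

  part : Carrier → Carrier
  part x = x - ρ x

  part∈ : ∀ x → T (member (part x))
  part∈ x = ≈-sym (ρ≈ x)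

  recompose : ∀ {x y} → ρ x ≡ ρ y → part x ≡ part y → x ≡ y
  recompose {x} {y} r p = S.solve 4 (λ x y rx ry → rx ≜ ry ∷ x ⊖ rx ≜ y ⊖ ry ∷ [] ⊢ x ≜ y)
    (x ∷ y ∷ ρ x ∷ ρ y ∷ []) (r ∷ p ∷ [])

  -- `ρ` is only a choice of representatives, so `part` is not additive in general: sums of parts
  -- are compared only where the sums of representatives agree.
  part-∙ : ∀ {x y x′ y′} → ρ x ∙ ρ y ≡ ρ x′ ∙ ρ y′ → x ∙ y ≡ x′ ∙ y′ → part x ∙ part y ≡ part x′ ∙ part y′
  part-∙ {x} {y} {x′} {y′} r e = S.solve 8
    (λ x y x′ y′ a b a′ b′ → a ⊕ b ≜ a′ ⊕ b′ ∷ x ⊕ y ≜ x′ ⊕ y′ ∷ [] ⊢ x ⊖ a ⊕ (y ⊖ b) ≜ x′ ⊖ a′ ⊕ (y′ ⊖ b′))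
    (x ∷ y ∷ x′ ∷ y′ ∷ ρ x ∷ ρ y ∷ ρ x′ ∷ ρ y′ ∷ []) (r ∷ e ∷ [])

  private
    module Sign = Section G (λ x y → member (x - y)) (≈-reflexive refl) ≈-sym ≈-trans
                          _⁻¹ ⁻¹-cong
                          (λ x → Q.solve 1 (λ x → [] ⊢ ⊝ ⊝ x ≜ x) (x ∷ []) [])

    T-≟ : ∀ {x y} → x ≡ y → T (does (x ≟ y))
    T-≟ {x} {y} eq = subst T (sym (dec-true (x ≟ y) eq)) _
    ≟-T : ∀ {x y} → T (does (x ≟ y)) → x ≡ y
    ≟-T {x} {y} p = does⇒ (x ≟ y) (T⇒≡true p)

    module Half = Section G (λ x y → does (x ≟ y)) (λ {x} → T-≟ {x} refl)
                          (λ p → T-≟ (sym (≟-T p))) (λ p q → T-≟ (trans (≟-T p) (≟-T q)))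
                          (_∙ t) (λ p → T-≟ (cong (_∙ t) (≟-T p)))
                          (λ x → T-≟ (S.solve 2 (λ x t → t ⊕ t ≜ 𝟘 ∷ [] ⊢ x ⊕ t ⊕ t ≜ x) (x ∷ t ∷ [])
                            (t∙t≡ε ∷ [])))

  sign : Carrier → Bool
  sign = Sign.section

  sign-⁻¹ : ∀ {h} → ¬ h ≈ ε → sign (h ⁻¹) ≡ not (sign h)
  sign-⁻¹ {h} h≉ε = Sign.section-σ (λ h≈h⁻¹ → h≉ε (QuarterTurn.no-2-torsion R
    (Q.solve 1 (λ h → h ≜ ⊝ h ∷ [] ⊢ h ⊕ h ≜ 𝟘) (h ∷ []) (h≈h⁻¹ ∷ []))))

  A : Carrier → Bool
  A = Half.section

  A-t : ∀ x → A (x ∙ t) ≡ not (A x)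
  A-t x = Half.section-σ (λ p → t≢ε (S.solve 2 (λ x t → x ≜ x ⊕ t ∷ [] ⊢ t ≜ 𝟘) (x ∷ t ∷ [])
    (does⇒ (x ≟ (x ∙ t)) (T⇒≡true p) ∷ [])))

  -- The half-set in the row block of h and the shift of its second diagonal.
  A′ : Bool → Carrier → Bool
  A′ true u = A u
  A′ false u = A (u - g)

  γ : Bool → Carrier
  γ true = g
  γ false = g ⁻¹

  -- The row blocks of h and -h have opposite signs and meet the same columns. The shift by `γ`
  -- carries the half-set of one sign onto that of the other, so complementary halves of the two
  -- diagonals fill complementary sets of columns.
  A′-shift : ∀ s u → A′ (not s) (u ∙ γ s) ≡ A′ s u
  A′-shift true u = cong A (S.solve 2 (λ u g → [] ⊢ u ⊕ g ⊖ g ≜ u) (u ∷ g ∷ []) [])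
  A′-shift false u = refl

  A′-t : ∀ s u → A′ s (u ∙ t) ≡ not (A′ s u)
  A′-t true u = A-t u
  A′-t false u = trans (cong A (S.solve 3 (λ u t g → [] ⊢ u ⊕ t ⊖ g ≜ u ⊖ g ⊕ t) (u ∷ t ∷ g ∷ []) []))
    (A-t (u - g))

  γ∈ : ∀ s → T (member (γ s))
  γ∈ true = g∈M
  γ∈ false = ⁻¹∈ g∈M

  parity-γ : ∀ s → parity (γ s) ≡ true
  parity-γ true = parity-g
  parity-γ false = trans (parity-⁻¹ g) parity-g

  turn : Bool → QuarterTurn G M
  turn false = R
  turn true = reverse R

  shift : Bool → Bool → Carrier
  shift false s = ε
  shift true s = γ s

  shift∈ : ∀ o s → T (member (shift o s))
  shift∈ false s = ε∈
  shift∈ true s = γ∈ s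

  parity-shift : ∀ o s → parity (shift o s) ≡ o
  parity-shift false s = parity-ε
  parity-shift true s = parity-γ s

  -- `diagonal` is always even, so adding `flag` stores a bit as the parity of the colour; `decode`
  -- reads off the class, the bit and the diagonal again.
  flag : Bool → Carrier
  flag true = ε
  flag false = g

  flag∈ : ∀ f → T (member (flag f))
  flag∈ true = ε∈
  flag∈ false = g∈M

  parity-flag : ∀ f → parity (flag f) ≡ not f
  parity-flag true = parity-ε
  parity-flag false = parity-g

  lift : Carrier → Σ Carrier (T ∘ member) ⊎ Bool → Carrier ⊎ Bool
  lift r (inj₁ m) = inj₁ (r ∙ proj₁ m)
  lift r (inj₂ b) = inj₂ b

  point : Carrier → Σ Carrier (T ∘ member)
  point x = part x , part∈ x

  diagonal : Bool → Carrier → Carrier → Carrier → Carrier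
  diagonal o h x y = (part y - part x) - shift o (sign h)

  orient : Bool → Carrier → Carrier → Bool
  orient o h x = A′ (sign h) (part x) xor o

  -- Every block off the diagonal is of both kinds, with a centre for each; the parity of the cell's
  -- diagonal decides which kind, and hence which class of colours, is used.
  data Cell (x y : Carrier) : Carrier ⊎ Bool → Set where
    on : x ≈ y → Cell x y (lift (ρ x) (χ.colour (point x) (point y)))
    off : ∀ o w → ¬ x ≈ y → ρ w ≡ w → y ≈ w ∙ QuarterTurn.K (turn o) (x - w) →
          parity (part y - part x) ≡ o →
          Cell x y (inj₁ ((w ∙ diagonal o (x - w) x y) ∙ flag (orient o (x - w) x)))

  cell : ∀ x y → ∃[ k ] Cell x y k
  cell x y with T? (member (x - y))
  ... | yes x≈y = _ , on x≈y
  ... | no x≉y with parity (part y - part x) in eq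
  ...   | o = _ , off o (ρ w) x≉y (ρ-idempotent w) centred eq
    where
    open QuarterTurn (turn o)
    w = centre x y
    centred : y ≈ ρ w ∙ K (x - ρ w)
    centred = ≈-trans (centre-spec x y) (∙-cong (≈-sym (ρ≈ w))
      (K-cong (∙-cong (≈-reflexive refl) (⁻¹-cong (≈-sym (ρ≈ w))))))

  Same : Carrier → Carrier → Carrier → Carrier → Set
  Same x y x′ y′ = x ≡ x′ × y ≡ y′

  diagonal∈ : ∀ o h x y → T (member (diagonal o h x y))
  diagonal∈ o h x y = ∙∈ (∙∈ (part∈ y) (⁻¹∈ (part∈ x))) (⁻¹∈ (shift∈ o (sign h)))

  parity-diagonal : ∀ o h x y → parity (part y - part x) ≡ o → parity (diagonal o h x y) ≡ false
  parity-diagonal o h x y eq = trans (parity-∙ _ _)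
    (trans (cong₂ _xor_ eq (trans (parity-⁻¹ _) (parity-shift o (sign h)))) (xor-same o))

  label-class : ∀ {w d} f → ρ w ≡ w → T (member d) → ρ ((w ∙ d) ∙ flag f) ≡ w
  label-class {w} {d} f ρw d∈ = trans (ρ-cong (Q.solve 3 (λ w d f → d ≜ 𝟘 ∷ f ≜ 𝟘 ∷ [] ⊢ w ⊕ d ⊕ f ≜ w)
    (w ∷ d ∷ flag f ∷ []) (member⇒≈ε d∈ ∷ member⇒≈ε (flag∈ f) ∷ []))) ρw

  label-parity : ∀ {d} f → parity d ≡ false → parity (d ∙ flag f) ≡ not f
  label-parity {d} f eq = trans (parity-∙ d (flag f)) (cong₂ _xor_ eq (parity-flag f))

  decode : ∀ {w w′ d d′ f f′} → ρ w ≡ w → ρ w′ ≡ w′ → T (member d) → T (member d′) →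
           parity d ≡ false → parity d′ ≡ false →
           (w ∙ d) ∙ flag f ≡ (w′ ∙ d′) ∙ flag f′ → w ≡ w′ × d ≡ d′ × f ≡ f′
  decode {w} {w′} {d} {d′} {f} {f′} ρw ρw′ d∈ d′∈ pd pd′ eq = w≡ , d≡ , f≡
    where
    w≡ : w ≡ w′
    w≡ = trans (sym (label-class f ρw d∈)) (trans (cong ρ eq) (label-class f′ ρw′ d′∈))
    tail≡ : d ∙ flag f ≡ d′ ∙ flag f′
    tail≡ = S.solve 6 (λ w w′ d d′ f f′ → w ≜ w′ ∷ w ⊕ d ⊕ f ≜ w′ ⊕ d′ ⊕ f′ ∷ [] ⊢ d ⊕ f ≜ d′ ⊕ f′)
      (w ∷ w′ ∷ d ∷ d′ ∷ flag f ∷ flag f′ ∷ []) (w≡ ∷ eq ∷ [])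
    f≡ : f ≡ f′
    f≡ = not-injective (trans (sym (label-parity f pd)) (trans (cong parity tail≡) (label-parity f′ pd′)))
    d≡ : d ≡ d′
    d≡ = S.solve 4 (λ d d′ f f′ → f ≜ f′ ∷ d ⊕ f ≜ d′ ⊕ f′ ∷ [] ⊢ d ≜ d′)
      (d ∷ d′ ∷ flag f ∷ flag f′ ∷ []) (cong flag f≡ ∷ tail≡ ∷ [])

  -- A common row, column or symbol puts both cells into one diagonal block; for symbols this uses
  -- that G/M has no 2-torsion. Distinct copies of the colouring of M therefore never meet, and can
  -- share the two extra colours.
  on-on : ∀ {x y x′ y′} → x ≈ y → x′ ≈ y′ →
          lift (ρ x) (χ.colour (point x) (point y)) ≡ lift (ρ x′) (χ.colour (point x′) (point y′)) →
          Share x y x′ y′ → Same x y x′ y′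
  on-on {x} {y} {x′} {y′} x≈y x′≈y′ eq share =
    recompose ρx≡ (cong proj₁ (proj₁ same)) , recompose ρy≡ (cong proj₁ (proj₂ same))
    where
    x≈x′ : Share x y x′ y′ → x ≈ x′
    x≈x′ (inj₁ p) = ≈-reflexive p
    x≈x′ (inj₂ (inj₁ p)) = ≈-trans x≈y (≈-trans (≈-reflexive p) (≈-sym x′≈y′))
    x≈x′ (inj₂ (inj₂ p)) = Q.solve 2 (λ x x′ → x ⊖ x′ ≜ 𝟘 ∷ [] ⊢ x ≜ x′) (x ∷ x′ ∷ [])
      (QuarterTurn.no-2-torsion R (Q.solve 4
        (λ x y x′ y′ → x ≜ y ∷ x′ ≜ y′ ∷ x ⊕ y ≜ x′ ⊕ y′ ∷ [] ⊢ x ⊖ x′ ⊕ (x ⊖ x′) ≜ 𝟘)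
        (x ∷ y ∷ x′ ∷ y′ ∷ []) (x≈y ∷ x′≈y′ ∷ ≈-reflexive p ∷ [])) ∷ [])
    ρx≡ : ρ x ≡ ρ x′
    ρx≡ = ρ-cong (x≈x′ share)
    ρy≡ : ρ y ≡ ρ y′
    ρy≡ = trans (sym (ρ-cong x≈y)) (trans ρx≡ (ρ-cong x′≈y′))
    lift-injective : ∀ r k k′ → lift r k ≡ lift r k′ → k ≡ k′
    lift-injective r (inj₁ (m , p)) (inj₁ (m′ , p′)) e with
      S.solve 3 (λ r m m′ → r ⊕ m ≜ r ⊕ m′ ∷ [] ⊢ m ≜ m′) (r ∷ m ∷ m′ ∷ []) (inj₁-injective e ∷ [])
    ... | refl = cong (λ q → inj₁ (m , q)) (T-irrelevant p p′)
    lift-injective r (inj₂ b) (inj₂ b′) e = cong inj₂ (inj₂-injective e)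
    colours≡ : χ.colour (point x) (point y) ≡ χ.colour (point x′) (point y′)
    colours≡ = lift-injective (ρ x) _ _ (trans eq (cong (λ r → lift r _) (sym ρx≡)))
    parts : Share x y x′ y′ → FiniteAbelianGroup.Share (restrict G M) (point x) (point y) (point x′)
      (point y′)
    parts (inj₁ p) = inj₁ (Σ-T-≡ (cong part p))
    parts (inj₂ (inj₁ p)) = inj₂ (inj₁ (Σ-T-≡ (cong part p)))
    parts (inj₂ (inj₂ p)) = inj₂ (inj₂ (Σ-T-≡ (part-∙ (cong₂ _∙_ ρx≡ ρy≡) p)))
    same = χ.proper colours≡ (parts share)

  -- With h = x′ - ℓ, a common row, column or symbol means h = 0, Kh = 0 or (1 + K)h = 0. In each
  -- case h = 0, and the second cell would lie in a diagonal block too.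
  on-off : ∀ {x y x′ y′ ℓ} o → x ≈ y → ρ x ≡ ℓ → ¬ x′ ≈ y′ →
           y′ ≈ ℓ ∙ QuarterTurn.K (turn o) (x′ - ℓ) → ¬ Share x y x′ y′
  on-off {x} {y} {x′} {y′} {w} o x≈y ρx≡w x′≉y′ y′≈ share = x′≉y′
    (Q.solve 4 (λ w x′ y′ k → x′ ⊖ w ≜ 𝟘 ∷ k ≜ 𝟘 ∷ y′ ≜ w ⊕ k ∷ [] ⊢ x′ ≜ y′)
      (w ∷ x′ ∷ y′ ∷ K (x′ - w) ∷ []) (h≈ε share ∷ ≈-trans (K-cong (h≈ε share)) K-ε ∷ y′≈ ∷ []))
    where
    open QuarterTurn (turn o)
    x≈w : x ≈ w
    x≈w = ≈-trans (≈-sym (ρ≈ x)) (≈-reflexive ρx≡w)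
    h≈ε : Share x y x′ y′ → x′ - w ≈ ε
    h≈ε (inj₁ p) = Q.solve 3 (λ x x′ w → x ≜ x′ ∷ x ≜ w ∷ [] ⊢ x′ ⊖ w ≜ 𝟘) (x ∷ x′ ∷ w ∷ [])
      (≈-reflexive p ∷ x≈w ∷ [])
    h≈ε (inj₂ (inj₁ p)) = K-injective (≈-trans (Q.solve 5
      (λ x y y′ w k → x ≜ w ∷ x ≜ y ∷ y ≜ y′ ∷ y′ ≜ w ⊕ k ∷ [] ⊢ k ≜ 𝟘) (x ∷ y ∷ y′ ∷ w ∷ K (x′ - w) ∷ [])
      (x≈w ∷ x≈y ∷ ≈-reflexive p ∷ y′≈ ∷ [])) (≈-sym K-ε))
    h≈ε (inj₂ (inj₂ p)) = K-antifixed (Q.solve 6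
      (λ x y x′ y′ w k → x ≜ w ∷ x ≜ w ∷ x ≜ y ∷ x ⊕ y ≜ x′ ⊕ y′ ∷ y′ ≜ w ⊕ k ∷ [] ⊢ x′ ⊖ w ⊕ k ≜ 𝟘)
      (x ∷ y ∷ x′ ∷ y′ ∷ w ∷ K (x′ - w) ∷ []) (x≈w ∷ x≈w ∷ x≈y ∷ ≈-reflexive p ∷ y′≈ ∷ []))

  off-same : ∀ {x y x′ y′ w} o → y ≈ w ∙ QuarterTurn.K (turn o) (x - w) →
             y′ ≈ w ∙ QuarterTurn.K (turn o) (x′ - w) →
             diagonal o (x - w) x y ≡ diagonal o (x′ - w) x′ y′ →
             orient o (x - w) x ≡ orient o (x′ - w) x′ → Share x y x′ y′ → Same x y x′ y′
  off-same {x} {y} {x′} {y′} {w} o y≈ y′≈ d≡ f≡ share = recompose ρx≡ u≡ , recompose ρy≡ v≡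
    where
    open QuarterTurn (turn o)
    h = x - w
    h′ = x′ - w
    h≈h′ : Share x y x′ y′ → h ≈ h′
    h≈h′ (inj₁ p) = ≈-reflexive (cong (_- w) p)
    h≈h′ (inj₂ (inj₁ p)) = K-injective (Q.solve 5
      (λ y y′ w k k′ → y ≜ y′ ∷ y ≜ w ⊕ k ∷ y′ ≜ w ⊕ k′ ∷ [] ⊢ k ≜ k′)
      (y ∷ y′ ∷ w ∷ K h ∷ K h′ ∷ []) (≈-reflexive p ∷ y≈ ∷ y′≈ ∷ []))
    h≈h′ (inj₂ (inj₂ p)) = sum-injective (Q.solve 7
      (λ x y x′ y′ w k k′ → x ⊕ y ≜ x′ ⊕ y′ ∷ y ≜ w ⊕ k ∷ y′ ≜ w ⊕ k′ ∷ [] ⊢ x ⊖ w ⊕ k ≜ x′ ⊖ w ⊕ k′)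
      (x ∷ y ∷ x′ ∷ y′ ∷ w ∷ K h ∷ K h′ ∷ []) (≈-reflexive p ∷ y≈ ∷ y′≈ ∷ []))
    h≈ = h≈h′ share
    ρx≡ : ρ x ≡ ρ x′
    ρx≡ = ρ-cong (Q.solve 3 (λ x x′ w → x ⊖ w ≜ x′ ⊖ w ∷ [] ⊢ x ≜ x′) (x ∷ x′ ∷ w ∷ []) (h≈ ∷ []))
    ρy≡ : ρ y ≡ ρ y′
    ρy≡ = ρ-cong (Q.solve 5 (λ y y′ w k k′ → k ≜ k′ ∷ y ≜ w ⊕ k ∷ y′ ≜ w ⊕ k′ ∷ [] ⊢ y ≜ y′)
      (y ∷ y′ ∷ w ∷ K h ∷ K h′ ∷ []) (K-cong h≈ ∷ y≈ ∷ y′≈ ∷ []))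
    s≡ : sign h ≡ sign h′
    s≡ = Sign.section-cong h≈
    diff≡ : part y - part x ≡ part y′ - part x′
    diff≡ = S.solve 4 (λ d d′ s s′ → s ≜ s′ ∷ d ⊖ s ≜ d′ ⊖ s′ ∷ [] ⊢ d ≜ d′)
      (part y - part x ∷ part y′ - part x′ ∷ shift o (sign h) ∷ shift o (sign h′) ∷ [])
        (cong (shift o) s≡ ∷ d≡ ∷ [])
    A≡ : A′ (sign h) (part x) ≡ A′ (sign h) (part x′)
    A≡ = xor-cancelʳ o (trans f≡ (cong (λ s → A′ s (part x′) xor o) (sym s≡)))
    u≡-from : Share x y x′ y′ → part x ≡ part x′
    u≡-from (inj₁ p) = cong part p
    u≡-from (inj₂ (inj₁ p)) = S.solve 4 (λ u v u′ v′ → v ≜ v′ ∷ v ⊖ u ≜ v′ ⊖ u′ ∷ [] ⊢ u ≜ u′)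
      (part x ∷ part y ∷ part x′ ∷ part y′ ∷ []) (cong part p ∷ diff≡ ∷ [])
    -- On one diagonal the symbol determines the row up to `t`, and the half-set contains just one
    -- of the two candidates.
    u≡-from (inj₂ (inj₂ p)) with involution-unique (part x - part x′) (S.solve 4
      (λ u v u′ v′ → u ⊕ v ≜ u′ ⊕ v′ ∷ v ⊖ u ≜ v′ ⊖ u′ ∷ [] ⊢ u ⊖ u′ ⊕ (u ⊖ u′) ≜ 𝟘)
      (part x ∷ part y ∷ part x′ ∷ part y′ ∷ []) (part-∙ (cong₂ _∙_ ρx≡ ρy≡) p ∷ diff≡ ∷ []))
    ... | inj₁ eq = S.solve 2 (λ u u′ → u ⊖ u′ ≜ 𝟘 ∷ [] ⊢ u ≜ u′) (part x ∷ part x′ ∷ []) (eq ∷ [])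
    ... | inj₂ eq = contradiction
      (trans (sym A≡) (trans (cong (A′ (sign h)) (S.solve 3 (λ u u′ t → u ⊖ u′ ≜ t ∷ [] ⊢ u ≜ u′ ⊕ t)
        (part x ∷ part x′ ∷ t ∷ []) (eq ∷ []))) (A′-t (sign h) (part x′))))
      (not-¬ refl)
    u≡ = u≡-from share
    v≡ : part y ≡ part y′
    v≡ = S.solve 4 (λ u v u′ v′ → u ≜ u′ ∷ v ⊖ u ≜ v′ ⊖ u′ ∷ [] ⊢ v ≜ v′)
      (part x ∷ part y ∷ part x′ ∷ part y′ ∷ []) (u≡ ∷ diff≡ ∷ [])

  off-opposite : ∀ {x y x′ y′ w} → ¬ x′ ≈ y′ →
                 y ≈ w ∙ QuarterTurn.K R (x - w) → y′ ≈ w ∙ (QuarterTurn.K R (x′ - w) ⁻¹) →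
                 diagonal false (x - w) x y ≡ diagonal true (x′ - w) x′ y′ →
                 orient false (x - w) x ≡ orient true (x′ - w) x′ → ¬ Share x y x′ y′
  off-opposite {x} {y} {x′} {y′} {w} x′≉y′ y≈ y′≈ d≡ f≡ = clash
    where
    open QuarterTurn R
    h = x - w
    h′ = x′ - w
    u = part x
    v = part y
    u′ = part x′
    v′ = part y′
    γ′ = γ (sign h′)
    flags : A′ (sign h) u ≡ not (A′ (sign h′) u′)
    flags = trans (sym (xor-identityʳ _)) (trans f≡ (xor-comm _ true))
    h′≉ε : ¬ h′ ≈ ε
    h′≉ε h′≈ε = x′≉y′ (Q.solve 4 (λ x′ y′ w k → x′ ⊖ w ≜ 𝟘 ∷ k ≜ 𝟘 ∷ y′ ≜ w ⊖ k ∷ [] ⊢ x′ ≜ y′)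
      (x′ ∷ y′ ∷ w ∷ K h′ ∷ []) (h′≈ε ∷ ≈-trans (K-cong h′≈ε) K-ε ∷ y′≈ ∷ []))
    clash : ¬ Share x y x′ y′
    clash (inj₁ refl) = not-¬ refl flags
    -- Equal columns force h = -h′, hence opposite signs; the half-sets then agree exactly where the
    -- flags require them to differ.
    clash (inj₂ (inj₁ refl)) = not-¬ (trans
        (cong₂ A′ s≡ (S.solve 4 (λ u u′ v γ → v ⊖ u ⊖ 𝟘 ≜ v ⊖ u′ ⊖ γ ∷ [] ⊢ u ≜ u′ ⊕ γ)
          (u ∷ u′ ∷ v ∷ γ′ ∷ []) (d≡ ∷ [])))
        (A′-shift (sign h′) u′)) flags
      where
      h≈ : h ≈ h′ ⁻¹
      h≈ = K-injective (≈-trans (Q.solve 4 (λ y w k k′ → y ≜ w ⊕ k ∷ y ≜ w ⊖ k′ ∷ [] ⊢ k ≜ ⊝ k′)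
        (y ∷ w ∷ K h ∷ K h′ ∷ []) (y≈ ∷ y′≈ ∷ [])) (≈-sym (K-⁻¹ h′)))
      s≡ : sign h ≡ not (sign h′)
      s≡ = trans (Sign.section-cong h≈) (sign-⁻¹ h′≉ε)
    -- Equal symbols force h′ = Kh, so the second block is the transpose of the first and the
    -- representatives have equal sums. The remaining parts would give 2u = 2u′ ± g, which parity
    -- excludes.
    clash (inj₂ (inj₂ p)) = true≢false (trans (sym odd-symbol)
      (trans (cong parity (sym squares)) (parity-square u)))
      where
      h′≈ : h′ ≈ K h
      h′≈ = sum-difference (Q.solve 7
        (λ x y x′ y′ w k k′ → x ⊕ y ≜ x′ ⊕ y′ ∷ y ≜ w ⊕ k ∷ y′ ≜ w ⊖ k′ ∷ [] ⊢ x ⊖ w ⊕ k ≜ x′ ⊖ w ⊖ k′)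
        (x ∷ y ∷ x′ ∷ y′ ∷ w ∷ K h ∷ K h′ ∷ []) (≈-reflexive p ∷ y≈ ∷ y′≈ ∷ []))
      ρx′≡ : ρ x′ ≡ ρ y
      ρx′≡ = ρ-cong (Q.solve 4 (λ x′ y w k → x′ ⊖ w ≜ k ∷ y ≜ w ⊕ k ∷ [] ⊢ x′ ≜ y)
        (x′ ∷ y ∷ w ∷ K h ∷ []) (h′≈ ∷ y≈ ∷ []))
      ρy′≡ : ρ y′ ≡ ρ x
      ρy′≡ = ρ-cong (Q.solve 5 (λ x y′ w k kk → k ≜ kk ∷ kk ≜ ⊝ (x ⊖ w) ∷ y′ ≜ w ⊖ k ∷ [] ⊢ y′ ≜ x)
        (x ∷ y′ ∷ w ∷ K h′ ∷ K (K h) ∷ []) (K-cong h′≈ ∷ K∘K h ∷ y′≈ ∷ []))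
      squares : u ∙ u ≡ (u′ ∙ u′) ∙ γ′
      squares = S.solve 5
        (λ u v u′ v′ γ → v ⊖ u ⊖ 𝟘 ≜ v′ ⊖ u′ ⊖ γ ∷ u ⊕ v ≜ u′ ⊕ v′ ∷ [] ⊢ u ⊕ u ≜ u′ ⊕ u′ ⊕ γ)
        (u ∷ v ∷ u′ ∷ v′ ∷ γ′ ∷ [])
        (d≡ ∷ part-∙ (trans (comm (ρ x) (ρ y)) (sym (cong₂ _∙_ ρx′≡ ρy′≡))) p ∷ [])
      odd-symbol : parity ((u′ ∙ u′) ∙ γ′) ≡ true
      odd-symbol = trans (parity-∙ (u′ ∙ u′) γ′) (cong₂ _xor_ (parity-square u′) (parity-γ (sign h′)))

  on-class : ∀ {x y w d f} → ρ w ≡ w → T (member d) →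
             lift (ρ x) (χ.colour (point x) (point y)) ≡ inj₁ ((w ∙ d) ∙ flag f) → ρ x ≡ w
  on-class {x} {y} {w} {d} {f} ρw d∈ eq with χ.colour (point x) (point y)
  ... | inj₁ (m , m∈) = trans (sym (trans (ρ-cong (Q.solve 2 (λ r m → m ≜ 𝟘 ∷ [] ⊢ r ⊕ m ≜ r)
      (ρ x ∷ m ∷ []) (member⇒≈ε m∈ ∷ []))) (ρ-idempotent x)))
    (trans (cong ρ (inj₁-injective eq)) (label-class f ρw d∈))

  on-off-clash : ∀ {x y x′ y′} o w → x ≈ y → ¬ x′ ≈ y′ → ρ w ≡ w →
                 y′ ≈ w ∙ QuarterTurn.K (turn o) (x′ - w) →
                 lift (ρ x) (χ.colour (point x) (point y)) ≡
                   inj₁ ((w ∙ diagonal o (x′ - w) x′ y′) ∙ flag (orient o (x′ - w) x′)) →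
                 ¬ Share x y x′ y′
  on-off-clash {x} {y} {x′} {y′} o w x≈y x′≉y′ ρw y′≈ eq =
    on-off o x≈y (on-class {f = orient o (x′ - w) x′} ρw (diagonal∈ o (x′ - w) x′ y′) eq) x′≉y′ y′≈

  off-off : ∀ {x y x′ y′} o o′ w w′ → ¬ x ≈ y → ¬ x′ ≈ y′ → w ≡ w′ →
            y ≈ w ∙ QuarterTurn.K (turn o) (x - w) → y′ ≈ w′ ∙ QuarterTurn.K (turn o′) (x′ - w′) →
            diagonal o (x - w) x y ≡ diagonal o′ (x′ - w′) x′ y′ →
            orient o (x - w) x ≡ orient o′ (x′ - w′) x′ → Share x y x′ y′ → Same x y x′ y′
  off-off false false w .w _ _ refl y≈ y′≈ d≡ f≡ = off-same false y≈ y′≈ d≡ f≡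
  off-off true true w .w _ _ refl y≈ y′≈ d≡ f≡ = off-same true y≈ y′≈ d≡ f≡
  off-off false true w .w _ x′≉y′ refl y≈ y′≈ d≡ f≡ share =
    contradiction share (off-opposite x′≉y′ y≈ y′≈ d≡ f≡)
  off-off true false w .w x≉y _ refl y≈ y′≈ d≡ f≡ share =
    contradiction (Share-sym share) (off-opposite x≉y y′≈ y≈ (sym d≡) (sym f≡))

  separate : ∀ {x y x′ y′ k k′} → Cell x y k → Cell x′ y′ k′ → k ≡ k′ → Share x y x′ y′ → Same x y x′ y′
  separate (on x≈y) (on x′≈y′) eq share = on-on x≈y x′≈y′ eq share
  separate (on x≈y) (off o w x′≉y′ ρw y′≈ _) eq share =
    contradiction share (on-off-clash o w x≈y x′≉y′ ρw y′≈ eq)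
  separate (off o w x≉y ρw y≈ _) (on x′≈y′) eq share =
    contradiction (Share-sym share) (on-off-clash o w x′≈y′ x≉y ρw y≈ (sym eq))
  separate {x} {y} {x′} {y′} (off o w x≉y ρw y≈ po) (off o′ w′ x′≉y′ ρw′ y′≈ po′) eq share =
    let w≡ , d≡ , f≡ = decode ρw ρw′ (diagonal∈ o (x - w) x y) (diagonal∈ o′ (x′ - w′) x′ y′)
                         (parity-diagonal o (x - w) x y po) (parity-diagonal o′ (x′ - w′) x′ y′ po′)
                         (inj₁-injective eq)
    in off-off o o′ w w′ x≉y x′≉y′ w≡ y≈ y′≈ d≡ f≡ share

  colouring : Colouring G
  colouring = record
    { colour = λ x y → proj₁ (cell x y)
    ; proper = λ {x} {y} {x′} {y′} → separate (proj₂ (cell x y)) (proj₂ (cell x′ y′)) }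

-- Cyclic groups of even order

even⇒double : ∀ k → odd k ≡ false → ∃[ j ] k ≡ j + j
odd⇒suc-double : ∀ k → odd k ≡ true → ∃[ j ] k ≡ suc (j + j)
even⇒double zero _ = 0 , refl
even⇒double (suc k) eq with odd⇒suc-double k (trans (sym (not-involutive (odd k))) (cong not eq))
... | j , k≡ = suc j , cong suc (trans k≡ (sym (ℕₚ.+-suc j j)))
odd⇒suc-double (suc k) eq with even⇒double k (trans (sym (not-involutive (odd k))) (cong not eq))
... | j , k≡ = j , cong suc k≡

double-injective : ∀ {i j} → i + i ≡ j + j → i ≡ j
double-injective {i} {j} eq with ℕₚ.<-cmp i j
... | tri< lt _ _ = contradiction eq (ℕₚ.<⇒≢ (ℕₚ.+-mono-< lt lt))
... | tri≈ _ i≡j _ = i≡j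
... | tri> _ _ gt = contradiction (sym eq) (ℕₚ.<⇒≢ (ℕₚ.+-mono-< gt gt))

triple-injective : ∀ {i j} → i + i + i ≡ j + j + j → i ≡ j
triple-injective {i} {j} eq with ℕₚ.<-cmp i j
... | tri< lt _ _ = contradiction eq (ℕₚ.<⇒≢ (ℕₚ.+-mono-< (ℕₚ.+-mono-< lt lt) lt))
... | tri≈ _ i≡j _ = i≡j
... | tri> _ _ gt = contradiction (sym eq) (ℕₚ.<⇒≢ (ℕₚ.+-mono-< (ℕₚ.+-mono-< gt gt) gt))

double-even : ∀ k → odd (k + k) ≡ false
double-even zero = refl
double-even (suc k) = trans (cong (not ∘ odd) (ℕₚ.+-suc k k)) (cong (not ∘ not) (double-even k))

almost-halves : ∀ q → ∃[ a ] ∃[ b ] (q ≡ a + b × b ≤ a × a ≤ suc b)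
almost-halves zero = 0 , 0 , refl , z≤n , z≤n
almost-halves (suc q) with almost-halves q
... | a , b , q≡ , b≤a , a≤1+b = suc b , a , cong suc (trans q≡ (ℕₚ.+-comm a b)) , a≤1+b , s≤s b≤a

module _ (G : FiniteAbelianGroup) where
  open FiniteAbelianGroup G

  ·-ε : ∀ k → k · ε ≡ ε
  ·-ε zero = refl
  ·-ε (suc k) = trans (identityˡ _) (·-ε k)

module Order (G : FiniteAbelianGroup) (x : FiniteAbelianGroup.Carrier G) where
  open FiniteAbelianGroup G
  private
    module S = LinearSolver 𝒢

  private
    pred-exponent : ∃[ N ] suc N · x ≡ ε
    pred-exponent with exponent | exponent≢0 | exponent·x≡ε x
    ... | suc N | _ | eq = N , eq

  opaque
    order : ∃[ l ] (suc l · x ≡ ε × (∀ i → i < l → ¬ suc i · x ≡ ε))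
    order = least (λ k → suc k · x ≟ ε) {proj₁ pred-exponent} (proj₂ pred-exponent)

  l L : ℕ
  l = proj₁ order
  L = suc l

  L·x≡ε : L · x ≡ ε
  L·x≡ε = proj₁ (proj₂ order)

  order-minimal : ∀ {k} → k < L → k · x ≡ ε → k ≡ 0
  order-minimal {zero} _ _ = refl
  order-minimal {suc k} (s≤s k<l) eq = contradiction eq (proj₂ (proj₂ order) k k<l)

  ·-cancel : ∀ {j k} → j ≤ k → k < L → j · x ≡ k · x → j ≡ k
  ·-cancel {j} {k} j≤k k<L eq = sym (trans (sym (ℕₚ.m+[n∸m]≡n j≤k))
    (trans (cong (j +_) d≡0) (ℕₚ.+-identityʳ j)))
    where
    d = k ℕ.∸ j
    d≡0 : d ≡ 0
    d≡0 = order-minimal (ℕₚ.≤-<-trans (ℕₚ.m∸n≤m k j) k<L) (S.solve 3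
      (λ j k d → j ≜ k ∷ k ≜ j ⊕ d ∷ [] ⊢ d ≜ 𝟘) (j · x ∷ k · x ∷ d · x ∷ [])
      (eq ∷ trans (cong (_· x) (sym (ℕₚ.m+[n∸m]≡n j≤k))) (×-homo-+ x j d) ∷ []))

  ·-injective : ∀ {j k} → j < L → k < L → j · x ≡ k · x → j ≡ k
  ·-injective {j} {k} j<L k<L eq with ℕₚ.≤-total j k
  ... | inj₁ j≤k = ·-cancel j≤k k<L eq
  ... | inj₂ k≤j = sym (·-cancel k≤j j<L (sym eq))

  reduce-· : ∀ k → (k % L) · x ≡ k · x
  reduce-· k = S.solve 3 (λ a r m → a ≜ r ⊕ m ∷ m ≜ 𝟘 ∷ [] ⊢ r ≜ a)
    (k · x ∷ (k % L) · x ∷ (k / L * L) · x ∷ [])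
    (trans (cong (_· x) (DivMod.m≡m%n+[m/n]*n k L)) (×-homo-+ x (k % L) (k / L * L)) ∷
     trans (sym (×-assocˡ x (k / L) L)) (trans (cong ((k / L) ·_) L·x≡ε) (·-ε G (k / L))) ∷ [])

-- In a cyclic group of order 2q with generator 1, the diagonals 2j and 2j + 1 are split between two
-- colours by the half-set {0, …, q - 1}, which leaves one clash in each colour. For each j one cell
-- (r, c) and its translate by (q, q) are recoloured: (-i, 3i + 1) if j = 2i, and
-- (-a - 1 - 3i, i + 1 - a) if j = 2i + 1, where a = ⌈q/2⌉. These cells form a partial transversal.
module Cyclic (G : FiniteAbelianGroup) (E : EvenStructure G)
              (1# : FiniteAbelianGroup.Carrier G)
              (generates : ∀ x → ∃[ k ] x ≡ FiniteAbelianGroup._·_ G k 1#) where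

  open FiniteAbelianGroup G
  open EvenStructure E
  private
    module S = LinearSolver 𝒢

  parity-1# : parity 1# ≡ true
  parity-1# with parity 1# in eq
  ... | true = refl
  ... | false = trans (sym (∧-zeroʳ (odd k))) (trans (cong (odd k ∧_) (sym eq))
                  (trans (sym (parity-· k 1#)) (trans (cong parity (sym g≡)) parity-g)))
    where
    k = proj₁ (generates g)
    g≡ = proj₂ (generates g)

  parity-·1# : ∀ k → parity (k · 1#) ≡ odd k
  parity-·1# k = trans (parity-· k 1#) (trans (cong (odd k ∧_) parity-1#) (∧-identityʳ (odd k)))

  open Order G 1#

  private
    half-order : ∃[ q ] L ≡ q + q
    half-order = even⇒double L (trans (sym (parity-·1# L)) (trans (cong parity L·x≡ε) parity-ε))

  opaque
    q : ℕ
    q = proj₁ half-order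

    L≡q+q : L ≡ q + q
    L≡q+q = proj₂ half-order

  q≢0 : q ≢ 0
  q≢0 q≡0 with trans L≡q+q (cong₂ _+_ q≡0 q≡0)
  ... | ()

  q<L : q < L
  q<L = subst (q <_) (sym L≡q+q) (ℕₚ.m<m+n q (ℕₚ.n≢0⇒n>0 q≢0))

  t≡ : q · 1# ≡ t
  t≡ with involution-unique (q · 1#) (trans (sym (×-homo-+ 1# q q))
    (trans (cong (_· 1#) (sym L≡q+q)) L·x≡ε))
  ... | inj₁ eq = contradiction (order-minimal q<L eq) q≢0
  ... | inj₂ eq = eq

  opaque
    index : Carrier → ℕ
    index x = proj₁ (generates x) % L

    index<L : ∀ x → index x < L
    index<L x = DivMod.m%n<n (proj₁ (generates x)) L

    index-· : ∀ x → index x · 1# ≡ x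
    index-· x = trans (reduce-· (proj₁ (generates x))) (sym (proj₂ (generates x)))

  index-unique : ∀ {x k} → k < L → k · 1# ≡ x → index x ≡ k
  index-unique {x} k<L eq = ·-injective (index<L x) k<L (trans (index-· x) (sym eq))

  A : Carrier → Bool
  A x = does (index x ℕ.<? q)

  A-low : ∀ {x k} → k < q → k · 1# ≡ x → A x ≡ true
  A-low {x} {k} k<q eq = dec-true (index x ℕ.<? q) (subst (_< q)
    (sym (index-unique (ℕₚ.<-trans k<q q<L) eq)) k<q)

  A-high : ∀ {x k} → q ≤ k → k < L → k · 1# ≡ x → A x ≡ false
  A-high {x} {k} q≤k k<L eq = dec-false (index x ℕ.<? q)
    (λ lt → ℕₚ.<⇒≱ lt (subst (q ≤_) (sym (index-unique k<L eq)) q≤k))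

  A-t : ∀ x → A (x ∙ t) ≡ not (A x)
  A-t x with ℕₚ.<-≤-connex (index x) q
  ... | inj₁ k<q = trans (A-high (ℕₚ.m≤n+m q k) (subst (k + q <_) (sym L≡q+q) (ℕₚ.+-monoˡ-< q k<q))
                                 (trans (×-homo-+ 1# k q) (cong₂ _∙_ (index-· x) t≡)))
                         (cong not (sym (A-low k<q (index-· x))))
    where k = index x
  ... | inj₂ q≤k = trans (A-low r<q (S.solve 4 (λ r q x t → q ⊕ r ≜ x ∷ q ≜ t ∷ t ⊕ t ≜ 𝟘 ∷ [] ⊢ r ≜ x ⊕ t)
                            (r · 1# ∷ q · 1# ∷ x ∷ t ∷ [])
                            (trans (sym (×-homo-+ 1# q r)) (trans (cong (_· 1#) k≡) (index-· x)) ∷ t≡ ∷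
                              t∙t≡ε ∷ [])))
                         (cong not (sym (A-high q≤k (index<L x) (index-· x))))
    where
    k = index x
    r = k ℕ.∸ q
    k≡ : q + r ≡ k
    k≡ = ℕₚ.m+[n∸m]≡n q≤k
    r<q : r < q
    r<q = ℕₚ.+-cancelˡ-< q r q (≡.subst₂ _<_ (sym k≡) L≡q+q (index<L x))

  -- Along the successive multiples of the generator, membership in {0, ..., q - 1} changes only on
  -- entering 0 or q, that is `ε` or `t`. These two steps are the only source of clashes.
  A-edge : ∀ z → A (z ∙ 1#) ≡ A z ⊎ (z ∙ 1# ≡ ε ⊎ z ∙ 1# ≡ t)
  A-edge z with ℕₚ.<-cmp (suc (index z)) q
  ... | tri< k+1<q _ _ = inj₁ (trans (A-low k+1<q next)
    (sym (A-low (ℕₚ.<-trans (ℕₚ.n<1+n _) k+1<q) (index-· z))))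
    where
    next : suc (index z) · 1# ≡ z ∙ 1#
    next = trans (comm 1# _) (cong (_∙ 1#) (index-· z))
  ... | tri≈ _ k+1≡q _ = inj₂ (inj₂ (trans (sym next) (trans (cong (_· 1#) k+1≡q) t≡)))
    where
    next : suc (index z) · 1# ≡ z ∙ 1#
    next = trans (comm 1# _) (cong (_∙ 1#) (index-· z))
  ... | tri> _ _ (s≤s q≤k) with ℕₚ.m≤n⇒m<n∨m≡n (index<L z)
  ...   | inj₁ k+1<L = inj₁ (trans (A-high (ℕₚ.m≤n⇒m≤1+n q≤k) k+1<L
    (trans (comm 1# _) (cong (_∙ 1#) (index-· z))))
                                   (sym (A-high q≤k (index<L z) (index-· z))))
  ...   | inj₂ k+1≡L = inj₂ (inj₁ (trans (comm z 1#) (trans (cong (1# ∙_) (sym (index-· z)))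
    (trans (cong (_· 1#) k+1≡L) L·x≡ε))))

  private
    halves = almost-halves q

  opaque
    a b : ℕ
    a = proj₁ halves
    b = proj₁ (proj₂ halves)

    q≡a+b : q ≡ a + b
    q≡a+b = proj₁ (proj₂ (proj₂ halves))

    b≤a : b ≤ a
    b≤a = proj₁ (proj₂ (proj₂ (proj₂ halves)))

    a≤1+b : a ≤ suc b
    a≤1+b = proj₂ (proj₂ (proj₂ (proj₂ halves)))

  L≡ : L ≡ (a + b) + (a + b)
  L≡ = trans L≡q+q (cong₂ _+_ q≡a+b q≡a+b)

  data Place : Set where
    even-place : ∀ i → i < a → Place
    odd-place : ∀ i → i < b → Place

  Y : Carrier
  Y = a · 1#

  triple : ℕ → Carrier
  triple i = (i · 1# ∙ i · 1#) ∙ i · 1#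

  -- `position` is the even diagonal 2j of the pair. On the even places, row, column and symbol
  -- advance by -1, 3 and 2. The odd places arise from these cells by the reflection (r, c) ↦ (-c,
  -- -r), which keeps c - r = 4i + 1, and the translation by (-a, 1 - a), which moves this
  -- difference to 4i + 2 and the rows and columns off those of the even places.
  row column position : Place → Carrier
  row (even-place i _) = (i · 1#) ⁻¹
  row (odd-place i _) = ((Y ∙ 1#) ∙ triple i) ⁻¹
  column (even-place i _) = triple i ∙ 1#
  column (odd-place i _) = (i · 1# ∙ 1#) - Y
  position (even-place i _) = triple i ∙ i · 1#
  position (odd-place i _) = (triple i ∙ i · 1#) ∙ (1# ∙ 1#)

  triple-· : ∀ i → (i + i + i) · 1# ≡ triple i
  triple-· i = trans (×-homo-+ 1# (i + i) i) (cong (_∙ i · 1#) (×-homo-+ 1# i i))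

  quadruple-· : ∀ i → ((i + i) + (i + i)) · 1# ≡ triple i ∙ i · 1#
  quadruple-· i = trans (cong (_· 1#) (sym (ℕₚ.+-assoc (i + i) i i)))
    (trans (×-homo-+ 1# (i + i + i) i) (cong (_∙ i · 1#) (triple-· i)))

  opaque
    place : ∀ e → parity e ≡ false → ∃[ p ] position p ≡ e
    place e pe with even⇒double (index e) (trans (sym (parity-·1# (index e)))
      (trans (cong parity (index-· e)) pe))
    ... | j , k≡ with odd j in oj
    ...   | false with even⇒double j oj
    ...     | i , refl = even-place i i<a , trans (sym (quadruple-· i))
      (trans (cong (_· 1#) (sym k≡)) (index-· e))
      where
      2i<q : i + i < q
      2i<q with ℕₚ.<-≤-connex (i + i) q
      ... | inj₁ lt = lt
      ... | inj₂ ge = contradiction (≡.subst₂ _<_ k≡ L≡q+q (index<L e)) (ℕₚ.≤⇒≯ (ℕₚ.+-mono-≤ ge ge))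
      i<a : i < a
      i<a with ℕₚ.<-≤-connex i a
      ... | inj₁ lt = lt
      ... | inj₂ a≤i = contradiction (subst (i + i <_) q≡a+b 2i<q)
        (ℕₚ.≤⇒≯ (ℕₚ.+-mono-≤ a≤i (ℕₚ.≤-trans b≤a a≤i)))
    place e pe | j , k≡ | true with odd⇒suc-double j oj
    ...     | i , refl = odd-place i i<b , trans (sym value) (index-· e)
      where
      value : index e · 1# ≡ (triple i ∙ i · 1#) ∙ (1# ∙ 1#)
      value = trans (cong (_· 1#) (trans k≡ (cong suc (ℕₚ.+-suc (i + i) (i + i)))))
        (S.solve 3 (λ o k k′ → k ≜ k′ ∷ [] ⊢ o ⊕ (o ⊕ k) ≜ k′ ⊕ (o ⊕ o))
          (1# ∷ ((i + i) + (i + i)) · 1# ∷ triple i ∙ i · 1# ∷ []) (quadruple-· i ∷ []))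
      2i+1<q : suc (i + i) < q
      2i+1<q with ℕₚ.<-≤-connex (suc (i + i)) q
      ... | inj₁ lt = lt
      ... | inj₂ ge = contradiction (≡.subst₂ _<_ k≡ L≡q+q (index<L e)) (ℕₚ.≤⇒≯ (ℕₚ.+-mono-≤ ge ge))
      i<b : i < b
      i<b with ℕₚ.<-≤-connex i b
      ... | inj₁ lt = lt
      ... | inj₂ b≤i = contradiction (subst (suc (i + i) <_) q≡a+b 2i+1<q)
                         (ℕₚ.≤⇒≯ (ℕₚ.+-mono-≤ (ℕₚ.≤-trans a≤1+b (s≤s b≤i)) b≤i))

  i<L : ∀ {i} → i < a → i < L
  i<L {i} i<a = subst (i <_) (sym L≡) (ℕₚ.<-≤-trans i<a (ℕₚ.≤-trans (ℕₚ.m≤m+n a b) (ℕₚ.m≤m+n (a + b) _)))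

  2i<L : ∀ {i} → i < a → i + i < L
  2i<L {i} i<a = subst (i + i <_) (sym L≡)
    (ℕₚ.+-mono-<-≤ (ℕₚ.<-≤-trans i<a (ℕₚ.m≤m+n a b)) (ℕₚ.≤-trans (ℕₚ.<⇒≤ i<a) (ℕₚ.m≤m+n a b)))

  a+3i<L : ∀ {i} → i < a → a + (i + i + i) < L
  a+3i<L {i} i<a = subst (a + (i + i + i) <_) (trans rearrange (sym L≡))
    (ℕₚ.+-monoʳ-< a (ℕₚ.+-mono-≤-< (ℕₚ.+-mono-≤ i≤b i≤b) i<a))
    where
    i≤b : i ≤ b
    i≤b = ℕₚ.≤-pred (ℕₚ.≤-trans i<a a≤1+b)
    rearrange : a + (b + b + a) ≡ (a + b) + (a + b)
    rearrange = trans (cong (a +_) (trans (ℕₚ.+-assoc b b a) (cong (b +_) (ℕₚ.+-comm b a))))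
      (sym (ℕₚ.+-assoc a b (a + b)))

  a+1+3i<L : ∀ {i} → i < b → a + suc (i + i + i) < L
  a+1+3i<L {i} i<b = subst (a + suc (i + i + i) <_) (trans (sym (ℕₚ.+-assoc a b (a + b))) (sym L≡))
    (ℕₚ.+-monoʳ-< a (ℕₚ.<-≤-trans (ℕₚ.+-mono-<-≤ (s≤s (ℕₚ.+-monoʳ-< i i<b)) (ℕₚ.<⇒≤ i<b))
      (ℕₚ.≤-trans (ℕₚ.+-monoˡ-≤ b (ℕₚ.+-monoˡ-≤ b i<b))
        (ℕₚ.≤-trans (ℕₚ.≤-reflexive (ℕₚ.+-assoc b b b)) (ℕₚ.+-monoʳ-≤ b (ℕₚ.+-monoˡ-≤ b b≤a))))))

  3i<L : ∀ {i} → i < a → i + i + i < L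
  3i<L {i} i<a = ℕₚ.≤-<-trans (ℕₚ.m≤n+m (i + i + i) a) (a+3i<L i<a)

  triple·-injective : ∀ {i j} → i < a → j < a → triple i ≡ triple j → i ≡ j
  triple·-injective {i} {j} i<a j<a eq = triple-injective
    (·-injective (3i<L i<a) (3i<L j<a) (trans (triple-· i) (trans eq (sym (triple-· j)))))

  double·-injective : ∀ {i j} → i < a → j < a → i · 1# ∙ i · 1# ≡ j · 1# ∙ j · 1# → i ≡ j
  double·-injective {i} {j} i<a j<a eq = double-injective
    (·-injective (2i<L i<a) (2i<L j<a) (trans (×-homo-+ 1# i i) (trans eq (sym (×-homo-+ 1# j j)))))

  <b⇒<a : ∀ {i} → i < b → i < a
  <b⇒<a i<b = ℕₚ.<-≤-trans i<b b≤a

  even-place-cong : ∀ {i j} (p : i < a) (p′ : j < a) → i ≡ j → even-place i p ≡ even-place j p′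
  even-place-cong p p′ refl = cong (even-place _) (ℕₚ.<-irrelevant p p′)

  odd-place-cong : ∀ {i j} (p : i < b) (p′ : j < b) → i ≡ j → odd-place i p ≡ odd-place j p′
  odd-place-cong p p′ refl = cong (odd-place _) (ℕₚ.<-irrelevant p p′)

  -- Both sides are multiples of the generator with coefficient below the order, and the coefficient
  -- on the right is at least `a`.
  no-row-clash : ∀ {i j} → i < a → j < b → i · 1# ≢ (Y ∙ 1#) ∙ triple j
  no-row-clash {i} {j} i<a j<b eq = ℕₚ.<⇒≱ i<a (subst (a ≤_) (sym i≡) (ℕₚ.m≤m+n a _))
    where
    i≡ : i ≡ a + suc (j + j + j)
    i≡ = ·-injective (i<L i<a) (a+1+3i<L j<b) (S.solve 5
      (λ i y o t t′ → i ≜ y ⊕ o ⊕ t ∷ t′ ≜ y ⊕ (o ⊕ t) ∷ [] ⊢ i ≜ t′)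
      (i · 1# ∷ Y ∷ 1# ∷ triple j ∷ (a + suc (j + j + j)) · 1# ∷ [])
      (eq ∷ trans (×-homo-+ 1# a (suc (j + j + j))) (cong (λ z → Y ∙ (1# ∙ z)) (triple-· j)) ∷ []))

  no-column-clash : ∀ {i j} → i < a → j < b → triple i ∙ 1# ≢ (j · 1# ∙ 1#) - Y
  no-column-clash {i} {j} i<a j<b eq =
    ℕₚ.<⇒≱ (<b⇒<a j<b) (subst (a ≤_) j≡ (ℕₚ.m≤m+n a (i + i + i)))
    where
    j≡ : a + (i + i + i) ≡ j
    j≡ = ·-injective (a+3i<L i<a) (i<L (<b⇒<a j<b)) (S.solve 5
      (λ j y o t t′ → t ⊕ o ≜ j ⊕ o ⊖ y ∷ t′ ≜ y ⊕ t ∷ [] ⊢ t′ ≜ j)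
      (j · 1# ∷ Y ∷ 1# ∷ triple i ∷ (a + (i + i + i)) · 1# ∷ [])
      (eq ∷ trans (×-homo-+ 1# a (i + i + i)) (cong (Y ∙_) (triple-· i)) ∷ []))

  row-injective : ∀ p p′ → row p ≡ row p′ → p ≡ p′
  row-injective (even-place i p) (even-place j p′) eq = even-place-cong p p′ (·-injective (i<L p) (i<L p′)
    (S.solve 2 (λ i j → ⊝ i ≜ ⊝ j ∷ [] ⊢ i ≜ j) (i · 1# ∷ j · 1# ∷ []) (eq ∷ [])))
  row-injective (odd-place i p) (odd-place j p′) eq = odd-place-cong p p′
    (triple·-injective (<b⇒<a p) (<b⇒<a p′)
    (S.solve 3 (λ i j y → ⊝ (y ⊕ i) ≜ ⊝ (y ⊕ j) ∷ [] ⊢ i ≜ j) (triple i ∷ triple j ∷ Y ∙ 1# ∷ [])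
      (eq ∷ [])))
  row-injective (even-place i p) (odd-place j p′) eq = contradiction
    (S.solve 2 (λ i j → ⊝ i ≜ ⊝ j ∷ [] ⊢ i ≜ j) (i · 1# ∷ (Y ∙ 1#) ∙ triple j ∷ []) (eq ∷ []))
      (no-row-clash p p′)
  row-injective (odd-place i p) (even-place j p′) eq = contradiction
    (S.solve 2 (λ i j → ⊝ i ≜ ⊝ j ∷ [] ⊢ j ≜ i) ((Y ∙ 1#) ∙ triple i ∷ j · 1# ∷ []) (eq ∷ []))
      (no-row-clash p′ p)

  column-injective : ∀ p p′ → column p ≡ column p′ → p ≡ p′
  column-injective (even-place i p) (even-place j p′) eq = even-place-cong p p′ (triple·-injective p p′
    (S.solve 3 (λ i j o → i ⊕ o ≜ j ⊕ o ∷ [] ⊢ i ≜ j) (triple i ∷ triple j ∷ 1# ∷ []) (eq ∷ [])))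
  column-injective (odd-place i p) (odd-place j p′) eq = odd-place-cong p p′
    (·-injective (i<L (<b⇒<a p)) (i<L (<b⇒<a p′))
    (S.solve 4 (λ i j o y → i ⊕ o ⊖ y ≜ j ⊕ o ⊖ y ∷ [] ⊢ i ≜ j) (i · 1# ∷ j · 1# ∷ 1# ∷ Y ∷ []) (eq ∷ [])))
  column-injective (even-place i p) (odd-place j p′) eq = contradiction eq (no-column-clash p p′)
  column-injective (odd-place i p) (even-place j p′) eq = contradiction (sym eq) (no-column-clash p′ p)

  symbol : Place → Carrier
  symbol p = row p ∙ column p

  -- The symbols are 2i + 1 on the even places and -2(a + j) on the odd ones.
  parity-symbol : ∀ i p j p′ → symbol (even-place i p) ≢ symbol (odd-place j p′)
  parity-symbol i p j p′ eq = true≢false (trans (sym (trans (parity-∙ (X ∙ X) 1#)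
    (cong₂ _xor_ (parity-square X) parity-1#)))
    (trans (cong parity (S.solve 4
      (λ x z y o → ⊝ x ⊕ (x ⊕ x ⊕ x ⊕ o) ≜ ⊝ (y ⊕ o ⊕ (z ⊕ z ⊕ z)) ⊕ (z ⊕ o ⊖ y) ∷ [] ⊢ x ⊕ x ⊕ o ≜ ⊝
        (y ⊕ z) ⊖ (y ⊕ z))
      (X ∷ Z ∷ Y ∷ 1# ∷ []) (eq ∷ []))) (parity-square ((Y ∙ Z) ⁻¹))))
    where
    X = i · 1#
    Z = j · 1#

  symbol-injective : ∀ p p′ → symbol p ≡ symbol p′ → p ≡ p′
  symbol-injective (even-place i p) (even-place j p′) eq = even-place-cong p p′ (double·-injective p p′
    (S.solve 3 (λ x z o → ⊝ x ⊕ (x ⊕ x ⊕ x ⊕ o) ≜ ⊝ z ⊕ (z ⊕ z ⊕ z ⊕ o) ∷ [] ⊢ x ⊕ x ≜ z ⊕ z)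
      (i · 1# ∷ j · 1# ∷ 1# ∷ []) (eq ∷ [])))
  symbol-injective (odd-place i p) (odd-place j p′) eq = odd-place-cong p p′
    (double·-injective (<b⇒<a p) (<b⇒<a p′)
    (S.solve 4 (λ x z y o → ⊝ (y ⊕ o ⊕ (x ⊕ x ⊕ x)) ⊕ (x ⊕ o ⊖ y) ≜ ⊝ (y ⊕ o ⊕ (z ⊕ z ⊕ z)) ⊕
      (z ⊕ o ⊖ y) ∷ [] ⊢ x ⊕ x ≜ z ⊕ z)
      (i · 1# ∷ j · 1# ∷ Y ∷ 1# ∷ []) (eq ∷ [])))
  symbol-injective (even-place i p) (odd-place j p′) eq = contradiction eq (parity-symbol i p j p′)
  symbol-injective (odd-place i p) (even-place j p′) eq = contradiction (sym eq) (parity-symbol j p′ i p)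

  -- A clash consists of two cells in one column, one on each diagonal of the pair. Removing either
  -- resolves it, so the recoloured cell may be taken from whichever diagonal suits the transversal.
  on-diagonal : ∀ p → column p ≡ row p ∙ position p ⊎ column p ≡ (row p ∙ position p) ∙ 1#
  on-diagonal (even-place i _) = inj₂ (S.solve 2
    (λ x o → [] ⊢ x ⊕ x ⊕ x ⊕ o ≜ ⊝ x ⊕ (x ⊕ x ⊕ x ⊕ x) ⊕ o) (i · 1# ∷ 1# ∷ []) [])
  on-diagonal (odd-place i _) = inj₁ (S.solve 3
    (λ x y o → [] ⊢ x ⊕ o ⊖ y ≜ ⊝ (y ⊕ o ⊕ (x ⊕ x ⊕ x)) ⊕ (x ⊕ x ⊕ x ⊕ x ⊕ (o ⊕ o)))
      (i · 1# ∷ Y ∷ 1# ∷ []) [])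

  shift : Bool → Carrier
  shift false = ε
  shift true = 1#

  parity-shift : ∀ o → parity (shift o) ≡ o
  parity-shift false = parity-ε
  parity-shift true = parity-1#

  flag : Bool → Carrier
  flag true = ε
  flag false = 1#

  parity-flag : ∀ f → parity (flag f) ≡ not f
  parity-flag true = parity-ε
  parity-flag false = parity-1#

  τ : Bool → Carrier
  τ false = ε
  τ true = t

  offset : Carrier → Carrier → Bool
  offset x y = parity (y - x)

  even-part : Carrier → Carrier → Carrier
  even-part x y = (y - x) - shift (offset x y)

  parity-even-part : ∀ x y → parity (even-part x y) ≡ false
  parity-even-part x y = trans (parity-∙ _ _) (trans (cong (offset x y xor_)
    (trans (parity-⁻¹ _) (parity-shift (offset x y)))) (xor-same (offset x y)))

  spot : ∀ e → parity e ≡ false → Place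
  spot e pe = proj₁ (place e pe)

  position-spot : ∀ {e} pe → position (spot e pe) ≡ e
  position-spot {e} pe = proj₂ (place e pe)

  spot-cong : ∀ {e e′} pe pe′ → e ≡ e′ → spot e pe ≡ spot e′ pe′
  spot-cong {e} pe pe′ refl = cong (spot e) (≡-irrelevant pe pe′)

  -- The half-set is translated so that the clashes fall into the columns `column p` and
  -- `column p ∙ t`, which contain the removed cells.
  orient : Place → Carrier → Bool → Bool
  orient p x o = A (x - (column p - position p)) xor o

  record Removed (x y : Carrier) (p : Place) (s : Bool) : Set where
    constructor _,_
    field
      row≡ : x ≡ row p ∙ τ s
      column≡ : y ≡ column p ∙ τ s

  removed? : ∀ x y p s → Dec (Removed x y p s)
  removed? x y p s with x ≟ row p ∙ τ s | y ≟ column p ∙ τ s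
  ... | yes x≡ | yes y≡ = yes (x≡ , y≡)
  ... | no x≢ | _ = no (x≢ ∘ Removed.row≡)
  ... | _ | no y≢ = no (y≢ ∘ Removed.column≡)

  data Cell (x y : Carrier) : Carrier ⊎ Bool → Set where
    extra : ∀ p s → Removed x y p s → Cell x y (inj₂ s)
    main : ∀ e pe o → let p = spot e pe in y ≡ x ∙ position p ∙ shift o →
           (∀ s → ¬ Removed x y p s) → Cell x y (inj₁ (position p ∙ flag (orient p x o)))

  cell : ∀ x y → ∃[ k ] Cell x y k
  cell x y with removed? x y p false | removed? x y p true
    where p = spot (even-part x y) (parity-even-part x y)
  ... | yes r | _ = _ , extra _ false r
  ... | no _ | yes r = _ , extra _ true r
  ... | no ¬r₀ | no ¬r₁ = _ , main (even-part x y) (parity-even-part x y) (offset x y)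
          (S.solve 4 (λ x y p s → p ≜ y ⊖ x ⊖ s ∷ [] ⊢ y ≜ x ⊕ p ⊕ s)
            (x ∷ y ∷ position p ∷ shift (offset x y) ∷ []) (position-spot (parity-even-part x y) ∷ []))
          λ { false → ¬r₀ ; true → ¬r₁ }
    where p = spot (even-part x y) (parity-even-part x y)

  Same : Carrier → Carrier → Carrier → Carrier → Set
  Same x y x′ y′ = x ≡ x′ × y ≡ y′

  extra-separate : ∀ {x y x′ y′ p p′} s → Removed x y p s → Removed x′ y′ p′ s → Share x y x′ y′ →
    Same x y x′ y′
  extra-separate {p = p} {p′} s (x≡ , y≡) (x′≡ , y′≡) share = finish (place≡ share)
    where
    place≡ : Share _ _ _ _ → p ≡ p′
    place≡ (inj₁ e) = row-injective p p′ (S.solve 3 (λ r r′ t → r ⊕ t ≜ r′ ⊕ t ∷ [] ⊢ r ≜ r′)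
      (row p ∷ row p′ ∷ τ s ∷ []) (trans (sym x≡) (trans e x′≡) ∷ []))
    place≡ (inj₂ (inj₁ e)) = column-injective p p′ (S.solve 3 (λ r r′ t → r ⊕ t ≜ r′ ⊕ t ∷ [] ⊢ r ≜ r′)
      (column p ∷ column p′ ∷ τ s ∷ []) (trans (sym y≡) (trans e y′≡) ∷ []))
    place≡ (inj₂ (inj₂ e)) = symbol-injective p p′ (S.solve 5
      (λ r r′ c c′ t → r ⊕ t ⊕ (c ⊕ t) ≜ r′ ⊕ t ⊕ (c′ ⊕ t) ∷ [] ⊢ r ⊕ c ≜ r′ ⊕ c′)
      (row p ∷ row p′ ∷ column p ∷ column p′ ∷ τ s ∷ [])
      (trans (sym (cong₂ _∙_ x≡ y≡)) (trans e (cong₂ _∙_ x′≡ y′≡)) ∷ []))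
    finish : p ≡ p′ → Same _ _ _ _
    finish refl = trans x≡ (sym x′≡) , trans y≡ (sym y′≡)

  main-same : ∀ {x y x′ y′} p o → y ≡ x ∙ position p ∙ shift o → y′ ≡ x′ ∙ position p ∙ shift o →
              orient p x o ≡ orient p x′ o → Share x y x′ y′ → Same x y x′ y′
  main-same {x} {y} {x′} {y′} p o y≡ y′≡ f≡ share = x≡ share , y≡′ (x≡ share)
    where
    y≡′ : x ≡ x′ → y ≡ y′
    y≡′ e = trans y≡ (trans (cong (λ z → z ∙ position p ∙ shift o) e) (sym y′≡))
    d = column p - position p
    x≡ : Share x y x′ y′ → x ≡ x′
    x≡ (inj₁ e) = e
    x≡ (inj₂ (inj₁ e)) = S.solve 4 (λ x x′ p s → x ⊕ p ⊕ s ≜ x′ ⊕ p ⊕ s ∷ [] ⊢ x ≜ x′)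
      (x ∷ x′ ∷ position p ∷ shift o ∷ []) (trans (sym y≡) (trans e y′≡) ∷ [])
    x≡ (inj₂ (inj₂ e)) with involution-unique (x - x′) (S.solve 6
      (λ x y x′ y′ p s → x ⊕ y ≜ x′ ⊕ y′ ∷ y ≜ x ⊕ p ⊕ s ∷ y′ ≜ x′ ⊕ p ⊕ s ∷ [] ⊢ x ⊖ x′ ⊕ (x ⊖ x′) ≜ 𝟘)
      (x ∷ y ∷ x′ ∷ y′ ∷ position p ∷ shift o ∷ []) (e ∷ y≡ ∷ y′≡ ∷ []))
    ... | inj₁ z = S.solve 2 (λ x x′ → x ⊖ x′ ≜ 𝟘 ∷ [] ⊢ x ≜ x′) (x ∷ x′ ∷ []) (z ∷ [])
    ... | inj₂ z = contradiction (trans (sym (xor-cancelʳ o f≡)) (trans (cong A (S.solve 4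
        (λ x x′ d t → x ⊖ x′ ≜ t ∷ [] ⊢ x ⊖ d ≜ x′ ⊖ d ⊕ t) (x ∷ x′ ∷ d ∷ t ∷ []) (z ∷ [])))
          (A-t (x′ - d))))
      (not-¬ refl)

  -- Rows are separated by the complementary halves, and symbols by parity. A common column means x
  -- = x′ + 1, so a clash needs a step at which `A` changes, and there one of the two cells has been
  -- removed.
  main-opposite : ∀ {x y x′ y′} p →
                  y ≡ x ∙ position p ∙ shift false → y′ ≡ x′ ∙ position p ∙ shift true →
                  (∀ s → ¬ Removed x y p s) → (∀ s → ¬ Removed x′ y′ p s) →
                  orient p x false ≡ orient p x′ true → ¬ Share x y x′ y′
  main-opposite {x} {y} {x′} {y′} p y≡ y′≡ kept kept′ f≡ = clash
    where
    d = column p - position p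
    z = x′ - d
    flags : A (x - d) ≡ not (A z)
    flags = trans (sym (xor-identityʳ _)) (trans f≡ (xor-comm _ true))
    removed : ∀ s → z ∙ 1# ≡ τ s → y ≡ y′ → ⊥
    removed s z≡ e with on-diagonal p
    ... | inj₁ c≡ = kept s
      (x-row , y-column)
      where
      x-row : x ≡ row p ∙ τ s
      x-row = S.solve 8
        (λ x x′ y y′ r c q τ → y ≜ y′ ∷ y ≜ x ⊕ q ⊕ 𝟘 ∷ c ≜ r ⊕ q ∷ y′ ≜ c ⊕ τ ∷ [] ⊢ x ≜ r ⊕ τ)
        (x ∷ x′ ∷ y ∷ y′ ∷ row p ∷ column p ∷ position p ∷ τ s ∷ [])
        (e ∷ y≡ ∷ c≡ ∷ S.solve 6 (λ x′ y′ c q o τ → x′ ⊖ (c ⊖ q) ⊕ o ≜ τ ∷ y′ ≜ x′ ⊕ q ⊕ o ∷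
          [] ⊢ y′ ≜ c ⊕ τ)
          (x′ ∷ y′ ∷ column p ∷ position p ∷ 1# ∷ τ s ∷ []) (z≡ ∷ y′≡ ∷ []) ∷ [])
      y-column : y ≡ column p ∙ τ s
      y-column = trans e (S.solve 6 (λ x′ y′ c q o τ → x′ ⊖ (c ⊖ q) ⊕ o ≜ τ ∷ y′ ≜ x′ ⊕ q ⊕ o ∷
        [] ⊢ y′ ≜ c ⊕ τ)
          (x′ ∷ y′ ∷ column p ∷ position p ∷ 1# ∷ τ s ∷ []) (z≡ ∷ y′≡ ∷ []))
    ... | inj₂ c≡ = kept′ s
      ( S.solve 6 (λ x′ r c q o τ → x′ ⊖ (c ⊖ q) ⊕ o ≜ τ ∷ c ≜ r ⊕ q ⊕ o ∷ [] ⊢ x′ ≜ r ⊕ τ)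
          (x′ ∷ row p ∷ column p ∷ position p ∷ 1# ∷ τ s ∷ []) (z≡ ∷ c≡ ∷ [])
      , S.solve 6 (λ x′ y′ c q o τ → x′ ⊖ (c ⊖ q) ⊕ o ≜ τ ∷ y′ ≜ x′ ⊕ q ⊕ o ∷ [] ⊢ y′ ≜ c ⊕ τ)
          (x′ ∷ y′ ∷ column p ∷ position p ∷ 1# ∷ τ s ∷ []) (z≡ ∷ y′≡ ∷ []))
    clash : ¬ Share x y x′ y′
    clash (inj₁ refl) = not-¬ refl flags
    clash (inj₂ (inj₁ e)) with A-edge z
    ... | inj₁ same = not-¬ (trans (cong A (S.solve 5
            (λ x x′ q d o → x ⊕ q ⊕ 𝟘 ≜ x′ ⊕ q ⊕ o ∷ [] ⊢ x ⊖ d ≜ x′ ⊖ d ⊕ o)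
            (x ∷ x′ ∷ position p ∷ d ∷ 1# ∷ []) (trans (sym y≡) (trans e y′≡) ∷ []))) same) flags
    ... | inj₂ (inj₁ z≡ε) = removed false z≡ε e
    ... | inj₂ (inj₂ z≡t) = removed true z≡t e
    clash (inj₂ (inj₂ e)) = true≢false (trans
      (sym (trans (parity-∙ (x′ ∙ x′) 1#) (cong₂ _xor_ (parity-square x′) parity-1#)))
      (trans (cong parity (S.solve 6
        (λ x y x′ y′ q o → x ⊕ y ≜ x′ ⊕ y′ ∷ y ≜ x ⊕ q ⊕ 𝟘 ∷ y′ ≜ x′ ⊕ q ⊕ o ∷ [] ⊢ x′ ⊕ x′ ⊕ o ≜ x ⊕ x)
        (x ∷ y ∷ x′ ∷ y′ ∷ position p ∷ 1# ∷ []) (e ∷ y≡ ∷ y′≡ ∷ []))) (parity-square x)))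

  main-main : ∀ {x y x′ y′} p o o′ →
              y ≡ x ∙ position p ∙ shift o → y′ ≡ x′ ∙ position p ∙ shift o′ →
              (∀ s → ¬ Removed x y p s) → (∀ s → ¬ Removed x′ y′ p s) →
              orient p x o ≡ orient p x′ o′ → Share x y x′ y′ → Same x y x′ y′
  main-main p false false y≡ y′≡ _ _ f≡ = main-same p false y≡ y′≡ f≡
  main-main p true true y≡ y′≡ _ _ f≡ = main-same p true y≡ y′≡ f≡
  main-main p false true y≡ y′≡ kept kept′ f≡ share =
    contradiction share (main-opposite p y≡ y′≡ kept kept′ f≡)
  main-main p true false y≡ y′≡ kept kept′ f≡ share =
    contradiction (Share-sym share) (main-opposite p y′≡ y≡ kept′ kept (sym f≡))

  decode : ∀ {e e′} f f′ → parity e ≡ false → parity e′ ≡ false → e ∙ flag f ≡ e′ ∙ flag f′ →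
    e ≡ e′ × f ≡ f′
  decode {e} {e′} f f′ pe pe′ eq = S.solve 4 (λ e e′ f f′ → e ⊕ f ≜ e′ ⊕ f′ ∷ f ≜ f′ ∷ [] ⊢ e ≜ e′)
      (e ∷ e′ ∷ flag f ∷ flag f′ ∷ []) (eq ∷ cong flag f≡ ∷ []) , f≡
    where
    f≡ : f ≡ f′
    f≡ = not-injective (trans (sym (trans (parity-∙ e (flag f)) (cong₂ _xor_ pe (parity-flag f))))
      (trans (cong parity eq) (trans (parity-∙ e′ (flag f′)) (cong₂ _xor_ pe′ (parity-flag f′)))))

  separate : ∀ {x y x′ y′ k k′} → Cell x y k → Cell x′ y′ k′ → k ≡ k′ → Share x y x′ y′ → Same x y x′ y′
  separate (extra p s r) (extra p′ .s r′) refl share = extra-separate s r r′ share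
  separate {x} {y} {x′} {y′} (main e pe o y≡ kept) (main e′ pe′ o′ y′≡ kept′) eq share
    with decode (orient (spot e pe) x o) (orient (spot e′ pe′) x′ o′)
                (trans (cong parity (position-spot pe)) pe) (trans (cong parity (position-spot pe′)) pe′)
                (inj₁-injective eq)
  ... | e≡ , f≡ = finish (spot-cong pe pe′ (trans (sym (position-spot pe))
    (trans e≡ (position-spot pe′)))) y′≡ kept′ f≡
    where
    finish : ∀ {p′} → spot e pe ≡ p′ → y′ ≡ x′ ∙ position p′ ∙ shift o′ → (∀ s → ¬ Removed x′ y′ p′ s) →
             orient (spot e pe) x o ≡ orient p′ x′ o′ → Same x y x′ y′
    finish refl y′≡ kept′ f≡ = main-main (spot e pe) o o′ y≡ y′≡ kept kept′ f≡ share

  colouring : Colouring G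
  colouring = record
    { colour = λ x y → proj₁ (cell x y)
    ; proper = λ {x} {y} {x′} {y′} → separate (proj₂ (cell x y)) (proj₂ (cell x′ y′)) }

-- Reduction to cyclic groups

prime-coprime : ∀ {p k} → Prime p → ¬ p ∣ k → Coprime p k
prime-coprime p-prime p∤k (d∣p , d∣k) with prime⇒irreducible p-prime d∣p
... | inj₁ d≡1 = d≡1
... | inj₂ refl = contradiction d∣k p∤k

module _ (G : FiniteAbelianGroup) where
  open FiniteAbelianGroup G
  private
    module S = LinearSolver 𝒢

  ∃? : ∀ {P : Carrier → Set} → Decidable P → Dec (∃ P)
  ∃? P? = map′ Any.satisfied (λ (x , px) → lose (complete x) px) (Any.any? P? elements)

  -- Multiplication by `exponent ∸ 1` is negation. Integral Bézout identities thus become identities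
  -- with natural coefficients.
  neg : ℕ → ℕ
  neg k = (exponent ∸ 1) * k

  neg-· : ∀ k x → neg k · x ≡ (k · x) ⁻¹
  neg-· k x with exponent | exponent≢0 | exponent·x≡ε
  ... | suc N | _ | kill = S.solve 2 (λ a b → a ⊕ b ≜ 𝟘 ∷ [] ⊢ b ≜ ⊝ a) (k · x ∷ (N * k) · x ∷ [])
    (trans (sym (×-homo-+ x k (N * k))) (trans (sym (×-assocˡ x (suc N) k)) (kill (k · x))) ∷ [])

  ·-swap : ∀ j k x → j · (k · x) ≡ k · (j · x)
  ·-swap j k x = trans (×-assocˡ x j k) (trans (cong (_· x) (ℕₚ.*-comm j k)) (sym (×-assocˡ x k j)))

  ·-⁻¹ : ∀ k x → k · (x ⁻¹) ≡ (k · x) ⁻¹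
  ·-⁻¹ k x = S.solve 3 (λ a b c → c ≜ a ⊕ b ∷ c ≜ 𝟘 ∷ [] ⊢ b ≜ ⊝ a)
    (k · x ∷ k · (x ⁻¹) ∷ k · (x ∙ x ⁻¹) ∷ [])
    (×-distrib-+ x (x ⁻¹) k ∷ trans (cong (k ·_) (inverseʳ x)) (·-ε G k) ∷ [])

  private
    sign-free : ∀ {p k} x y → 1 + y * k ≡ x * p → ∀ z → (x * p) · z ∙ (neg y * k) · z ≡ z
    sign-free {p} {k} x y eq z = S.solve 4 (λ z a b c → a ≜ z ⊕ b ∷ c ≜ ⊝ b ∷ [] ⊢ a ⊕ c ≜ z)
      (z ∷ (x * p) · z ∷ (y * k) · z ∷ (neg y * k) · z ∷ [])
      (cong (_· z) (sym eq) ∷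
       trans (cong (_· z) (ℕₚ.*-assoc (exponent ∸ 1) y k)) (neg-· (y * k) z) ∷ [])

  bézout-· : ∀ {p k} → Coprime p k → ∃[ u ] ∃[ v ] (∀ z → (u * p) · z ∙ (v * k) · z ≡ z)
  bézout-· {p} {k} coprime with coprime-Bézout coprime
  ... | Bézout.+- x y eq = x , neg y , sign-free x y eq
  ... | Bézout.-+ x y eq = neg x , y , λ z → trans (comm _ _) (sign-free y x eq z)

  subgroup : (P : Carrier → Set) → Decidable P → P ε → (∀ {x y} → P x → P y → P (x ∙ y)) →
             (∀ {x} → P x → P (x ⁻¹)) → Subgroup G
  subgroup P P? Pε P∙ P⁻¹ = record
    { member = λ x → isYes (P? x)
    ; ε∈ = fromWitness Pε
    ; ∙∈ = λ p q → fromWitness (P∙ (toWitness p) (toWitness q))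
    ; ⁻¹∈ = λ p → fromWitness (P⁻¹ (toWitness p)) }

  private
    Multiple : ℕ → Carrier → Set
    Multiple k x = ∃[ y ] x ≡ k · y

    multiple? : ∀ k → Decidable (Multiple k)
    multiple? k x = ∃? (λ y → x ≟ k · y)

  multiples : ℕ → Subgroup G
  multiples k = subgroup (Multiple k) (multiple? k) (ε , sym (·-ε G k))
    (λ { (y , refl) (z , refl) → y ∙ z , sym (×-distrib-+ y z k) })
    (λ { (y , refl) → y ⁻¹ , sym (·-⁻¹ k y) })

  opaque
    multiple-∈ : ∀ k y → T (Subgroup.member (multiples k) (k · y))
    multiple-∈ k y = fromWitness {a? = multiple? k (k · y)} (y , refl)

    multiple-view : ∀ k {x} → T (Subgroup.member (multiples k) x) → ∃[ y ] x ≡ k · y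
    multiple-view k {x} = toWitness {a? = multiple? k x}

  ·-cong : ∀ (M : Subgroup G) k {x y} → Subgroup._≈_ M x y → Subgroup._≈_ M (k · x) (k · y)
  ·-cong M zero _ = Subgroup.≈-reflexive M refl
  ·-cong M (suc k) x≈y = Subgroup.∙-cong M x≈y (·-cong M k x≈y)

  ·-∈ : ∀ (M : Subgroup G) k {x} → T (Subgroup.member M x) → T (Subgroup.member M (k · x))
  ·-∈ M zero _ = Subgroup.ε∈ M
  ·-∈ M (suc k) x∈ = Subgroup.∙∈ M x∈ (·-∈ M k x∈)

  module Adjoin (M : Subgroup G) (x : Carrier) where
    open Subgroup M

    private
      In : Carrier → Set
      In y = ∃[ k ] T (member (y - k · x))

      in? : Decidable In
      -- Multiples of `x` repeat with period `exponent`, which makes the search finite.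
      in? y = map′ (λ (k , _ , p) → k , p) reduce (ℕₚ.anyUpTo? (λ k → T? (member (y - k · x))) exponent)
        where
        instance _ = exponent≢0
        reduce : In y → ∃[ k ] (k < exponent × T (member (y - k · x)))
        reduce (k , p) = k % exponent , DivMod.m%n<n k exponent , subst (λ z → T (member (y - z))) k·x≡ p
          where
          k·x≡ : k · x ≡ (k % exponent) · x
          k·x≡ = S.solve 3 (λ a b c → a ≜ b ⊕ c ∷ c ≜ 𝟘 ∷ [] ⊢ a ≜ b)
            (k · x ∷ (k % exponent) · x ∷ (k / exponent * exponent) · x ∷ [])
            (trans (cong (_· x) (DivMod.m≡m%n+[m/n]*n k exponent))
              (×-homo-+ x (k % exponent) (k / exponent * exponent)) ∷
             trans (sym (×-assocˡ x (k / exponent) exponent))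
                   (trans (cong ((k / exponent) ·_) (exponent·x≡ε x)) (·-ε G (k / exponent))) ∷ [])

    adjoin : Subgroup G
    adjoin = subgroup In in?
      (0 , subst (T ∘ member) (sym (inverseʳ ε)) ε∈)
      (λ { {y} {z} (k , p) (l , q) → k + l , subst (T ∘ member)
         (S.solve 5 (λ y z a b c → c ≜ a ⊕ b ∷ [] ⊢ y ⊖ a ⊕ (z ⊖ b) ≜ y ⊕ z ⊖ c)
           (y ∷ z ∷ k · x ∷ l · x ∷ (k + l) · x ∷ []) (×-homo-+ x k l ∷ [])) (∙∈ p q) })
      (λ { {y} (k , p) → neg k , subst (T ∘ member)
         (S.solve 3 (λ y a b → b ≜ ⊝ a ∷ [] ⊢ ⊝ (y ⊖ a) ≜ ⊝ y ⊖ b) (y ∷ k · x ∷ neg k · x ∷ [])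
           (neg-· k x ∷ [])) (⁻¹∈ p) })

    opaque
      adjoin-view : ∀ {y} → T (Subgroup.member adjoin y) → In y
      adjoin-view {y} = toWitness {a? = in? y}

      adjoin-in : ∀ {y} → In y → T (Subgroup.member adjoin y)
      adjoin-in {y} = fromWitness {a? = in? y}

    base∈ : ∀ {y} → T (member y) → T (Subgroup.member adjoin y)
    base∈ {y} y∈ = adjoin-in (0 , subst (T ∘ member) (S.solve 1 (λ y → [] ⊢ y ≜ y ⊖ 𝟘) (y ∷ []) []) y∈)

    x∈ : T (Subgroup.member adjoin x)
    x∈ = adjoin-in (1 , subst (T ∘ member) (S.solve 1 (λ x → [] ⊢ 𝟘 ≜ x ⊖ (x ⊕ 𝟘)) (x ∷ []) []) ε∈)

  Cyclic-mod : Subgroup G → Set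
  Cyclic-mod M = ∃[ x ] (∀ y → ∃[ k ] T (Subgroup.member M (y - k · x)))

  -- For prime p, this presents G/M as a plane over the field with p elements, with basis `e₁`,
  -- `e₂`.
  record RankTwo (p : ℕ) : Set where
    field
      M : Subgroup G
    open Subgroup M
    field
      p·∈ : ∀ x → T (member (p · x))
      e₁ e₂ : Carrier
      e₁∉ : ¬ T (member e₁)
      e₂∉ : ¬ T (Subgroup.member (Adjoin.adjoin M e₁) e₂)
      span : ∀ y → ∃[ a ] ∃[ b ] T (member (y - (a · e₁ ∙ b · e₂)))

  private
    -- Each adjunction of a new element lowers this count, which makes `climb` terminate.
    missing : (Carrier → Bool) → List Carrier → ℕ
    missing f [] = 0
    missing f (x ∷ xs) = if f x then missing f xs else suc (missing f xs)

    missing-≤ : ∀ {f h : Carrier → Bool} → (∀ {x} → T (f x) → T (h x)) → ∀ xs → missing h xs ≤ missing f xs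
    missing-≤ f⊆h [] = z≤n
    missing-≤ {f} {h} f⊆h (x ∷ xs) with f x in fx | h x in hx
    ... | true | true = missing-≤ {f} {h} f⊆h xs
    ... | true | false = contradiction (subst T hx (f⊆h (subst T (sym fx) _))) λ ()
    ... | false | true = ℕₚ.m≤n⇒m≤1+n (missing-≤ {f} {h} f⊆h xs)
    ... | false | false = s≤s (missing-≤ {f} {h} f⊆h xs)

    missing-< : ∀ {f h : Carrier → Bool} → (∀ {x} → T (f x) → T (h x)) → ∀ {x xs} → x ∈ˡ xs → ¬ T
      (f x) → T (h x) →
                missing h xs < missing f xs
    missing-< {f} {h} f⊆h {x} {_ ∷ xs} (here refl) x∉f x∈h with f x | h x
    ... | true | _ = contradiction _ x∉f
    ... | false | true = s≤s (missing-≤ {f} {h} f⊆h xs)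
    missing-< {f} {h} f⊆h {x} {y ∷ xs} (there x∈) x∉f x∈h with f y in fy | h y in hy
    ... | true | true = missing-< {f} {h} f⊆h x∈ x∉f x∈h
    ... | true | false = contradiction (subst T hy (f⊆h (subst T (sym fy) _))) λ ()
    ... | false | true = ℕₚ.m≤n⇒m≤1+n (missing-< {f} {h} f⊆h x∈ x∉f x∈h)
    ... | false | false = s≤s (missing-< {f} {h} f⊆h x∈ x∉f x∈h)

  -- Adjoin elements to M one at a time; the last two give the quotient of rank two.
  climb : ∀ {p} n (M : Subgroup G) → (∀ x → T (Subgroup.member M (p · x))) →
          missing (Subgroup.member M) elements ≤ n → Cyclic-mod M ⊎ RankTwo p
  climb {p} n M p·∈ bound with ∃? (λ x → ¬? (T? (Subgroup.member M x)))
  ... | no full = inj₁ (ε , λ y → 0 , in-M (y - ε))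
    where
    in-M : ∀ y → T (Subgroup.member M y)
    in-M y with T? (Subgroup.member M y)
    ... | yes y∈ = y∈
    ... | no y∉ = contradiction (y , y∉) full
  climb zero M p·∈ bound | yes (x , x∉M) =
    contradiction (ℕₚ.<-≤-trans (missing-< {Subgroup.member M} {const true} _
      (complete x) x∉M _) bound) λ ()
  climb {p} (suc n) M p·∈ bound | yes (x , x∉M)
    with climb {p} n adjoin (λ y → base∈ (p·∈ y))
               (ℕₚ.≤-pred (ℕₚ.<-≤-trans (missing-< {Subgroup.member M} {Subgroup.member adjoin} base∈
                 (complete x) x∉M x∈) bound))
    where open Adjoin M x
  ... | inj₂ found = inj₂ found
  ... | inj₁ (x′ , covers) with T? (Subgroup.member (Adjoin.adjoin M x) x′)
  ...   | yes x′∈ = inj₁ (x , λ y → adjoin-view (whole y))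
    where
    open Adjoin M x
    whole : ∀ y → T (Subgroup.member adjoin y)
    whole y = let k , p = covers y in subst (T ∘ Subgroup.member adjoin)
      (S.solve 2 (λ y z → [] ⊢ y ⊖ z ⊕ z ≜ y) (y ∷ k · x′ ∷ []) [])
      (Subgroup.∙∈ adjoin p (·-∈ adjoin k x′∈))
  ...   | no x′∉ = inj₂ (record
    { M = M ; p·∈ = p·∈ ; e₁ = x ; e₂ = x′ ; e₁∉ = x∉M ; e₂∉ = x′∉
    ; span = λ y → let k , q = covers y ; j , r = adjoin-view q in j , k , subst (T ∘ Subgroup.member M)
        (S.solve 3 (λ y a b → [] ⊢ y ⊖ b ⊖ a ≜ y ⊖ (a ⊕ b)) (y ∷ j · x ∷ k · x′ ∷ []) []) r })
    where open Adjoin M x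

  cyclic-or-rank-two : ∀ p → Cyclic-mod (multiples p) ⊎ RankTwo p
  cyclic-or-rank-two p = climb _ (multiples p) (multiple-∈ p) ℕₚ.≤-refl

  -- If p divides k, write y = ax + kz and expand z in the same way: the remainder lies in k²G,
  -- which is contained in pkG. Otherwise the generators are combined as in the Chinese remainder
  -- theorem.
  cyclic-mod-product : ∀ {p k} → Prime p → Cyclic-mod (multiples p) → Cyclic-mod (multiples k) →
    Cyclic-mod (multiples (p * k))
  cyclic-mod-product {p} {k} p-prime (e , e-spans) (x , x-spans) with p ∣? k
  ... | yes (divides c k≡) = x , λ y →
    let a , y∈ = x-spans y ; z , y≡ = multiple-view k y∈
        b , z∈ = x-spans z ; w , z≡ = multiple-view k z∈
    in a + k * b , subst (T ∘ Subgroup.member (multiples (p * k)))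
      (S.solve 7 (λ y ax z kz kbx kw abx → y ⊖ ax ≜ kz ∷ kz ≜ kbx ⊕ kw ∷ abx ≜ ax ⊕ kbx ∷ [] ⊢ kw ≜ y ⊖ abx)
        (y ∷ a · x ∷ z ∷ k · z ∷ (k * b) · x ∷ (p * k) · (c · w) ∷ (a + k * b) · x ∷ [])
        (y≡ ∷
         trans (cong (k ·_) (S.solve 3 (λ z bx kw → z ⊖ bx ≜ kw ∷ [] ⊢ z ≜ bx ⊕ kw)
           (z ∷ b · x ∷ k · w ∷ []) (z≡ ∷ [])))
           (trans (×-distrib-+ (b · x) (k · w) k) (cong₂ _∙_ (×-assocˡ x k b)
             (trans (×-assocˡ w k k) (trans (cong (_· w) (kk≡ k≡)) (sym (×-assocˡ w (p * k) c)))))) ∷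
         ×-homo-+ x a (k * b) ∷ []))
      (multiple-∈ (p * k) (c · w))
    where
    kk≡ : k ≡ c * p → k * k ≡ p * k * c
    kk≡ eq = trans (cong (k *_) eq) (trans (cong (k *_) (ℕₚ.*-comm c p))
      (trans (sym (ℕₚ.*-assoc k p c)) (cong (_* c) (ℕₚ.*-comm k p))))
  ... | no p∤k = A ∙ B , λ y → coefficient y , spans y
    where
    open Subgroup (multiples (p * k)) hiding (quotient)
    module Q = LinearSolver (Subgroup.quotient (multiples (p * k)))
    -- Here up + vk = 1. As kA and pB lie in pkG, multiplication by up fixes `A` and kills `B`
    -- modulo pkG, and multiplication by vk does the converse.
    uv = bézout-· (prime-coprime p-prime p∤k)
    u = proj₁ uv
    v = proj₁ (proj₂ uv)
    bez = proj₂ (proj₂ uv)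
    A = p · x
    B = k · e
    vanish : ∀ w z → w · ((p * k) · z) ≈ ε
    vanish w z = member⇒≈ε (·-∈ (multiples (p * k)) w (multiple-∈ (p * k) z))
    vA : (v * k) · A ≈ ε
    vA = subst (_≈ ε) (trans (cong (v ·_) (trans (cong (_· x) (ℕₚ.*-comm p k)) (sym (×-assocˡ x k p))))
      (×-assocˡ A v k)) (vanish v x)
    uB : (u * p) · B ≈ ε
    uB = subst (_≈ ε) (trans (cong (u ·_) (sym (×-assocˡ e p k))) (×-assocˡ B u p)) (vanish u e)
    uA : (u * p) · A ≈ A
    uA = Q.solve 3 (λ a b c → a ⊕ b ≜ c ∷ b ≜ 𝟘 ∷ [] ⊢ a ≜ c) ((u * p) · A ∷ (v * k) · A ∷ A ∷ [])
      (≈-reflexive (bez A) ∷ vA ∷ [])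
    vB : (v * k) · B ≈ B
    vB = Q.solve 3 (λ a b c → b ⊕ a ≜ c ∷ b ≜ 𝟘 ∷ [] ⊢ a ≜ c) ((v * k) · B ∷ (u * p) · B ∷ B ∷ [])
      (≈-reflexive (bez B) ∷ uB ∷ [])
    a b : Carrier → ℕ
    a y = proj₁ (x-spans y)
    b y = proj₁ (e-spans y)
    -- Chosen to act as `u * a y` on `A` and as `v * b y` on `B`, modulo pkG.
    coefficient : Carrier → ℕ
    coefficient y = u * a y * (u * p) + v * b y * (v * k)
    p·y : ∀ y → p · y ≈ a y · A
    p·y y = let z , y≡ = multiple-view k (proj₂ (x-spans y)) in
      Q.solve 4 (λ y' ax kz r → y' ≜ ax ⊕ kz ∷ kz ≜ 𝟘 ∷ ax ≜ r ∷ [] ⊢ y' ≜ r)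
        (p · y ∷ p · (a y · x) ∷ (p * k) · z ∷ a y · A ∷ [])
        (≈-reflexive (trans (cong (p ·_) (S.solve 3 (λ y ax kz → y ⊖ ax ≜ kz ∷ [] ⊢ y ≜ ax ⊕ kz)
          (y ∷ a y · x ∷ k · z ∷ []) (y≡ ∷ [])))
          (trans (×-distrib-+ (a y · x) (k · z) p) (cong (p · (a y · x) ∙_) (×-assocˡ z p k)))) ∷
         member⇒≈ε (multiple-∈ (p * k) z) ∷
         ≈-reflexive (·-swap p (a y) x) ∷ [])
    k·y : ∀ y → k · y ≈ b y · B
    k·y y = let z , y≡ = multiple-view p (proj₂ (e-spans y)) in
      Q.solve 4 (λ y' ax kz r → y' ≜ ax ⊕ kz ∷ kz ≜ 𝟘 ∷ ax ≜ r ∷ [] ⊢ y' ≜ r)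
        (k · y ∷ k · (b y · e) ∷ (p * k) · z ∷ b y · B ∷ [])
        (≈-reflexive (trans (cong (k ·_) (S.solve 3 (λ y ax kz → y ⊖ ax ≜ kz ∷ [] ⊢ y ≜ ax ⊕ kz)
          (y ∷ b y · e ∷ p · z ∷ []) (y≡ ∷ [])))
          (trans (×-distrib-+ (b y · e) (p · z) k) (cong (k · (b y · e) ∙_)
            (trans (×-assocˡ z k p) (cong (_· z) (ℕₚ.*-comm k p)))))) ∷
         member⇒≈ε (multiple-∈ (p * k) z) ∷
         ≈-reflexive (·-swap k (b y) e) ∷ [])
    c·A : ∀ y → coefficient y · A ≈ u · (a y · A)
    c·A y = Q.solve 4 (λ c l r s → c ≜ l ⊕ r ∷ r ≜ 𝟘 ∷ l ≜ s ∷ [] ⊢ c ≜ s)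
      (coefficient y · A ∷ (u * a y * (u * p)) · A ∷ (v * b y * (v * k)) · A ∷ u · (a y · A) ∷ [])
      (≈-reflexive (×-homo-+ A (u * a y * (u * p)) (v * b y * (v * k))) ∷
       ≡.subst₂ _≈_ (×-assocˡ A (v * b y) (v * k)) (·-ε G (v * b y))
         (·-cong (multiples (p * k)) (v * b y) vA) ∷
       ≡.subst₂ _≈_ (×-assocˡ A (u * a y) (u * p)) (sym (×-assocˡ A u (a y)))
         (·-cong (multiples (p * k)) (u * a y) uA) ∷ [])
    c·B : ∀ y → coefficient y · B ≈ v · (b y · B)
    c·B y = Q.solve 4 (λ c l r s → c ≜ l ⊕ r ∷ l ≜ 𝟘 ∷ r ≜ s ∷ [] ⊢ c ≜ s)
      (coefficient y · B ∷ (u * a y * (u * p)) · B ∷ (v * b y * (v * k)) · B ∷ v · (b y · B) ∷ [])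
      (≈-reflexive (×-homo-+ B (u * a y * (u * p)) (v * b y * (v * k))) ∷
       ≡.subst₂ _≈_ (×-assocˡ B (u * a y) (u * p)) (·-ε G (u * a y))
         (·-cong (multiples (p * k)) (u * a y) uB) ∷
       ≡.subst₂ _≈_ (×-assocˡ B (v * b y) (v * k)) (sym (×-assocˡ B v (b y)))
         (·-cong (multiples (p * k)) (v * b y) vB) ∷ [])
    spans : ∀ y → y ≈ coefficient y · (A ∙ B)
    spans y = Q.solve 8 (λ y l r cA cB c uA vB → l ⊕ r ≜ y ∷ l ≜ uA ∷ r ≜ vB ∷ cA ≜ uA ∷ cB ≜ vB ∷
      c ≜ cA ⊕ cB ∷ [] ⊢ y ≜ c)
      (y ∷ (u * p) · y ∷ (v * k) · y ∷ coefficient y · A ∷ coefficient y · B ∷ coefficient y · (A ∙ B) ∷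
        u · (a y · A) ∷ v · (b y · B) ∷ [])
      (≈-reflexive (bez y) ∷
       subst (_≈ u · (a y · A)) (×-assocˡ y u p) (·-cong (multiples (p * k)) u (p·y y)) ∷
       subst (_≈ v · (b y · B)) (×-assocˡ y v k) (·-cong (multiples (p * k)) v (k·y y)) ∷
       c·A y ∷ c·B y ∷ ≈-reflexive (×-distrib-+ A B (coefficient y)) ∷ [])

-- Quotients of odd exponent and of rank two

module OddQuotient (G : FiniteAbelianGroup) (M : Subgroup G) {p h : ℕ} (p-odd : p ≡ suc (h + h))
                   (p·∈ : ∀ x → T (Subgroup.member M (FiniteAbelianGroup._·_ G p x))) where
  open FiniteAbelianGroup G
  open Subgroup M
  private
    module Q = LinearSolver quotient

  p·x≡ : ∀ x → p · x ≡ x ∙ (h · (x ∙ x))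
  p·x≡ x = trans (cong (_· x) p-odd) (cong (x ∙_) (trans (×-homo-+ x h h) (sym (×-distrib-+ x x h))))

  -- Twice h + 1 is p + 1, and p kills the quotient.
  half : Carrier → Carrier
  half x = suc h · x

  half∙half : ∀ x → half x ∙ half x ≈ x
  half∙half x = Q.solve 4 (λ x px hx hxx → px ≜ 𝟘 ∷ px ≜ x ⊕ hxx ∷ hxx ≜ hx ⊕ hx ∷ [] ⊢ x ⊕ hx ⊕
    (x ⊕ hx) ≜ x)
    (x ∷ p · x ∷ h · x ∷ h · (x ∙ x) ∷ [])
    (member⇒≈ε (p·∈ x) ∷ ≈-reflexive (p·x≡ x) ∷ ≈-reflexive (×-distrib-+ x x h) ∷ [])

  no-2-torsion : ∀ {x} → x ∙ x ≈ ε → x ≈ ε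
  no-2-torsion {x} xx≈ε = Q.solve 3 (λ x px hxx → px ≜ 𝟘 ∷ px ≜ x ⊕ hxx ∷ hxx ≜ 𝟘 ∷ [] ⊢ x ≜ 𝟘)
    (x ∷ p · x ∷ h · (x ∙ x) ∷ [])
    (member⇒≈ε (p·∈ x) ∷ ≈-reflexive (p·x≡ x) ∷
     ≈-trans (·-cong G M h xx≈ε) (≈-reflexive (·-ε G h)) ∷ [])

  module _ (E : EvenStructure G) where
    open EvenStructure E

    t∈ : T (member t)
    t∈ = subst (T ∘ member) (trans (p·x≡ t) (trans (cong (λ z → t ∙ h · z) t∙t≡ε)
      (trans (cong (t ∙_) (·-ε G h)) (identityʳ t)))) (p·∈ t)

    odd-p : odd p ≡ true
    odd-p = trans (cong odd p-odd) (cong not (double-even h))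

    parity-p·g : parity (p · g) ≡ true
    parity-p·g = trans (parity-· p g) (cong₂ _∧_ odd-p parity-g)

    -- `Extension` needs an odd element inside M: the multiple `p · g` lies in M and is odd because
    -- p is.
    withinM : EvenStructure G
    withinM = record
      { t = t ; t≢ε = t≢ε ; t∙t≡ε = t∙t≡ε ; involution-unique = involution-unique
      ; parity = parity ; parity-∙ = parity-∙ ; g = p · g ; parity-g = parity-p·g ; halve = halve }

    restricted : EvenStructure (restrict G M)
    restricted = record
      { t = t , t∈ ; t≢ε = λ eq → t≢ε (cong proj₁ eq) ; t∙t≡ε = Σ-T-≡ t∙t≡ε
      ; involution-unique = λ x eq → [ inj₁ ∘ Σ-T-≡ , inj₂ ∘ Σ-T-≡ ]′
        (involution-unique (proj₁ x) (cong proj₁ eq))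
      ; parity = parity ∘ proj₁ ; parity-∙ = λ x y → parity-∙ (proj₁ x) (proj₁ y)
      ; g = p · g , p·∈ g ; parity-g = parity-p·g
      -- The half found in G already lies in M, because G/M has no 2-torsion.
      ; halve = λ (x , x∈) even → let y , x≡ = halve x even in
          (y , ≈ε⇒member (no-2-torsion (member⇒≈ε (subst (T ∘ member) x≡ x∈)))) , Σ-T-≡ x≡ }

module RankTwoTurn (G : FiniteAbelianGroup) {p h : ℕ} (p-prime : Prime p) (p-odd : p ≡ suc (h + h))
                   (rank : RankTwo G p) where
  open FiniteAbelianGroup G
  open RankTwo rank
  open Subgroup M
  open OddQuotient G M {p} {h} p-odd p·∈
  private
    module S = LinearSolver 𝒢
    module Q = LinearSolver quotient

  p·≈ε : ∀ x → p · x ≈ ε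
  p·≈ε x = member⇒≈ε (p·∈ x)

  -- If p did not divide k, a Bézout combination of p · v and k · v would put `v` into `S`.
  divides-factor : ∀ (S : Subgroup G) {v} → T (Subgroup.member S (p · v)) → ¬ T (Subgroup.member S v) →
                   ∀ {k} → T (Subgroup.member S (k · v)) → p ∣ k
  divides-factor S {v} pv∈ v∉ {k} kv∈ with p ∣? k
  ... | yes p∣k = p∣k
  ... | no p∤k = contradiction (subst (T ∘ Subgroup.member S)
      (trans (cong₂ _∙_ (×-assocˡ v u p) (×-assocˡ v w k)) (bez v))
      (Subgroup.∙∈ S (·-∈ G S u pv∈) (·-∈ G S w kv∈))) v∉
    where
    uw = bézout-· G (prime-coprime p-prime p∤k)
    u = proj₁ uw
    w = proj₁ (proj₂ uw)
    bez = proj₂ (proj₂ uw)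

  divisible⇒≈ε : ∀ {k} → p ∣ k → ∀ v → k · v ≈ ε
  divisible⇒≈ε {k} (divides c k≡) v = ≈-trans (≈-reflexive (trans (cong (_· v) k≡) (sym (×-assocˡ v c p))))
    (≈-trans (·-cong G M c (p·≈ε v)) (≈-reflexive (·-ε G c)))

  private
    ordered : ∀ (S : Subgroup G) {v} → T (Subgroup.member S (p · v)) → ¬ T (Subgroup.member S v) →
              ∀ {a b} → a ≤ b → T (Subgroup.member S (b · v - a · v)) → ∀ u → a · u ≈ b · u
    ordered S {v} pv∈ v∉ {a} {b} a≤b diff∈ u = Q.solve 3 (λ a b d → b ≜ a ⊕ d ∷ d ≜ 𝟘 ∷ [] ⊢ a ≜ b)
      (a · u ∷ b · u ∷ (b ∸ a) · u ∷ [])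
      (≈-reflexive (plus u) ∷ divisible⇒≈ε (divides-factor S pv∈ v∉ {b ∸ a} (subst (T ∘ Subgroup.member S)
        (S.solve 3 (λ a b d → b ≜ a ⊕ d ∷ [] ⊢ b ⊖ a ≜ d) (a · v ∷ b · v ∷ (b ∸ a) · v ∷ [])
          (plus v ∷ [])) diff∈)) u ∷ [])
      where
      plus : ∀ z → b · z ≡ a · z ∙ (b ∸ a) · z
      plus z = trans (cong (_· z) (sym (ℕₚ.m+[n∸m]≡n a≤b))) (×-homo-+ z a (b ∸ a))

  -- Agreement is needed on every `u`, because `K` applies the coefficient of one basis vector to
  -- the other. It holds since the two coefficients are congruent modulo p.
  same-coefficient : ∀ (S : Subgroup G) {v} → T (Subgroup.member S (p · v)) → ¬ T (Subgroup.member S v) →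
                     ∀ {a b} → T (Subgroup.member S (b · v - a · v)) → ∀ u → a · u ≈ b · u
  same-coefficient S {v} pv∈ v∉ {a} {b} diff∈ u with ℕₚ.≤-total a b
  ... | inj₁ a≤b = ordered S pv∈ v∉ {a} {b} a≤b diff∈ u
  ... | inj₂ b≤a = ≈-sym (ordered S pv∈ v∉ {b} {a} b≤a (subst (T ∘ Subgroup.member S)
      (S.solve 2 (λ a b → [] ⊢ ⊝ (b ⊖ a) ≜ a ⊖ b) (a · v ∷ b · v ∷ []) []) (Subgroup.⁻¹∈ S diff∈)) u)

  coordinates-unique : ∀ {a b a′ b′} → a · e₁ ∙ b · e₂ ≈ a′ · e₁ ∙ b′ · e₂ →
                       (∀ u → a · u ≈ a′ · u) × (∀ u → b · u ≈ b′ · u)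
  coordinates-unique {a} {b} {a′} {b′} eq = first , second
    where
    open Adjoin G M e₁
    second : ∀ u → b · u ≈ b′ · u
    -- Modulo M and `e₁` the first terms vanish, which isolates the second coefficient.
    second = same-coefficient adjoin {e₂} (base∈ (p·∈ e₂)) e₂∉ {b} {b′} (subst (T ∘ Subgroup.member adjoin)
      (S.solve 4 (λ ae be ae′ be′ → [] ⊢ ⊝ (ae ⊕ be ⊖ (ae′ ⊕ be′)) ⊕ (ae ⊖ ae′) ≜ be′ ⊖ be)
        (a · e₁ ∷ b · e₂ ∷ a′ · e₁ ∷ b′ · e₂ ∷ []) [])
      (Subgroup.∙∈ adjoin (Subgroup.⁻¹∈ adjoin (base∈ eq))
        (Subgroup.∙∈ adjoin (·-∈ G adjoin a x∈) (Subgroup.⁻¹∈ adjoin (·-∈ G adjoin a′ x∈)))))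
    first : ∀ u → a · u ≈ a′ · u
    first = same-coefficient M {e₁} (p·∈ e₁) e₁∉ {a} {a′} (≈-sym (Q.solve 4
      (λ ae be ae′ be′ → be ≜ be′ ∷ ae ⊕ be ≜ ae′ ⊕ be′ ∷ [] ⊢ ae ≜ ae′)
      (a · e₁ ∷ b · e₂ ∷ a′ · e₁ ∷ b′ · e₂ ∷ []) (second e₂ ∷ eq ∷ [])))

  α β : Carrier → ℕ
  α x = proj₁ (span x)
  β x = proj₁ (proj₂ (span x))

  expand : ∀ x → x ≈ α x · e₁ ∙ β x · e₂
  expand x = proj₂ (proj₂ (span x))

  coordinates : ∀ {x a b} → x ≈ a · e₁ ∙ b · e₂ → (∀ u → α x · u ≈ a · u) × (∀ u → β x · u ≈ b · u)
  coordinates {x} {a} {b} eq = coordinates-unique {α x} {β x} {a} {b} (≈-trans (≈-sym (expand x)) eq)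

  K : Carrier → Carrier
  K x = α x · e₂ - β x · e₁

  quarterTurn : QuarterTurn G M
  quarterTurn = record
    { K = K ; K-cong = K-cong ; K-∙ = K-∙ ; K∘K = K∘K
    ; half = half ; half∙half = half∙half ; no-2-torsion = no-2-torsion }
    where
    K-cong : ∀ {x y} → x ≈ y → K x ≈ K y
    K-cong {x} {y} x≈y = ∙-cong (proj₁ c e₂) (⁻¹-cong (proj₂ c e₁))
      where c = coordinates {x} {α y} {β y} (≈-trans x≈y (expand y))
    K-∙ : ∀ x y → K (x ∙ y) ≈ K x ∙ K y
    K-∙ x y = Q.solve 6
      (λ a b ax ay bx by → a ≜ ax ⊕ ay ∷ b ≜ bx ⊕ by ∷ [] ⊢ a ⊖ b ≜ ax ⊖ bx ⊕ (ay ⊖ by))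
      (α (x ∙ y) · e₂ ∷ β (x ∙ y) · e₁ ∷ α x · e₂ ∷ α y · e₂ ∷ β x · e₁ ∷ β y · e₁ ∷ [])
      (≈-trans (proj₁ c e₂) (≈-reflexive (×-homo-+ e₂ (α x) (α y))) ∷
       ≈-trans (proj₂ c e₁) (≈-reflexive (×-homo-+ e₁ (β x) (β y))) ∷ [])
      where
      c = coordinates {x ∙ y} {α x + α y} {β x + β y} (Q.solve 8
        (λ x y ax ay bx by a b → x ≜ ax ⊕ bx ∷ y ≜ ay ⊕ by ∷ a ≜ ax ⊕ ay ∷ b ≜ bx ⊕ by ∷ [] ⊢ x ⊕ y ≜ a ⊕ b)
        (x ∷ y ∷ α x · e₁ ∷ α y · e₁ ∷ β x · e₂ ∷ β y · e₂ ∷ (α x + α y) · e₁ ∷ (β x + β y) · e₂ ∷ [])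
        (expand x ∷ expand y ∷ ≈-reflexive (×-homo-+ e₁ (α x) (α y)) ∷ ≈-reflexive
          (×-homo-+ e₂ (β x) (β y)) ∷ []))
    K∘K : ∀ x → K (K x) ≈ x ⁻¹
    K∘K x = Q.solve 6
      (λ x a b n ae be → a ≜ n ∷ n ≜ ⊝ be ∷ b ≜ ae ∷ x ≜ ae ⊕ be ∷ [] ⊢ a ⊖ b ≜ ⊝ x)
      (x ∷ α (K x) · e₂ ∷ β (K x) · e₁ ∷ neg G (β x) · e₂ ∷ α x · e₁ ∷ β x · e₂ ∷ [])
      (proj₁ c e₂ ∷ ≈-reflexive (neg-· G (β x) e₂) ∷ proj₂ c e₁ ∷ expand x ∷ [])
      where
      c = coordinates {K x} {neg G (β x)} {α x} (≈-reflexive (S.solve 3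
        (λ a b n → n ≜ ⊝ b ∷ [] ⊢ a ⊖ b ≜ n ⊕ a) (α x · e₂ ∷ β x · e₁ ∷ neg G (β x) · e₁ ∷ [])
          (neg-· G (β x) e₁ ∷ [])))

cyclic-mod-2 : ∀ (G : FiniteAbelianGroup) → EvenStructure G → Cyclic-mod G (multiples G 2)
cyclic-mod-2 G E = g , reduce
  where
  open FiniteAbelianGroup G
  open EvenStructure E
  module S = LinearSolver 𝒢
  even∈ : ∀ y → parity y ≡ false → T (Subgroup.member (multiples G 2) y)
  even∈ y even = let z , y≡ = halve y even in subst (T ∘ Subgroup.member (multiples G 2))
    (trans (cong (z ∙_) (identityʳ z)) (sym y≡)) (multiple-∈ G 2 z)
  reduce : ∀ y → ∃[ k ] T (Subgroup.member (multiples G 2) (y - k · g))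
  reduce y with parity y in eq
  ... | false = 0 , even∈ (y - ε) (trans (cong parity (S.solve 1 (λ y → [] ⊢ y ⊖ 𝟘 ≜ y) (y ∷ []) [])) eq)
  ... | true = 1 , even∈ (y - 1 · g) (trans (parity-∙ y _)
          (cong₂ _xor_ eq (trans (parity-⁻¹ (1 · g)) (trans (cong parity (identityʳ g)) parity-g))))

prime-2-or-odd : ∀ {p} → Prime p → p ≡ 2 ⊎ ∃[ h ] p ≡ suc (h + h)
prime-2-or-odd {p} p-prime with odd p in eq
... | true = inj₂ (odd⇒suc-double p eq)
... | false with even⇒double p eq
...   | j , p≡ with prime⇒irreducible p-prime (divides j
  (trans p≡ (trans (cong (j +_) (sym (ℕₚ.+-identityʳ j))) (ℕₚ.*-comm 2 j))))
...     | inj₂ 2≡p = inj₁ (sym 2≡p)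

-- The recursion along quotients of rank two

module Recursion where

  OddRankTwo : FiniteAbelianGroup → Set
  OddRankTwo G = ∃[ p ] (Prime p × (∃[ h ] p ≡ suc (h + h)) × RankTwo G p)

  -- For the prime factors of the exponent with multiplicity, the product kills G, so the first
  -- alternative says that G itself is cyclic.
  over-primes : ∀ G → EvenStructure G → ∀ ps → All Prime ps → Cyclic-mod G
    (multiples G (product ps)) ⊎ OddRankTwo G
  over-primes G E [] [] = inj₁ (ε , λ y → 0 , subst (T ∘ Subgroup.member (multiples G 1))
      (S.solve 1 (λ y → [] ⊢ y ⊕ 𝟘 ≜ y ⊖ 𝟘) (y ∷ []) []) (multiple-∈ G 1 y))
    where
    open FiniteAbelianGroup G
    module S = LinearSolver 𝒢
  over-primes G E (p ∷ ps) (p-prime ∷ ps-prime) with over-primes G E ps ps-prime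
  ... | inj₂ found = inj₂ found
  ... | inj₁ cyc with prime-2-or-odd p-prime
  ...   | inj₁ refl = inj₁ (cyclic-mod-product G {2} {product ps} p-prime (cyclic-mod-2 G E) cyc)
  ...   | inj₂ odd-p with cyclic-or-rank-two G p
  ...     | inj₁ cyc-p = inj₁ (cyclic-mod-product G {p} {product ps} p-prime cyc-p cyc)
  ...     | inj₂ rank = inj₂ (p , p-prime , odd-p , rank)

  cyclic⇒colouring : ∀ G → EvenStructure G → Cyclic-mod G
    (multiples G (FiniteAbelianGroup.exponent G)) → Colouring G
  cyclic⇒colouring G E (x , spans) = Cyclic.colouring G E x (λ y →
    let k , y∈ = spans y ; z , y≡ = multiple-view G exponent y∈ in
    k , S.solve 3 (λ y kx ez → y ⊖ kx ≜ ez ∷ ez ≜ 𝟘 ∷ [] ⊢ y ≜ kx) (y ∷ k · x ∷ exponent · z ∷ [])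
      (y≡ ∷ exponent·x≡ε z ∷ []))
    where
    open FiniteAbelianGroup G
    module S = LinearSolver 𝒢

  -- The bound `n` on the element list drops on passing to M, because `e₁` lies outside M.
  colour : ∀ n G → List.length (FiniteAbelianGroup.elements G) ≤ n → EvenStructure G → Colouring G
  colour n G bound E with over-primes G E (PrimeFactorisation.factors f) (PrimeFactorisation.factorsPrime f)
    where
    instance _ = FiniteAbelianGroup.exponent≢0 G
    f = factorise (FiniteAbelianGroup.exponent G)
  ... | inj₁ cyc = cyclic⇒colouring G E (subst (Cyclic-mod G ∘ multiples G)
    (sym (PrimeFactorisation.isFactorisation f)) cyc)
    where
    instance _ = FiniteAbelianGroup.exponent≢0 G
    f = factorise (FiniteAbelianGroup.exponent G)
  colour zero G bound E | inj₂ _ = contradiction (FiniteAbelianGroup.complete G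
    (FiniteAbelianGroup.ε G)) (none bound)
    where
    none : ∀ {A : Set} {x : A} {xs : List A} → List.length xs ≤ 0 → ¬ x ∈ˡ xs
    none {xs = []} _ ()
  colour (suc n) G bound E | inj₂ (p , p-prime , (h , p-odd) , rank) =
    Extension.colouring G M (RankTwoTurn.quarterTurn G {p} {h} p-prime p-odd rank) (withinM E) (p·∈ _)
      (t∈ E)
      (colour n (restrict G M) (ℕₚ.≤-pred (ℕₚ.<-≤-trans (restrict-shrinks G M e₁∉) bound)) (restricted E))
    where
    open RankTwo rank
    open OddQuotient G M {p} {h} p-odd p·∈

opaque
  colouring : ∀ G → EvenStructure G → Colouring G
  colouring G = Recursion.colour _ G ℕₚ.≤-refl

-- The sum of all elements

-- Stated for commutative monoids, because it is applied both to the group, for the value of σ, and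
-- to the natural numbers, for counting the pairs.
module Pairing (𝓜 : CommutativeMonoid 0ℓ 0ℓ) {n : ℕ} (π : Fin n → Fin n) (π-involutive : ∀ x → π (π x) ≡ x) where
  open CommutativeMonoid 𝓜 renaming (refl to ≈-refl; sym to ≈-sym; trans to ≈-trans)
  open import Algebra.Properties.CommutativeMonoid.Sum 𝓜
  open import Relation.Binary.Reasoning.Setoid setoid

  private
    when : Bool → Carrier → Carrier
    when c x = if c then x else ε

    involution : Permutation n n
    involution = permutation π π π-involutive π-involutive

  fixed paired : (Fin n → Carrier) → Fin n → Carrier
  fixed f x = when (does (π x ≟ᶠ x)) (f x)
  paired f x = when (does (x Finₚ.<? π x)) (f x ∙ f (π x))

  -- A moved point is either the smaller or the larger member of its pair; reindexing by `π` brings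
  -- the term of the larger member to the smaller one.
  pairing : ∀ f → sum f ≈ sum (fixed f) ∙ sum (paired f)
  pairing f = begin
    sum f                                      ≈⟨ sum-cong-≋ split ⟩
    sum (λ x → fixed f x ∙ (lo x ∙ hi x))      ≈⟨ ∑-distrib-+ (fixed f) _ ⟩
    sum (fixed f) ∙ sum (λ x → lo x ∙ hi x)    ≈⟨ ∙-congˡ (∑-distrib-+ lo hi) ⟩
    sum (fixed f) ∙ (sum lo ∙ sum hi)          ≈⟨ ∙-congˡ (∙-congˡ (sum-permute hi involution)) ⟩
    sum (fixed f) ∙ (sum lo ∙ sum (hi ∘ π))    ≈⟨ ∙-congˡ (∑-distrib-+ lo (hi ∘ π)) ⟨
    sum (fixed f) ∙ sum (λ x → lo x ∙ hi (π x)) ≈⟨ ∙-congˡ (sum-cong-≋ merge) ⟩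
    sum (fixed f) ∙ sum (paired f)             ∎
    where
    lo hi : Fin n → Carrier
    lo x = when (does (x Finₚ.<? π x)) (f x)
    hi x = when (does (π x Finₚ.<? x)) (f x)
    split : ∀ x → f x ≈ fixed f x ∙ (lo x ∙ hi x)
    split x with Finₚ.<-cmp x (π x)
    ... | tri< l ne ¬g rewrite dec-false (π x ≟ᶠ x) (ne ∘ sym) | dec-true (x Finₚ.<? π x) l | dec-false
      (π x Finₚ.<? x) ¬g =
      ≈-sym (≈-trans (identityˡ _) (identityʳ _))
    ... | tri≈ ¬l e ¬g rewrite dec-true (π x ≟ᶠ x) (sym e) | dec-false (x Finₚ.<? π x) ¬l | dec-false
      (π x Finₚ.<? x) ¬g =
      ≈-sym (≈-trans (∙-congˡ (identityˡ _)) (identityʳ _))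
    ... | tri> ¬l ne g rewrite dec-false (π x ≟ᶠ x) (ne ∘ sym) | dec-false (x Finₚ.<? π x) ¬l | dec-true
      (π x Finₚ.<? x) g =
      ≈-sym (≈-trans (identityˡ _) (identityˡ _))
    merge : ∀ x → lo x ∙ hi (π x) ≈ paired f x
    merge x rewrite π-involutive x with does (x Finₚ.<? π x)
    ... | true = ≈-refl
    ... | false = identityˡ ε

  sum-ε : ∀ {f : Fin n → Carrier} → (∀ x → f x ≈ ε) → sum f ≈ ε
  sum-ε f≈ε = ≈-trans (sum-cong-≋ f≈ε) (sum-replicate-zero n)

  pairing-free : (∀ x → π x ≢ x) → ∀ f → sum f ≈ sum (paired f)
  pairing-free free f = ≈-trans (pairing f) (≈-trans (∙-congʳ (sum-ε none)) (identityˡ _))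
    where
    none : ∀ x → fixed f x ≈ ε
    none x rewrite dec-false (π x ≟ᶠ x) (free x) = ≈-refl

module ℕSum where
  open import Algebra.Properties.CommutativeMonoid.Sum ℕₚ.+-0-commutativeMonoid public

  sum-const-1 : ∀ n → sum {n} (const 1) ≡ n
  sum-const-1 zero = refl
  sum-const-1 (suc n) = cong suc (sum-const-1 n)

indicator : Bool → ℕ
indicator true = 1
indicator false = 0

sum-indicator-≡ : ∀ {n} (c : Fin n) → ℕSum.sum (λ x → indicator (does (c ≟ᶠ x))) ≡ 1
sum-indicator-≡ {suc n} zero = cong suc (ℕSum.sum-replicate-zero n)
sum-indicator-≡ {suc n} (suc c) = sum-indicator-≡ c

module FinGroup {n : ℕ} {_∙_ : Fin n → Fin n → Fin n} {ε : Fin n} {_⁻¹ : Fin n → Fin n}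
                (isAb : IsAbelianGroup _≡_ _∙_ ε _⁻¹) where

  private
    𝒢₀ : AbelianGroup 0ℓ 0ℓ
    𝒢₀ = record { isAbelianGroup = isAb }
  open import Algebra.Properties.CommutativeMonoid.Sum (AbelianGroup.commutativeMonoid 𝒢₀)
  private
    module S = LinearSolver 𝒢₀
    open import Algebra.Properties.CommutativeMonoid.Mult (AbelianGroup.commutativeMonoid 𝒢₀)
      using () renaming (_×_ to _·₀_)

    translation : ∀ x → Permutation n n
    translation x = permutation (x ∙_) ((x ⁻¹) ∙_)
      (λ y → S.solve 2 (λ x y → [] ⊢ x ⊕ (⊝ x ⊕ y) ≜ y) (x ∷ y ∷ []) [])
      (λ y → S.solve 2 (λ x y → [] ⊢ ⊝ x ⊕ (x ⊕ y) ≜ y) (x ∷ y ∷ []) [])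

    -- Translation by `x` permutes the group, so σ = n · x + σ.
    n·x≡ε : ∀ x → n ·₀ x ≡ ε
    n·x≡ε x = S.solve 2 (λ a s → s ≜ a ⊕ s ∷ [] ⊢ a ≜ 𝟘) (n ·₀ x ∷ sum id ∷ [])
      (trans (sum-permute id (translation x)) (trans (∑-distrib-+ (const x) id)
        (cong (_∙ sum id) (sum-replicate n))) ∷ [])

    n≢0 : Fin n → NonZero n
    n≢0 zero = _
    n≢0 (suc _) = _

  G : FiniteAbelianGroup
  G = record
    { isAbelianGroup = isAb ; _≟_ = _≟ᶠ_ ; elements = List.allFin n ; complete = ∈-allFin
    ; exponent = n ; exponent≢0 = n≢0 ε ; exponent·x≡ε = n·x≡ε }

  open FiniteAbelianGroup G using (_·_; ×-homo-+; ×-distrib-+; identityˡ; identityʳ; exponent·x≡ε)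

  σ : Fin n
  σ = sum id

  ·-when : ∀ {m} (c : Fin m → Bool) x → sum (λ i → if c i then x else ε) ≡ ℕSum.sum (indicator ∘ c) · x
  ·-when {zero} c x = refl
  ·-when {suc m} c x with c zero
  ... | true = cong (x ∙_) (·-when (c ∘ suc) x)
  ... | false = trans (identityˡ _) (·-when (c ∘ suc) x)

  -- The Euler criterion: pairing x with g - x when g is not a double.
  euler : ∀ {g} → (∀ y → g ≢ y ∙ y) → ∃[ N ] (n ≡ N ℕ.+ N × σ ≡ N · g)
  euler {g} nonsquare = N , n≡ , σ≡
    where
    π : Fin n → Fin n
    π x = g ∙ (x ⁻¹)
    π-involutive : ∀ x → π (π x) ≡ x
    π-involutive x = S.solve 2 (λ g x → [] ⊢ g ⊖ (g ⊖ x) ≜ x) (g ∷ x ∷ []) []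
    free : ∀ x → π x ≢ x
    free x eq = nonsquare x (S.solve 2 (λ g x → g ⊖ x ≜ x ∷ [] ⊢ g ≜ x ⊕ x) (g ∷ x ∷ []) (eq ∷ []))
    low : Fin n → Bool
    low x = does (x Finₚ.<? π x)
    N = ℕSum.sum (indicator ∘ low)
    n≡ : n ≡ N ℕ.+ N
    n≡ = trans (sym (ℕSum.sum-const-1 n)) (trans (Pairing.pairing-free ℕₚ.+-0-commutativeMonoid π π-involutive free (const 1))
      (trans (ℕSum.sum-cong-≗ two) (ℕSum.∑-distrib-+ (indicator ∘ low) (indicator ∘ low))))
      where
      two : ∀ x → (if low x then 2 else 0) ≡ indicator (low x) ℕ.+ indicator (low x)
      two x with low x
      ... | true = refl
      ... | false = refl
    σ≡ : σ ≡ N · g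
    σ≡ = trans (Pairing.pairing-free (AbelianGroup.commutativeMonoid 𝒢₀) π π-involutive free id)
      (trans (sum-cong-≗ pair) (·-when low g))
      where
      pair : ∀ x → (if low x then x ∙ π x else ε) ≡ (if low x then g else ε)
      pair x = cong (λ z → if low x then z else ε) (S.solve 2 (λ g x → [] ⊢ x ⊕ (g ⊖ x) ≜ g)
        (g ∷ x ∷ []) [])

  private
    selfInverse : Fin n → Bool
    selfInverse x = does ((x ⁻¹) ≟ᶠ x)

    σ≡Σ-selfInverse : σ ≡ sum (λ x → if selfInverse x then x else ε)
    σ≡Σ-selfInverse = trans (Pairing.pairing 𝓜 _⁻¹ inv id)
      (trans (cong (sum (λ x → if selfInverse x then x else ε) ∙_) (Pairing.sum-ε 𝓜 _⁻¹ inv cancel))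
        (identityʳ _))
      where
      𝓜 = AbelianGroup.commutativeMonoid 𝒢₀
      inv : ∀ x → (x ⁻¹) ⁻¹ ≡ x
      inv x = S.solve 1 (λ x → [] ⊢ ⊝ ⊝ x ≜ x) (x ∷ []) []
      cancel : ∀ x → Pairing.paired 𝓜 _⁻¹ inv id x ≡ ε
      cancel x with does (x Finₚ.<? (x ⁻¹))
      ... | true = S.solve 1 (λ x → [] ⊢ x ⊖ x ≜ 𝟘) (x ∷ []) []
      ... | false = refl

  -- Pairing x with x + s; the number N of pairs does not depend on the involution s.
  involution-sum : ∀ {s} → s ≢ ε → s ∙ s ≡ ε → ∃[ N ] (ℕSum.sum
    (indicator ∘ selfInverse) ≡ N ℕ.+ N × σ ≡ N · s)
  involution-sum {s} s≢ε s∙s≡ε = N , count≡ , σ≡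
    where
    π : Fin n → Fin n
    π x = x ∙ s
    π-involutive : ∀ x → π (π x) ≡ x
    π-involutive x = S.solve 2 (λ x s → s ⊕ s ≜ 𝟘 ∷ [] ⊢ x ⊕ s ⊕ s ≜ x) (x ∷ s ∷ []) (s∙s≡ε ∷ [])
    free : ∀ x → π x ≢ x
    free x eq = s≢ε (S.solve 2 (λ x s → x ⊕ s ≜ x ∷ [] ⊢ s ≜ 𝟘) (x ∷ s ∷ []) (eq ∷ []))
    selfInverse-π : ∀ x → selfInverse (π x) ≡ selfInverse x
    selfInverse-π x with (x ⁻¹) ≟ᶠ x
    ... | yes e = dec-true (((x ∙ s) ⁻¹) ≟ᶠ (x ∙ s)) (S.solve 2
      (λ x s → ⊝ x ≜ x ∷ s ⊕ s ≜ 𝟘 ∷ [] ⊢ ⊝ (x ⊕ s) ≜ x ⊕ s) (x ∷ s ∷ []) (e ∷ s∙s≡ε ∷ []))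
    ... | no ne = dec-false (((x ∙ s) ⁻¹) ≟ᶠ (x ∙ s)) (λ e → ne (S.solve 2
      (λ x s → ⊝ (x ⊕ s) ≜ x ⊕ s ∷ s ⊕ s ≜ 𝟘 ∷ [] ⊢ ⊝ x ≜ x) (x ∷ s ∷ []) (e ∷ s∙s≡ε ∷ [])))
    low : Fin n → Bool
    low x = does (x Finₚ.<? π x) ∧ selfInverse x
    N = ℕSum.sum (indicator ∘ low)
    count≡ : ℕSum.sum (indicator ∘ selfInverse) ≡ N ℕ.+ N
    count≡ = trans (Pairing.pairing-free ℕₚ.+-0-commutativeMonoid π π-involutive free
      (indicator ∘ selfInverse))
      (trans (ℕSum.sum-cong-≗ two) (ℕSum.∑-distrib-+ (indicator ∘ low) (indicator ∘ low)))
      where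
      two : ∀ x → (if does (x Finₚ.<? π x) then indicator (selfInverse x) ℕ.+ indicator
        (selfInverse (π x)) else 0)
                ≡ indicator (low x) ℕ.+ indicator (low x)
      two x rewrite selfInverse-π x with does (x Finₚ.<? π x)
      ... | true = refl
      ... | false = refl
    σ≡ : σ ≡ N · s
    σ≡ = trans σ≡Σ-selfInverse (trans (Pairing.pairing-free
      (AbelianGroup.commutativeMonoid 𝒢₀) π π-involutive free _)
      (trans (sum-cong-≗ pair) (·-when low s)))
      where
      pair : ∀ x → (if does (x Finₚ.<? π x) then (if selfInverse x then x else ε) ∙
        (if selfInverse (π x) then π x else ε) else ε)
                 ≡ (if low x then s else ε)
      pair x rewrite selfInverse-π x with does (x Finₚ.<? π x)
      ... | false = refl
      ... | true with (x ⁻¹) ≟ᶠ x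
      ...   | yes e = S.solve 2 (λ x s → ⊝ x ≜ x ∷ [] ⊢ x ⊕ (x ⊕ s) ≜ s) (x ∷ s ∷ []) (e ∷ [])
      ...   | no _ = identityˡ ε

  double-· : ∀ k {x} → x ∙ x ≡ ε → (k ℕ.+ k) · x ≡ ε
  double-· k {x} xx≡ε = trans (×-homo-+ x k k) (trans (sym (×-distrib-+ x x k))
    (trans (cong (k ·_) xx≡ε) (·-ε G k)))

  odd-· : ∀ k {x} → x ∙ x ≡ ε → odd k ≡ true → k · x ≡ x
  odd-· k {x} xx≡ε k-odd with odd⇒suc-double k k-odd
  ... | j , refl = trans (cong (x ∙_) (double-· j xx≡ε)) (identityʳ x)

  even-· : ∀ k {x} → x ∙ x ≡ ε → odd k ≡ false → k · x ≡ ε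
  even-· k xx≡ε k-even with even⇒double k k-even
  ... | j , refl = double-· j xx≡ε

  record UniqueInvolution : Set where
    field
      t : Fin n
      t≢ε : t ≢ ε
      t∙t≡ε : t ∙ t ≡ ε
      unique : ∀ x → x ∙ x ≡ ε → x ≡ ε ⊎ x ≡ t
      σ≡t : σ ≡ t

  -- Without involutions only `ε` is its own inverse, and σ = 0. Otherwise σ = N · s for every
  -- involution s, with the same N throughout; as σ ≠ 0, this N is odd, so each involution equals σ.
  sum≢ε⇒uniqueInvolution : σ ≢ ε → UniqueInvolution
  sum≢ε⇒uniqueInvolution σ≢ε with any? (λ x → ¬? (x ≟ᶠ ε) ×-dec ((x ∙ x) ≟ᶠ ε))
  ... | no none = contradiction (trans σ≡Σ-selfInverse (trans (sum-cong-≗ only-ε)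
    (sum-replicate-zero n))) σ≢ε
    where
    only-ε : ∀ x → (if selfInverse x then x else ε) ≡ ε
    only-ε x with (x ⁻¹) ≟ᶠ x | x ≟ᶠ ε
    ... | no _ | _ = refl
    ... | yes _ | yes x≡ε = x≡ε
    ... | yes e | no x≢ε = contradiction (x , x≢ε , S.solve 1 (λ x → ⊝ x ≜ x ∷ [] ⊢ x ⊕ x ≜ 𝟘) (x ∷ [])
      (e ∷ [])) none
  ... | yes (t , t≢ε , t∙t≡ε) with involution-sum t≢ε t∙t≡ε
  ...   | N , count≡ , σ≡ with odd N in N-odd
  ...     | false = contradiction (trans σ≡ (even-· N t∙t≡ε N-odd)) σ≢ε
  ...     | true = record { t = t ; t≢ε = t≢ε ; t∙t≡ε = t∙t≡ε ; σ≡t = σ≡t ; unique = unique }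
    where
    σ≡t : σ ≡ t
    σ≡t = trans σ≡ (odd-· N t∙t≡ε N-odd)
    unique : ∀ x → x ∙ x ≡ ε → x ≡ ε ⊎ x ≡ t
    unique x xx≡ε with x ≟ᶠ ε
    ... | yes x≡ε = inj₁ x≡ε
    ... | no x≢ε with involution-sum x≢ε xx≡ε
    ...   | N′ , count′≡ , σ≡′ with double-injective {N} {N′} (trans (sym count≡) count′≡)
    ...     | refl = inj₂ (trans (sym (odd-· N xx≡ε N-odd)) (trans (sym σ≡′) σ≡t))

  -- Otherwise doubling has a section, which is injective and so, by finiteness, surjective. It
  -- would then take the values `ε` and `t`, which have the same double, at one point.
  nonsquare-exists : UniqueInvolution → ∃[ g ] (∀ y → g ≢ y ∙ y)
  nonsquare-exists U with any? (λ g → ¬? (any? (λ y → g ≟ᶠ (y ∙ y))))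
  ... | yes (g , nonsquare) = g , λ y eq → nonsquare (y , eq)
  ... | no all-squares = contradiction (section-surjective (UniqueInvolution.t U)) absurd
    where
    open UniqueInvolution U
    root : ∀ g → ∃[ y ] g ≡ y ∙ y
    root g with any? (λ y → g ≟ᶠ (y ∙ y))
    ... | yes r = r
    ... | no ¬r = contradiction (g , ¬r) all-squares
    section : Fin n → Fin n
    section g = proj₁ (root g)
    section-inj : Injective _≡_ _≡_ section
    section-inj {g} {h} eq = trans (proj₂ (root g)) (trans (cong (λ y → y ∙ y) eq) (sym (proj₂ (root h))))
    section-surjective : ∀ y → ∃[ g ] section g ≡ y
    section-surjective = injective⇒surjective section-inj
    recover : ∀ {g y} → section g ≡ y → g ≡ y ∙ y
    recover {g} refl = proj₂ (root g)
    absurd : ¬ (∃[ g ] section g ≡ t)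
    absurd (g , eq) with section-surjective ε
    ... | h , eq′ = t≢ε (trans (sym eq) (trans (cong section (trans (recover eq) (trans t∙t≡ε
      (sym (trans (recover eq′) (identityˡ ε)))))) eq′))

  module _ (U : UniqueInvolution) where
    open UniqueInvolution U

    private
      g₀ = proj₁ (nonsquare-exists U)
      euler₀ = euler (proj₂ (nonsquare-exists U))

    N : ℕ
    N = proj₁ euler₀

    n≡N+N : n ≡ N ℕ.+ N
    n≡N+N = proj₁ (proj₂ euler₀)

    nonsquare⇒N·x≡t : ∀ {x} → (∀ y → x ≢ y ∙ y) → N · x ≡ t
    nonsquare⇒N·x≡t {x} nonsquare with euler nonsquare
    ... | N′ , n≡ , σ≡ = trans (cong (_· x) (double-injective {N} {N′} (trans (sym n≡N+N) n≡)))
      (trans (sym σ≡) σ≡t)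

    N·x≡ε⊎t : ∀ x → N · x ≡ ε ⊎ N · x ≡ t
    N·x≡ε⊎t x = unique (N · x) (trans (sym (×-homo-+ x N N))
      (trans (cong (_· x) (sym n≡N+N)) (exponent·x≡ε x)))

    -- The quadratic character in additive notation: by Euler's criterion, multiplication by N = n/2
    -- sends non-doubles to `t`, and it sends doubles to `ε`.
    parity : Fin n → Bool
    parity x = does ((N · x) ≟ᶠ t)

    parity-t : ∀ {x} → N · x ≡ t → parity x ≡ true
    parity-t {x} = dec-true ((N · x) ≟ᶠ t)

    parity-ε : ∀ {x} → N · x ≡ ε → parity x ≡ false
    parity-ε {x} eq = dec-false ((N · x) ≟ᶠ t) (λ eq′ → t≢ε (trans (sym eq′) eq))

    evenStructure : EvenStructure G
    evenStructure = record
      { t = t ; t≢ε = t≢ε ; t∙t≡ε = t∙t≡ε ; involution-unique = unique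
      ; parity = parity ; parity-∙ = parity-∙
      ; g = g₀ ; parity-g = parity-t (nonsquare⇒N·x≡t (proj₂ (nonsquare-exists U)))
      ; halve = halve }
      where
      parity-∙ : ∀ x y → parity (x ∙ y) ≡ parity x xor parity y
      parity-∙ x y with N·x≡ε⊎t x | N·x≡ε⊎t y
      ... | inj₁ p | inj₁ q rewrite parity-ε p | parity-ε q = parity-ε
        (trans (×-distrib-+ x y N) (trans (cong₂ _∙_ p q) (identityˡ ε)))
      ... | inj₁ p | inj₂ q rewrite parity-ε p | parity-t q = parity-t
        (trans (×-distrib-+ x y N) (trans (cong₂ _∙_ p q) (identityˡ t)))
      ... | inj₂ p | inj₁ q rewrite parity-t p | parity-ε q = parity-t
        (trans (×-distrib-+ x y N) (trans (cong₂ _∙_ p q) (identityʳ t)))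
      ... | inj₂ p | inj₂ q rewrite parity-t p | parity-t q = parity-ε
        (trans (×-distrib-+ x y N) (trans (cong₂ _∙_ p q) t∙t≡ε))
      halve : ∀ x → parity x ≡ false → ∃[ y ] x ≡ y ∙ y
      halve x even with any? (λ y → x ≟ᶠ (y ∙ y))
      ... | yes r = r
      ... | no ¬r = contradiction (trans (sym (parity-t
        (nonsquare⇒N·x≡t (λ y eq → ¬r (y , eq))))) even) true≢false

-- Sylow 2-subgroups and chromatic numbers

opaque
  two-part : ∀ k → k ≢ 0 → ∃[ c ] ∃[ d ] (k ≡ 2 ^ c * d × odd d ≡ true)
  two-part k = go k k ℕₚ.≤-refl
    where
    go : ∀ fuel k → k ≤ fuel → k ≢ 0 → ∃[ c ] ∃[ d ] (k ≡ 2 ^ c * d × odd d ≡ true)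
    go zero zero _ k≢0 = contradiction refl k≢0
    go (suc fuel) k k≤ k≢0 with odd k in k-odd
    ... | true = 0 , k , sym (ℕₚ.+-identityʳ k) , k-odd
    ... | false with even⇒double k k-odd
    ...   | zero , k≡ = contradiction k≡ k≢0
    ...   | suc j , k≡ with go fuel (suc j) (ℕₚ.≤-pred (ℕₚ.≤-trans
      (subst (suc (suc j) ≤_) (sym k≡) (s≤s (ℕₚ.m≤n+m (suc j) j))) k≤)) (λ ())
    ...     | c , d , j≡ , d-odd = suc c , d , trans k≡ (trans (cong₂ _+_ j≡ j≡) (double (2 ^ c) d)) , d-odd
      where
      double : ∀ m d → m * d + m * d ≡ 2 * m * d
      double m d = trans (cong (m * d +_) (sym (ℕₚ.+-identityʳ (m * d)))) (sym (ℕₚ.*-assoc 2 m d))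

2^c+2^c : ∀ c d → 2 ^ c * d + 2 ^ c * d ≡ 2 ^ suc c * d
2^c+2^c c d = trans (cong (2 ^ c * d +_) (sym (ℕₚ.+-identityʳ (2 ^ c * d)))) (sym (ℕₚ.*-assoc 2 (2 ^ c) d))

module Cardinality where
  open ℕSum

  ∣∣≡sum : ∀ {n} (S : Subset n) → ∣ S ∣ ≡ sum (indicator ∘ lookup S)
  ∣∣≡sum [] = refl
  ∣∣≡sum (true ∷ S) = cong suc (∣∣≡sum S)
  ∣∣≡sum (false ∷ S) = ∣∣≡sum S

  -- Counts the pairs (i, x) with f i = x in two ways.
  image-card : ∀ {n L} (S : Subset n) (f : Fin L → Fin n) → Injective _≡_ _≡_ f →
               (∀ i → f i ∈ S) → (∀ {x} → x ∈ S → ∃[ i ] f i ≡ x) → ∣ S ∣ ≡ L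
  image-card {n} {L} S f f-inj f∈ onto = trans (∣∣≡sum S) (trans (sum-cong-≗ fibres)
    (trans (∑-comm {n} {L} (λ x i → indicator (does (f i ≟ᶠ x))))
      (trans (sum-cong-≗ (λ i → sum-indicator-≡ (f i))) (sum-const-1 L))))
    where
    fibres : ∀ x → indicator (lookup S x) ≡ sum (λ i → indicator (does (f i ≟ᶠ x)))
    fibres x with x ∈? S
    ... | no x∉ = trans (cong indicator (outside-lookup (lookup S x) refl))
                        (sym (trans (sum-cong-≗ (λ i → cong indicator
                          (dec-false (f i ≟ᶠ x) (λ { refl → x∉ (f∈ i) })))) (sum-replicate-zero L)))
      where
      outside-lookup : ∀ b → lookup S x ≡ b → b ≡ false
      outside-lookup true eq = contradiction (lookup⇒[]= x S eq) x∉
      outside-lookup false _ = refl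
    ... | yes x∈ with onto x∈
    ...   | i₀ , refl = trans (cong indicator ([]=⇒lookup x∈))
      (sym (trans (sum-cong-≗ (λ i → cong indicator (same i))) (sum-indicator-≡ i₀)))
      where
      same : ∀ i → does (f i ≟ᶠ f i₀) ≡ does (i₀ ≟ᶠ i)
      same i with i₀ ≟ᶠ i
      ... | yes refl = dec-true (f i ≟ᶠ f i) refl
      ... | no i₀≢i = dec-false (f i ≟ᶠ f i₀) (λ eq → i₀≢i (sym (f-inj eq)))

module Sylow {n : ℕ} {_∙_ : Fin n → Fin n → Fin n} {ε : Fin n} {_⁻¹ : Fin n → Fin n}
             (isAb : IsAbelianGroup _≡_ _∙_ ε _⁻¹) where
  open FinGroup isAb
  open FiniteAbelianGroup G using (_·_; ×-homo-+; ×-assocˡ; ×-distrib-+; identityʳ; exponent·x≡ε)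

  pow≡ : ∀ g k → pow _∙_ ε g k ≡ k · g
  pow≡ g zero = refl
  pow≡ g (suc k) = cong (g ∙_) (pow≡ g k)

  module _ (z : Fin n) where
    open Order G z

    multiple : Fin L → Fin n
    multiple i = toℕ i · z

    multiple-injective : Injective _≡_ _≡_ multiple
    multiple-injective eq = Finₚ.toℕ-injective (·-injective (Finₚ.toℕ<n _) (Finₚ.toℕ<n _) eq)

    multiple-onto : ∀ {k x} → k · z ≡ x → ∃[ i ] multiple i ≡ x
    multiple-onto {k} eq = fromℕ< (DivMod.m%n<n k L) ,
      trans (cong (_· z) (Finₚ.toℕ-fromℕ< (DivMod.m%n<n k L))) (trans (reduce-· k) eq)

    generated? : Decidable (λ x → ∃[ k ] k · z ≡ x)
    generated? x = map′ (λ (i , eq) → toℕ i , eq) (λ (k , eq) → multiple-onto {k} eq)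
      (any? (λ i → multiple i ≟ᶠ x))

    ⟨_⟩ : Subset n
    ⟨_⟩ = tabulate (λ x → does (generated? x))

    generated∈ : ∀ {x} k → k · z ≡ x → x ∈ ⟨_⟩
    generated∈ {x} k eq = lookup⇒[]= x ⟨_⟩ (trans (lookup∘tabulate _ x) (dec-true (generated? x) (k , eq)))

    ∈generated : ∀ {x} → x ∈ ⟨_⟩ → ∃[ k ] k · z ≡ x
    ∈generated {x} x∈ = does⇒ (generated? x) (trans (sym (lookup∘tabulate _ x)) ([]=⇒lookup x∈))

    generated-card : ∣ ⟨_⟩ ∣ ≡ L
    generated-card = Cardinality.image-card ⟨_⟩ multiple multiple-injective (λ i → generated∈ (toℕ i) refl)
      (λ x∈ → let k , eq = ∈generated x∈ in multiple-onto {k} eq)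

    generated-subgroup : IsSubgroup _∙_ ε _⁻¹ ⟨_⟩
    generated-subgroup = generated∈ 0 refl
      , (λ x y x∈ y∈ → let j , p = ∈generated x∈ ; k , q = ∈generated y∈ in
          generated∈ (j + k) (trans (×-homo-+ z j k) (cong₂ _∙_ p q)))
      , (λ x x∈ → let k , p = ∈generated x∈ in generated∈ (neg G k) (trans (neg-· G k z) (cong _⁻¹ p)))

    generated-cyclic : IsCyclic _∙_ ε _⁻¹ ⟨_⟩
    generated-cyclic = z , generated∈ 1 (identityʳ z) ,
      λ h h∈ → let k , p = ∈generated h∈ in k , trans (pow≡ z k) p

    -- The order L is at most 2^(b+1) by minimality. Write L = 2^c d with d odd. If c ≤ b, then L
    -- divides 2^b d, so d · t = ε, against d · t = t. Hence c > b, and L is at least 2^(b+1).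
    two-power-order : ∀ b {t} → t ≢ ε → t ∙ t ≡ ε → (2 ^ b) · z ≡ t → L ≡ 2 ^ suc b
    two-power-order b {t} t≢ε t∙t≡ε 2^b·z≡t with ℕₚ.<-≤-connex (2 ^ suc b) L
    ... | inj₁ P<L = contradiction (order-minimal P<L
        (trans (×-homo-+ z (2 ^ b) (2 ^ b + 0)) (trans (cong₂ _∙_ 2^b·z≡t
          (trans (cong (_· z) (ℕₚ.+-identityʳ (2 ^ b))) 2^b·z≡t)) t∙t≡ε)))
        (ℕ.≢-nonZero⁻¹ (2 ^ suc b) {{ℕₚ.m^n≢0 2 (suc b)}})
    ... | inj₂ L≤P with two-part L (λ ())
    ...   | c , d , L≡ , d-odd with ℕₚ.<-≤-connex b c
    ...     | inj₁ b<c = ℕₚ.≤-antisym L≤P (subst (2 ^ suc b ≤_) (sym L≡)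
        (ℕₚ.≤-trans (ℕₚ.^-monoʳ-≤ 2 b<c) (subst (_≤ 2 ^ c * d) (ℕₚ.*-identityʳ (2 ^ c))
          (ℕₚ.*-monoʳ-≤ (2 ^ c) (positive d d-odd)))))
      where
      positive : ∀ d → odd d ≡ true → 1 ≤ d
      positive (suc d) _ = s≤s z≤n
    ...     | inj₂ c≤b = contradiction (trans (sym (trans (sym (cong (_· z) factor))
      (trans (sym (×-assocˡ z d (2 ^ b)))
          (trans (cong (d ·_) 2^b·z≡t) (odd-· d t∙t≡ε d-odd)))))
        (trans (sym (×-assocˡ z (2 ^ (b ℕ.∸ c)) L)) (trans (cong ((2 ^ (b ℕ.∸ c)) ·_) L·x≡ε)
          (·-ε G (2 ^ (b ℕ.∸ c)))))) t≢ε
      where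
      factor : d * 2 ^ b ≡ 2 ^ (b ℕ.∸ c) * L
      factor = trans (cong (λ e → d * 2 ^ e) (sym (ℕₚ.m∸n+n≡m c≤b)))
        (trans (cong (d *_) (ℕₚ.^-distribˡ-+-* 2 (b ℕ.∸ c) c))
        (trans (ℕₚ.*-comm d _) (trans (ℕₚ.*-assoc (2 ^ (b ℕ.∸ c)) (2 ^ c) d)
          (cong (2 ^ (b ℕ.∸ c) *_) (sym L≡)))))

  CyclicSylow : Set
  CyclicSylow = ∃[ S ] (IsSylow2 _∙_ ε _⁻¹ S × ¬ IsTrivial _∙_ ε _⁻¹ S × IsCyclic _∙_ ε _⁻¹ S)

  generated-sylow : ∀ z b m → n ≡ 2 ^ suc b * m → odd m ≡ true → ∣ ⟨ z ⟩ ∣ ≡ 2 ^ suc b → CyclicSylow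
  generated-sylow z b m n≡ m-odd card = ⟨ z ⟩ ,
      (generated-subgroup z , suc b , card , divides m (trans n≡ (ℕₚ.*-comm (2 ^ suc b) m)) , maximal) ,
      (λ trivial → ℕₚ.1+n≰n (ℕₚ.≤-trans (ℕₚ.^-monoʳ-≤ 2 (s≤s (z≤n {b})))
        (ℕₚ.≤-reflexive (trans (sym card) trivial)))) ,
      generated-cyclic z
    where
    maximal : ¬ (2 ^ suc (suc b)) ∣ n
    maximal 2P∣n with *-cancelˡ-∣ (2 ^ suc b) {{ℕₚ.m^n≢0 2 (suc b)}}
      (≡.subst₂ _∣_ (ℕₚ.*-comm 2 (2 ^ suc b)) n≡ 2P∣n)
    ... | divides j m≡ = true≢false (trans (sym m-odd)
            (trans (cong odd (trans m≡ (trans (ℕₚ.*-comm j 2) (cong (j +_) (ℕₚ.+-identityʳ j)))))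
              (double-even j)))

  -- Write n/2 = 2^b m with m odd. For an odd element g, (n/2) · g = t, so m · g has order 2^(b+1),
  -- the full power of 2 in n.
  uniqueInvolution⇒cyclicSylow : UniqueInvolution → CyclicSylow
  uniqueInvolution⇒cyclicSylow U with two-part (N U) N≢0
    where
    N≢0 : N U ≢ 0
    N≢0 eq = absurd ε (trans (n≡N+N U) (cong₂ _+_ eq eq))
      where
      absurd : ∀ {n} → Fin n → n ≢ 0
      absurd zero ()
  ... | b , m , N≡ , m-odd = generated-sylow (m · g) b m
      (trans (n≡N+N U) (trans (cong₂ _+_ N≡ N≡) (2^c+2^c b m))) m-odd
      (trans (generated-card (m · g)) (two-power-order (m · g) b t≢ε t∙t≡ε
        (trans (×-assocˡ g (2 ^ b) m) (trans (cong (_· g) (sym N≡)) (does⇒ ((N U · g) ≟ᶠ t) parity-g)))))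
    where
    open UniqueInvolution U
    open EvenStructure (evenStructure U) using (g; parity-g)

  -- The generator g of S is not a double in G: if g = 2y, then t = 2^b g = 2^(b+1) y and m · t = n
  -- · y = ε, whereas m · t = t for odd m. Euler's criterion then gives σ = (n/2) · g = m · t = t.
  cyclicSylow⇒sum≢ε : ∀ S → IsSylow2 _∙_ ε _⁻¹ S → ¬ IsTrivial _∙_ ε _⁻¹ S → IsCyclic _∙_ ε _⁻¹ S → σ ≢ ε
  cyclicSylow⇒sum≢ε S (_ , zero , card , _) nontrivial _ = contradiction card nontrivial
  cyclicSylow⇒sum≢ε S ((ε∈ , ∙∈ , _) , suc b , card , divides m n≡ , maximal) _ (g , g∈ , powers) σ≡ε =
    t≢ε (trans (sym (odd-· m t∙t≡ε m-odd)) (trans (sym σ≡m·t) σ≡ε))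
    where
    open Order G g
    P = 2 ^ suc b
    t = (2 ^ b) · g
    ·∈ : ∀ k → (k · g) ∈ S
    ·∈ zero = ε∈
    ·∈ (suc k) = ∙∈ _ _ g∈ (·∈ k)
    L≡P : L ≡ P
    L≡P = trans (sym (Cardinality.image-card S (multiple g) (multiple-injective g) (λ i → ·∈ (toℕ i))
      (λ {x} x∈ → let k , eq = powers x x∈ in multiple-onto g {k} (trans (sym (pow≡ g k)) eq)))) card
    double-t : ∀ x → ((2 ^ b) · x) ∙ ((2 ^ b) · x) ≡ P · x
    double-t x = trans (sym (×-homo-+ x (2 ^ b) (2 ^ b)))
      (cong (λ e → (2 ^ b + e) · x) (sym (ℕₚ.+-identityʳ (2 ^ b))))
    t∙t≡ε : t ∙ t ≡ ε
    t∙t≡ε = trans (double-t g) (trans (cong (_· g) (sym L≡P)) L·x≡ε)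
    t≢ε : t ≢ ε
    t≢ε eq = ℕ.≢-nonZero⁻¹ (2 ^ b) {{ℕₚ.m^n≢0 2 b}} (order-minimal
      (subst (2 ^ b <_) (sym L≡P) (ℕₚ.^-monoʳ-< 2 (s≤s (s≤s z≤n)) (ℕₚ.n<1+n b))) eq)
    m-odd : odd m ≡ true
    m-odd with odd m in eq
    ... | true = refl
    ... | false with even⇒double m eq
    ...   | j , m≡ = contradiction (divides j (trans n≡
      (trans (cong (_* P) m≡) (trans (cong (_* P) (trans (cong (j +_) (sym (ℕₚ.+-identityʳ j)))
        (ℕₚ.*-comm 2 j))) (ℕₚ.*-assoc j 2 P))))) maximal
    nonsquare : ∀ y → g ≢ y ∙ y
    nonsquare y g≡ = t≢ε (trans (sym (odd-· m t∙t≡ε m-odd)) (trans (cong (m ·_) t≡P·y)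
      (trans (×-assocˡ y m P) (trans (cong (_· y) (sym n≡)) (exponent·x≡ε y)))))
      where
      t≡P·y : t ≡ P · y
      t≡P·y = trans (cong ((2 ^ b) ·_) g≡) (trans (×-distrib-+ y y (2 ^ b)) (double-t y))
    σ≡m·t : σ ≡ m · t
    σ≡m·t with euler nonsquare
    ... | N , n≡N+N , σ≡ = trans σ≡ (trans (cong (_· g) N≡) (sym (×-assocˡ g m (2 ^ b))))
      where
      N≡ : N ≡ m * 2 ^ b
      N≡ = double-injective {N} {m * 2 ^ b} (trans (sym n≡N+N)
        (trans n≡ (trans (cong (λ e → m * (2 ^ b + e)) (ℕₚ.+-identityʳ (2 ^ b)))
          (ℕₚ.*-distribˡ-+ m (2 ^ b) (2 ^ b)))))

  noCyclicSylow⇒sum≡ε : (∀ S → IsSylow2 _∙_ ε _⁻¹ S → IsTrivial _∙_ ε _⁻¹ S ⊎ ¬ IsCyclic _∙_ ε _⁻¹ S) →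
    σ ≡ ε
  noCyclicSylow⇒sum≡ε noCyclic = decidable-stable (σ ≟ᶠ ε) λ σ≢ε →
    let S , sylow , nontrivial , cyclic = uniqueInvolution⇒cyclicSylow (sum≢ε⇒uniqueInvolution σ≢ε)
    in [ nontrivial , (λ ¬cyclic → ¬cyclic cyclic) ]′ (noCyclic S sylow)

-- Bounds for the number of colours

module Chromatic {n : ℕ} {_∙_ : Fin n → Fin n → Fin n} {ε : Fin n} {_⁻¹ : Fin n → Fin n}
                 (isAb : IsAbelianGroup _≡_ _∙_ ε _⁻¹) where
  open FinGroup isAb
  open FiniteAbelianGroup G using (𝒢)
  open import Algebra.Properties.CommutativeMonoid.Sum (AbelianGroup.commutativeMonoid 𝒢)
  private
    module S = LinearSolver 𝒢

  distinct-rows : ∀ {k c} → IsColoring (cayley _∙_) k c → ∀ {i i′ j} → c (i , j) ≡ c (i′ , j) → i ≡ i′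
  distinct-rows proper {i} {i′} {j} eq with i ≟ᶠ i′
  ... | yes i≡i′ = i≡i′
  ... | no i≢i′ = contradiction eq (proper (i , j) (i′ , j)
    ((λ p → i≢i′ (cong proj₁ p)) , inj₂ (inj₁ refl)))

  distinct-columns : ∀ {k c} → IsColoring (cayley _∙_) k c → ∀ {i j j′} → c (i , j) ≡ c (i , j′) → j ≡ j′
  distinct-columns proper {i} {j} {j′} eq with j ≟ᶠ j′
  ... | yes j≡j′ = j≡j′
  ... | no j≢j′ = contradiction eq (proper (i , j) (i , j′) ((λ p → j≢j′ (cong proj₂ p)) , inj₁ refl))

  n≤colours : ∀ {k} → Colorable (cayley _∙_) k → n ≤ k
  n≤colours (c , proper) = injective⇒≤ {f = λ j → c (ε , j)} (distinct-columns proper)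

  sum-injective : ∀ {f : Fin n → Fin n} → Injective _≡_ _≡_ f → sum f ≡ σ
  sum-injective {f} f-inj = sym (sum-permute id (permutation f f⁻ f∘f⁻ (λ x → f-inj (f∘f⁻ (f x)))))
    where
    f⁻ : Fin n → Fin n
    f⁻ y = proj₁ (injective⇒surjective f-inj y)
    f∘f⁻ : ∀ y → f (f⁻ y) ≡ y
    f∘f⁻ y = proj₂ (injective⇒surjective f-inj y)

  -- A transversal would give σ + σ = σ.
  missing-row : ∀ {k c} → IsColoring (cayley _∙_) k c → σ ≢ ε → ∀ κ → ∃[ i ] (∀ j → c (i , j) ≢ κ)
  missing-row {k} {c} proper σ≢ε κ with any? (λ i → all? (λ j → ¬? (c (i , j) ≟ᶠ κ)))
  ... | yes found = found
  ... | no none = contradiction (S.solve 2 (λ s s′ → s ≜ s ⊕ s ∷ [] ⊢ s ≜ 𝟘) (σ ∷ σ ∷ [])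
      (trans (sym (sum-injective symbols)) (trans (∑-distrib-+ id f)
        (cong (σ ∙_) (sum-injective columns))) ∷ [])) σ≢ε
    where
    hit : ∀ i → ∃[ j ] c (i , j) ≡ κ
    hit i with any? (λ j → c (i , j) ≟ᶠ κ)
    ... | yes h = h
    ... | no ¬h = contradiction (i , λ j eq → ¬h (j , eq)) none
    f : Fin n → Fin n
    f i = proj₁ (hit i)
    c-f : ∀ i i′ → c (i , f i) ≡ c (i′ , f i′)
    c-f i i′ = trans (proj₂ (hit i)) (sym (proj₂ (hit i′)))
    columns : Injective _≡_ _≡_ f
    columns {i} {i′} eq = distinct-rows proper (trans (c-f i i′) (cong (λ j → c (i′ , j)) (sym eq)))
    symbols : Injective _≡_ _≡_ (λ i → i ∙ f i)
    symbols {i} {i′} eq with i ≟ᶠ i′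
    ... | yes i≡i′ = i≡i′
    ... | no i≢i′ = contradiction (c-f i i′) (proper (i , f i) (i′ , f i′)
      ((λ p → i≢i′ (cong proj₁ p)) , inj₂ (inj₂ eq)))

-- Colour κ omits the row `r κ`, so a cell is determined by its colour and its place among the other
-- l = n - 1 rows, which gives n² ≤ kl. But (l + 2)l is one less than (l + 1)².
n+2≤colours : ∀ {n} {_∙_ : Fin n → Fin n → Fin n} {ε : Fin n} {_⁻¹ : Fin n → Fin n}
              (isAb : IsAbelianGroup _≡_ _∙_ ε _⁻¹) → FinGroup.σ isAb ≢ ε →
              ∀ {k} → Colorable (cayley _∙_) k → n + 2 ≤ k
n+2≤colours {zero} {ε = ()}
n+2≤colours {suc l} {_∙_} isAb σ≢ε {k} (c , proper) = bound
  where
  open Chromatic isAb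
  n = suc l
  r : Fin k → Fin n
  r κ = proj₁ (missing-row proper σ≢ε κ)
  r≢ : ∀ i j → r (c (i , j)) ≢ i
  r≢ i j eq = proj₂ (missing-row proper σ≢ε (c (i , j))) j (cong (λ i → c (i , j)) eq)
  code : Fin n × Fin n → Fin (k * l)
  code (i , j) = combine (c (i , j)) (punchOut (r≢ i j))
  same-row : ∀ {κ κ′ i i′} → κ ≡ κ′ → (p : r κ ≢ i) (p′ : r κ′ ≢ i′) → punchOut p ≡ punchOut p′ → i ≡ i′
  same-row refl p p′ eq = punchOut-injective p p′ eq
  code-injective : ∀ x y → code x ≡ code y → x ≡ y
  code-injective (i , j) (i′ , j′) eq with Finₚ.combine-injective _ _ _ _ eq
  ... | κ≡ , row≡ with same-row κ≡ (r≢ i j) (r≢ i′ j′) row≡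
  ...   | refl = cong (i ,_) (distinct-columns proper κ≡)
  cells : n * n ≤ k * l
  cells = injective⇒≤ {f = code ∘ remQuot n} λ {x} {y} eq →
    trans (sym (Finₚ.combine-remQuot n x)) (trans (cong (uncurry combine) (code-injective _ _ eq))
      (Finₚ.combine-remQuot n y))
  bound : n + 2 ≤ k
  bound with ℕₚ.<-≤-connex k (n + 2)
  ... | inj₂ le = le
  ... | inj₁ k< = contradiction cells (ℕₚ.<⇒≱ (ℕₚ.≤-<-trans (ℕₚ.*-monoˡ-≤ l k≤) small))
    where
    k≤ : k ≤ suc (suc l)
    k≤ = ℕₚ.≤-pred (subst (suc k ≤_) (ℕₚ.+-comm n 2) k<)
    small : suc (suc l) * l < suc l * suc l
    small = subst (suc (l + (l + l * l)) ≤_) (cong (suc l +_) (sym (ℕₚ.*-suc l l))) ℕₚ.≤-refl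

extend : ∀ {n} → Fin n ⊎ Bool → Fin (n + 2)
extend {n} (inj₁ x) = join n 2 (inj₁ x)
extend {n} (inj₂ false) = join n 2 (inj₂ zero)
extend {n} (inj₂ true) = join n 2 (inj₂ (suc zero))

extend-injective : ∀ {n} (x y : Fin n ⊎ Bool) → extend x ≡ extend y → x ≡ y
extend-injective {n} x y eq = trans (sym (retract x)) (trans (cong recover eq) (retract y))
  where
  back : Fin n ⊎ Fin 2 → Fin n ⊎ Bool
  back (inj₁ x) = inj₁ x
  back (inj₂ zero) = inj₂ false
  back (inj₂ (suc _)) = inj₂ true
  recover : Fin (n + 2) → Fin n ⊎ Bool
  recover i = back (splitAt n i)
  retract : ∀ x → recover (extend x) ≡ x
  retract (inj₁ x) = cong back (Finₚ.splitAt-join n 2 (inj₁ x))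
  retract (inj₂ false) = cong back (Finₚ.splitAt-join n 2 (inj₂ zero))
  retract (inj₂ true) = cong back (Finₚ.splitAt-join n 2 (inj₂ (suc zero)))

module Upper {n : ℕ} {_∙_ : Fin n → Fin n → Fin n} {ε : Fin n} {_⁻¹ : Fin n → Fin n}
             (isAb : IsAbelianGroup _≡_ _∙_ ε _⁻¹) where
  open FinGroup isAb
  open FiniteAbelianGroup G using (𝒢)
  private
    module S = LinearSolver 𝒢

  colouring⇒colorable : Colouring G → Colorable (cayley _∙_) (n + 2)
  colouring⇒colorable χ = (λ (i , j) → extend (colour i j)) , λ x y (x≢y , share) eq →
    let p , q = proper (extend-injective _ _ eq) share in x≢y (cong₂ _,_ p q)
    where open Colouring χ

  -- Colour κ consists of the cells (i, a i + κ), whose symbols (a i + i) + κ are distinct since `a`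
  -- is a complete mapping.
  completeMapping⇒colorable : Hall.Solvable isAb id → Colorable (cayley _∙_) n
  completeMapping⇒colorable (a , a-inj , a∙-inj) = c , λ (i , j) (i′ , j′) (x≢y , share) eq → x≢y
    (same share eq)
    where
    c : Fin n × Fin n → Fin n
    c (i , j) = j ∙ (a i ⁻¹)
    same : ∀ {i j i′ j′} → i ≡ i′ ⊎ j ≡ j′ ⊎ i ∙ j ≡ i′ ∙ j′ → c (i , j) ≡ c (i′ , j′) → (i , j) ≡ (i′ , j′)
    same {i} {j} {i′} {j′} share eq = cong₂ _,_ (i≡ share) (j≡ (i≡ share))
      where
      i≡ : i ≡ i′ ⊎ j ≡ j′ ⊎ i ∙ j ≡ i′ ∙ j′ → i ≡ i′
      i≡ (inj₁ p) = p
      i≡ (inj₂ (inj₁ p)) = a-inj (S.solve 4 (λ j j′ a a′ → j ≜ j′ ∷ j ⊖ a ≜ j′ ⊖ a′ ∷ [] ⊢ a ≜ a′)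
        (j ∷ j′ ∷ a i ∷ a i′ ∷ []) (p ∷ eq ∷ []))
      i≡ (inj₂ (inj₂ p)) = a∙-inj (S.solve 6
        (λ i i′ j j′ a a′ → i ⊕ j ≜ i′ ⊕ j′ ∷ j ⊖ a ≜ j′ ⊖ a′ ∷ [] ⊢ a ⊕ i ≜ a′ ⊕ i′)
        (i ∷ i′ ∷ j ∷ j′ ∷ a i ∷ a i′ ∷ []) (p ∷ eq ∷ []))
      j≡ : i ≡ i′ → j ≡ j′
      j≡ refl = S.solve 3 (λ j j′ a → j ⊖ a ≜ j′ ⊖ a ∷ [] ⊢ j ≜ j′) (j ∷ j′ ∷ a i ∷ []) (eq ∷ [])

  sum≢ε⇒chromatic : σ ≢ ε → ChromaticNumber (cayley _∙_) (n + 2)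
  sum≢ε⇒chromatic σ≢ε = colouring⇒colorable (colouring G (evenStructure (sum≢ε⇒uniqueInvolution σ≢ε))) ,
    λ k k<n+2 χ → ℕₚ.<⇒≱ k<n+2 (n+2≤colours isAb σ≢ε χ)

  completeMapping⇒chromatic : Hall.Solvable isAb id → ChromaticNumber (cayley _∙_) n
  completeMapping⇒chromatic solvable = completeMapping⇒colorable solvable ,
    λ k k<n χ → ℕₚ.<⇒≱ k<n (Chromatic.n≤colours isAb χ)

theorem1p6 : (n : ℕ) (_∙_ : Fin n → Fin n → Fin n) (ε : Fin n) (_⁻¹ : Fin n → Fin n)
    → IsAbelianGroup _≡_ _∙_ ε _⁻¹
    → (((S : Subset n) → IsSylow2 _∙_ ε _⁻¹ S → IsTrivial _∙_ ε _⁻¹ S ⊎ ¬ IsCyclic _∙_ ε _⁻¹ S)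
    → ChromaticNumber (cayley _∙_) n)
    × ((∃[ S ] (IsSylow2 _∙_ ε _⁻¹ S × ¬ IsTrivial _∙_ ε _⁻¹ S × IsCyclic _∙_ ε _⁻¹ S))
    → ChromaticNumber (cayley _∙_) (n + 2))
theorem1p6 zero _ () 
theorem1p6 (suc m) _∙_ ε _⁻¹ isAb =
  (λ noCyclic → completeMapping⇒chromatic (sum-zero⇒solvable isAb id
    (Sylow.noCyclicSylow⇒sum≡ε isAb noCyclic))) ,
  (λ (S , sylow , nontrivial , cyclic) → sum≢ε⇒chromatic
    (Sylow.cyclicSylow⇒sum≢ε isAb S sylow nontrivial cyclic))
  where open Upper isAb
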